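{- For every $k \in \mathbb{N}$ there exist constants $c^l_k$ and $c^u_k$ such that for all sufficiently large even $n$, the $k$-th smallest Laplacian eigenvalues (counted with multiplicity) of $\Gamma^l_n$ and $\Gamma^u_n$ satisfy $\lambda_k(\Gamma^l_n) \le c^l_k$ and $\lambda_k(\Gamma^u_n) \le c^u_k$.
   Context: A cubic graph is a connected graph, possibly with loops and multiple edges, in which every vertex has degree $3$ (a loop contributes $2$ to the degree of its vertex). Its vertices may be labelled (an $n$-vertex labelled cubic graph has vertex set $\{1,\dots,n\}$) or unlabelled (cubic graphs are then considered up to isomorphism). Whitehead move: let $e$ be a non-loop edge of a cubic graph with endpoints $u_1 \ne u_2$. Apart from the two halves of $e$, there are two half-edges at $u_1$ and two half-edges at $u_2$. A Whitehead move on $e$ chooses one of the two at $u_1$ and one of the two at $u_2$ and swaps them, i.e. the chosen half-edge at $u_1$ is reattached to $u_2$ and the chosen half-edge at $u_2$ is reattached to $u_1$; everything else is unchanged. (This gives at most $4$ moves on $e$ for labelled graphs and at most $2$ up to isomorphism for unlabelled graphs. The result is again a cubic graph, and Whitehead moves are reversible.) For even $n \in \mathbb{N}$ ($n\ge 2$), $\Gamma^l_n$ (resp. $\Gamma^u_n$) is the simple undirected graph whose vertices are all $n$-vertex labelled (resp. unlabelled) cubic graphs, with two distinct cubic graphs adjacent if and only if one can be transformed into the other by a single Whitehead move. For a finite simple graph $G$ on $N$ vertices, the Laplacian matrix is $Q(G) = D(G) - A(G)$, where $D(G)$ is the diagonal matrix of vertex degrees and $A(G)$ is the adjacency matrix.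 Its eigenvalues, counted with multiplicity, are written $\lambda_1(G) \le \lambda_2(G) \le \cdots \le \lambda_N(G)$. -}

module Defs where

open import Data.Bool.Base using (if_then_else_)
open import Data.Fin.Base using (Fin; zero; suc; toℕ; fromℕ<; finToFun; funToFin)
import Data.Fin.Base as Fin
open import Data.Fin.Permutation using (Permutation′; permutation; _⟨$⟩ʳ_; _⟨$⟩ˡ_; inverseˡ; inverseʳ)
open import Data.Fin.Properties using (_≟_; any?; all?; toℕ<n; toℕ-injective; finToFun-funToFin)
open import Data.Integer.Base as ℤ using (ℤ; +_)
open import Data.List.Base as List using (List; []; _∷_; cartesianProduct; cartesianProductWith; allFin; deduplicate; filter)
open import Data.Nat.Base as ℕ using (ℕ; zero; suc; _⊔_)
open import Data.Nat.DivMod using () renaming (_/_ to _div_)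
import Data.Nat.Properties as ℕ
open import Data.Product using (_×_; _,_; ∃; ∃-syntax; Σ-syntax; proj₁; proj₂; swap)
open import Data.Rational.Base as ℚ using (ℚ; 0ℚ; 1ℚ; ½; ∣_∣)
import Data.Rational.Properties as ℚ
open import Data.Rational.Solver using (module +-*-Solver)
open import Data.Sum.Base as Sum using (_⊎_; inj₁; inj₂)
open import Data.Vec.Base as Vec using (Vec; []; _∷_; lookup; count; concat; _[_]%=_; _[_]≔_)
open import Data.Vec.Functional using (Vector; foldr)
open import Data.Vec.Relation.Unary.Any as Any using (Any)
open import Level using (0ℓ)
open import Relation.Binary.Core using (Rel)
open import Relation.Binary.Construct.Closure.ReflexiveTransitive using (Star; _◅_; _◅◅_) renaming (ε to stop)
open import Relation.Binary.Definitions using (Decidable; Symmetric; Irreflexive)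
open import Relation.Binary.PropositionalEquality
  using (_≡_; _≢_; refl; sym; trans; cong; cong₂; subst; subst₂)
open import Relation.Nullary.Decidable using (Dec; yes; no; does; map′; _×-dec_; _⊎-dec_; ¬?)

------------------------------------------------------------------------
-- Reals are Cauchy sequences of rationals; their equality is the setoid
-- equality _≈_, not _≡_.

Cauchy : (ℕ → ℚ) → Set
Cauchy s = ∀ ε → 0ℚ ℚ.< ε →
           ∃[ N ] ∀ m n → N ℕ.≤ m → N ℕ.≤ n → ∣ s m ℚ.- s n ∣ ℚ.< ε

record ℝ : Set where
  constructor mkℝ
  field
    seq    : ℕ → ℚ
    cauchy : Cauchy seq

open ℝ public

infix  4 _≈_ _≤_
infixl 6 _+_
infixl 7 _*_

_≈_ : Rel ℝ 0ℓ
x ≈ y = ∀ ε → 0ℚ ℚ.< ε →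
        ∃[ N ] ∀ n → N ℕ.≤ n → ∣ seq x n ℚ.- seq y n ∣ ℚ.< ε

_≤_ : Rel ℝ 0ℓ
x ≤ y = ∀ ε → 0ℚ ℚ.< ε →
        ∃[ N ] ∀ n → N ℕ.≤ n → seq x n ℚ.≤ seq y n ℚ.+ ε

fromℚ : ℚ → ℝ
fromℚ q = mkℝ (λ _ → q) λ ε 0<ε → 0 , λ _ _ _ _ →
  subst (ℚ._< ε) (sym (cong ∣_∣ (ℚ.+-inverseʳ q))) 0<ε

fromℤ : ℤ → ℝ
fromℤ z = fromℚ (z ℚ./ 1)

0ℝ : ℝ
0ℝ = fromℚ 0ℚ

private
  *-pos : ∀ p {q} .{{_ : ℚ.Positive p}} → 0ℚ ℚ.< q → 0ℚ ℚ.< p ℚ.* q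
  *-pos p {q} 0<q = subst (ℚ._< p ℚ.* q) (ℚ.*-zeroʳ p) (ℚ.*-monoʳ-<-pos p 0<q)

  half-pos : ∀ {ε} → 0ℚ ℚ.< ε → 0ℚ ℚ.< ½ ℚ.* ε
  half-pos = *-pos ½

  triangle : ∀ p q {r} → p ℚ.+ q ≡ r → ∣ r ∣ ℚ.≤ ∣ p ∣ ℚ.+ ∣ q ∣
  triangle p q refl = ℚ.∣p+q∣≤∣p∣+∣q∣ p q

  halves : ∀ ε → ½ ℚ.* ε ℚ.+ ½ ℚ.* ε ≡ ε
  halves = solve 1 (λ e → con ½ :* e :+ con ½ :* e := e) refl
    where open +-*-Solver

  half<self : ∀ {ε} → 0ℚ ℚ.< ε → ½ ℚ.* ε ℚ.< ε
  half<self {ε} 0<ε = subst₂ ℚ._<_ (ℚ.+-identityʳ _) (halves ε)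
    (ℚ.+-monoʳ-< (½ ℚ.* ε) (half-pos 0<ε))

opaque
  +-cauchy : ∀ x y → Cauchy (λ n → seq x n ℚ.+ seq y n)
  +-cauchy x y ε 0<ε =
    let Nx , px = cauchy x (½ ℚ.* ε) (half-pos 0<ε)
        Ny , py = cauchy y (½ ℚ.* ε) (half-pos 0<ε)
    in Nx ⊔ Ny , λ m n N≤m N≤n →
       ℚ.≤-<-trans
         (triangle (seq x m ℚ.- seq x n) (seq y m ℚ.- seq y n)
            (rearrange (seq x m) (seq y m) (seq x n) (seq y n)))
         (ℚ.<-≤-trans
            (ℚ.+-mono-<
              (px m n (ℕ.m⊔n≤o⇒m≤o Nx Ny N≤m) (ℕ.m⊔n≤o⇒m≤o Nx Ny N≤n))
              (py m n (ℕ.m⊔n≤o⇒n≤o Nx Ny N≤m) (ℕ.m⊔n≤o⇒n≤o Nx Ny N≤n)))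
            (ℚ.≤-reflexive (halves ε)))
    where
    rearrange : ∀ a b c d → (a ℚ.- c) ℚ.+ (b ℚ.- d) ≡ (a ℚ.+ b) ℚ.- (c ℚ.+ d)
    rearrange = solve 4 (λ a b c d → (a :- c) :+ (b :- d) := (a :+ b) :- (c :+ d)) refl
      where open +-*-Solver

_+_ : ℝ → ℝ → ℝ
x + y = mkℝ (λ n → seq x n ℚ.+ seq y n) (+-cauchy x y)

private
  bounded : ∀ x → ∃[ B ] (0ℚ ℚ.< B × ∃[ N ] ∀ n → N ℕ.≤ n → ∣ seq x n ∣ ℚ.≤ B)
  bounded x with cauchy x 1ℚ (ℚ.positive⁻¹ 1ℚ)
  ... | N , p = 1ℚ ℚ.+ ∣ seq x N ∣
              , ℚ.+-mono-<-≤ (ℚ.positive⁻¹ 1ℚ) (ℚ.0≤∣p∣ (seq x N))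
              , N , λ n N≤n →
                  ℚ.≤-trans
                    (triangle (seq x n ℚ.- seq x N) (seq x N) (cancel (seq x n) (seq x N)))
                    (ℚ.+-monoˡ-≤ ∣ seq x N ∣ (ℚ.<⇒≤ (p n N N≤n ℕ.≤-refl)))
    where
    cancel : ∀ a b → (a ℚ.- b) ℚ.+ b ≡ a
    cancel = solve 2 (λ a b → (a :- b) :+ b := a) refl
      where open +-*-Solver

  scale : ∀ {B ε} → 0ℚ ℚ.< B → 0ℚ ℚ.< ε → ∃[ δ ] (0ℚ ℚ.< δ × B ℚ.* δ ≡ ε)
  scale {B} {ε} 0<B 0<ε = B⁻¹ ℚ.* ε
    , *-pos B⁻¹ 0<ε
    , trans (sym (ℚ.*-assoc B B⁻¹ ε))
        (trans (cong (ℚ._* ε) (ℚ.*-inverseʳ B)) (ℚ.*-identityˡ ε))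
    where
    instance
      B-pos : ℚ.Positive B
      B-pos = ℚ.positive 0<B
      B-nonZero : ℚ.NonZero B
      B-nonZero = ℚ.pos⇒nonZero B
    B⁻¹ : ℚ
    B⁻¹ = ℚ.1/ B
    instance
      B⁻¹-pos : ℚ.Positive B⁻¹
      B⁻¹-pos = ℚ.1/pos⇒pos B

  ∣*∣-mono : ∀ {p q B δ} → 0ℚ ℚ.< B → ∣ p ∣ ℚ.≤ B → ∣ q ∣ ℚ.< δ → ∣ p ℚ.* q ∣ ℚ.≤ B ℚ.* δ
  ∣*∣-mono {p} {q} {B} {δ} 0<B p≤B q<δ = ℚ.≤-trans (ℚ.≤-reflexive (ℚ.∣p*q∣≡∣p∣*∣q∣ p q))
    (ℚ.≤-trans
      (ℚ.*-monoʳ-≤-nonNeg ∣ q ∣ {{ℚ.nonNegative (ℚ.0≤∣p∣ q)}} p≤B)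
      (ℚ.*-monoˡ-≤-nonNeg B {{ℚ.nonNegative (ℚ.<⇒≤ 0<B)}} (ℚ.<⇒≤ q<δ)))

opaque
  *-cauchy : ∀ x y → Cauchy (λ n → seq x n ℚ.* seq y n)
  *-cauchy x y ε 0<ε =
    let Bx , 0<Bx , Mx , bx = bounded x
        By , 0<By , My , by = bounded y
        δ , 0<δ , Bδ≡½ε     = scale (ℚ.+-mono-< 0<Bx 0<By) (half-pos 0<ε)
        Nx , px             = cauchy x δ 0<δ
        Ny , py             = cauchy y δ 0<δ
        M = Mx ⊔ My
        N = Nx ⊔ Ny
    in M ⊔ N , λ m n ≤m ≤n →
       let M≤m = ℕ.m⊔n≤o⇒m≤o M N ≤m
           M≤n = ℕ.m⊔n≤o⇒m≤o M N ≤n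
           N≤m = ℕ.m⊔n≤o⇒n≤o M N ≤m
           N≤n = ℕ.m⊔n≤o⇒n≤o M N ≤n
       in ℚ.≤-<-trans
            (triangle (seq x m ℚ.* (seq y m ℚ.- seq y n)) (seq y n ℚ.* (seq x m ℚ.- seq x n))
              (rearrange (seq x m) (seq y m) (seq x n) (seq y n)))
            (ℚ.≤-<-trans
              (ℚ.+-mono-≤
                (∣*∣-mono {seq x m} 0<Bx (bx m (ℕ.m⊔n≤o⇒m≤o Mx My M≤m))
                  (py m n (ℕ.m⊔n≤o⇒n≤o Nx Ny N≤m) (ℕ.m⊔n≤o⇒n≤o Nx Ny N≤n)))
                (∣*∣-mono {seq y n} 0<By (by n (ℕ.m⊔n≤o⇒n≤o Mx My M≤n))
                  (px m n (ℕ.m⊔n≤o⇒m≤o Nx Ny N≤m) (ℕ.m⊔n≤o⇒m≤o Nx Ny N≤n))))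
              (subst (ℚ._< ε) (trans (sym Bδ≡½ε) (ℚ.*-distribʳ-+ δ Bx By)) (half<self 0<ε)))
    where
    rearrange : ∀ a b c d → a ℚ.* (b ℚ.- d) ℚ.+ d ℚ.* (a ℚ.- c) ≡ a ℚ.* b ℚ.- c ℚ.* d
    rearrange = solve 4 (λ a b c d → a :* (b :- d) :+ d :* (a :- c) := a :* b :- c :* d) refl
      where open +-*-Solver

_*_ : ℝ → ℝ → ℝ
x * y = mkℝ (λ n → seq x n ℚ.* seq y n) (*-cauchy x y)

------------------------------------------------------------------------
∑ : ∀ {N} → Vector ℝ N → ℝ
∑ = foldr _+_ 0ℝ

Matrix : ℕ → Set
Matrix N = Fin N → Fin N → ℝ

_*ᵥ_ : ∀ {N} → Matrix N → Vector ℝ N → Vector ℝ N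
(M *ᵥ x) i = ∑ λ j → M i j * x j

LinearlyIndependent : ∀ {k N} → (Fin k → Vector ℝ N) → Set
LinearlyIndependent {k} v =
  ∀ (a : Vector ℝ k) → (∀ j → (∑ λ i → a i * v i j) ≈ 0ℝ) → ∀ i → a i ≈ 0ℝ

-- For a symmetric matrix (the only case used) ℝᴺ is the direct sum of the
-- eigenspaces, so an independent family of N eigenvectors meets each
-- eigenspace in a basis of it: every eigenvalue occurs in λs exactly as often
-- as its multiplicity, and λs is determined by M up to _≈_.
record IsSpectrum {N} (M : Matrix N) (λs : Vector ℝ N) : Set where
  field
    sorted       : ∀ i j → i Fin.≤ j → λs i ≤ λs j
    eigenvectors : Fin N → Vector ℝ N
    eigen        : ∀ i j → (M *ᵥ eigenvectors i) j ≈ λs i * eigenvectors i j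
    independent  : LinearlyIndependent eigenvectors

------------------------------------------------------------------------
record SimpleGraph : Set₁ where
  field
    order      : ℕ
    Adj        : Rel (Fin order) 0ℓ
    adj?       : Decidable Adj
    adj-sym    : Symmetric Adj
    adj-irrefl : Irreflexive _≡_ Adj

module _ (G : SimpleGraph) where
  open SimpleGraph G

  degreeOf : Fin order → ℕ
  degreeOf i = List.length (filter (adj? i) (allFin order))

  degreeMatrix adjacencyMatrix : Fin order → Fin order → ℤ
  degreeMatrix    i j = if does (i ≟ j) then + degreeOf i else + 0
  adjacencyMatrix i j = if does (adj? i j) then + 1 else + 0

  laplacian : Matrix order
  laplacian i j = fromℤ (degreeMatrix i j ℤ.- adjacencyMatrix i j)

-- λₖ(G) ≤ c, with k counted from 1; in particular G has at least k vertices.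
KthLaplacianEigenvalue≤ : SimpleGraph → ℕ → ℝ → Set
KthLaplacianEigenvalue≤ G k c =
  Σ[ i ∈ Fin order ] (suc (toℕ i) ≡ k ×
    (∀ (λs : Vector ℝ order) → IsSpectrum (laplacian G) λs → λs i ≤ c))
  where open SimpleGraph G

------------------------------------------------------------------------
-- An edge is the vector of the vertices at which its two half-edges are
-- attached. The names Fin m of the edges and their orientations are only a
-- presentation: they are forgotten by the relations _≋_ and _≅_ below.

Edge : ℕ → Set
Edge n = Vec (Fin n) 2

Multigraph : ℕ → ℕ → Set
Multigraph n m = Vec (Edge n) m

HalfEdge : ℕ → Set
HalfEdge m = Fin m × Fin 2

module _ {n m : ℕ} where

  end : Multigraph n m → HalfEdge m → Fin n
  end G (e , s) = lookup (lookup G e) s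

  reattach : HalfEdge m → Fin n → Multigraph n m → Multigraph n m
  reattach (e , s) v G = G [ e ]%= (_[ s ]≔ v)

  -- A loop occurs twice at its vertex in the list of attachments.
  degree : Multigraph n m → Fin n → ℕ
  degree G v = count (_≟ v) (concat G)

  Joins : Fin n → Fin n → Edge n → Set
  Joins u v (x ∷ y ∷ []) = (x ≡ u × y ≡ v) ⊎ (x ≡ v × y ≡ u)

  joins? : ∀ u v e → Dec (Joins u v e)
  joins? u v (x ∷ y ∷ []) = (x ≟ u ×-dec y ≟ v) ⊎-dec (x ≟ v ×-dec y ≟ u)

  Neighbours : Multigraph n m → Rel (Fin n) 0ℓ
  Neighbours G u v = Any (Joins u v) G

  Connected : Multigraph n m → Set
  Connected G = ∀ u v → Star (Neighbours G) u v

  Cubic : Multigraph n m → Set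
  Cubic G = (∀ v → degree G v ≡ 3) × Connected G

  multiplicity : Multigraph n m → Fin n → Fin n → ℕ
  multiplicity G u v = count (joins? u v) G

  -- G and H present the same labelled multigraph: they have the same multiset
  -- of unordered pairs as edges.
  _≋_ : Rel (Multigraph n m) 0ℓ
  G ≋ H = ∀ u v → multiplicity G u v ≡ multiplicity H u v

  _≅_ : Rel (Multigraph n m) 0ℓ
  G ≅ H = Σ[ π ∈ Permutation′ n ]
    (∀ u v → multiplicity G u v ≡ multiplicity H (π ⟨$⟩ʳ u) (π ⟨$⟩ʳ v))

  -- h₁ and h₂ are the chosen half-edges at the two ends of the non-loop edge e.
  AdmissibleChoice : Multigraph n m → Fin m → HalfEdge m → HalfEdge m → Set
  AdmissibleChoice G e h₁ h₂ =
      u₁ ≢ u₂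
    × (proj₁ h₁ ≢ e × end G h₁ ≡ u₁)
    × (proj₁ h₂ ≢ e × end G h₂ ≡ u₂)
    where
    u₁ = end G (e , zero)
    u₂ = end G (e , suc zero)

  whitehead : Multigraph n m → Fin m → HalfEdge m → HalfEdge m → Multigraph n m
  whitehead G e h₁ h₂ =
    reattach h₁ (end G (e , suc zero)) (reattach h₂ (end G (e , zero)) G)

  WhiteheadMove : Rel (Multigraph n m) 0ℓ → Rel (Multigraph n m) 0ℓ
  WhiteheadMove _∼_ G H = ∃[ e ] ∃[ e₁ ] ∃[ s₁ ] ∃[ e₂ ] ∃[ s₂ ]
    (AdmissibleChoice G e (e₁ , s₁) (e₂ , s₂) × whitehead G e (e₁ , s₁) (e₂ , s₂) ∼ H)

------------------------------------------------------------------------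
-- Reachability is decided by Warshall's algorithm:
-- Via k relates vertices joined by a path with intermediate vertices < k.

module Reachability {n : ℕ} {R : Rel (Fin n) 0ℓ} (R? : Decidable R) where

  Via : ℕ → Rel (Fin n) 0ℓ
  Via zero    u v = u ≡ v ⊎ R u v
  Via (suc k) u v = Via k u v ⊎ ∃[ w ] (toℕ w ≡ k × Via k u w × Via k w v)

  via? : ∀ k → Decidable (Via k)
  via? zero    u v = u ≟ v ⊎-dec R? u v
  via? (suc k) u v = via? k u v ⊎-dec
    any? λ w → (toℕ w ℕ.≟ k) ×-dec (via? k u w ×-dec via? k w v)

  sound : ∀ k {u v} → Via k u v → Star R u v
  sound zero    (inj₁ refl)            = stop
  sound zero    (inj₂ r)               = r ◅ stop
  sound (suc k) (inj₁ p)               = sound k p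
  sound (suc k) (inj₂ (w , _ , p , q)) = sound k p ◅◅ sound k q

  base : ∀ k {u v} → Via zero u v → Via k u v
  base zero    p = p
  base (suc k) p = inj₁ (base k p)

  via-trans : ∀ k {u w v} → toℕ w ℕ.< k → Via k u w → Via k w v → Via k u v
  via-trans (suc k) {u} {w} {v} w<1+k p q with toℕ w ℕ.≟ k
  ... | yes w≡k = inj₂ (w , w≡k , to p , from q)
    where
    to : Via (suc k) u w → Via k u w
    to (inj₁ p) = p
    to (inj₂ (z , z≡k , p , _)) = subst (Via k u) (toℕ-injective (trans z≡k (sym w≡k))) p
    from : Via (suc k) w v → Via k w v
    from (inj₁ q) = q
    from (inj₂ (z , z≡k , _ , q)) =
      subst (λ x → Via k x v) (toℕ-injective (trans z≡k (sym w≡k))) q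
  ... | no w≢k = go p q
    where
    w<k : toℕ w ℕ.< k
    w<k = ℕ.≤∧≢⇒< (ℕ.s≤s⁻¹ w<1+k) w≢k
    go : Via (suc k) u w → Via (suc k) w v → Via (suc k) u v
    go (inj₁ p) (inj₁ q) = inj₁ (via-trans k w<k p q)
    go (inj₁ p) (inj₂ (z , z≡k , q , q′)) = inj₂ (z , z≡k , via-trans k w<k p q , q′)
    go (inj₂ (z , z≡k , p , p′)) (inj₁ q) = inj₂ (z , z≡k , p , via-trans k w<k p′ q)
    go (inj₂ (z , z≡k , p , _)) (inj₂ (z′ , z′≡k , _ , q′)) =
      inj₂ (z , z≡k , p , subst (λ x → Via k x v) (toℕ-injective (trans z′≡k (sym z≡k))) q′)

  complete : ∀ {u v} → Star R u v → Via n u v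
  complete stop     = base n (inj₁ refl)
  complete (r ◅ rs) = via-trans n (toℕ<n _) (base n (inj₂ r)) (complete rs)

  star? : Decidable (Star R)
  star? u v = map′ (sound n) complete (via? n u v)

anyPermutation? : ∀ {n} {P : (Fin n → Fin n) → Set} →
                  (∀ {f g} → (∀ i → f i ≡ g i) → P f → P g) →
                  (∀ f → Dec (P f)) → Dec (Σ[ π ∈ Permutation′ n ] P (π ⟨$⟩ʳ_))
anyPermutation? {n} {P} resp P? = map′ to from
  (any? λ (c : Fin (n ℕ.^ n)) → any? λ (d : Fin (n ℕ.^ n)) →
     all? (λ i → finToFun c (finToFun d i) ≟ i) ×-dec
     (all? (λ i → finToFun d (finToFun c i) ≟ i) ×-dec P? (finToFun c)))
  where
  Codes : Set
  Codes = ∃[ c ] ∃[ d ] ((∀ (i : Fin n) → finToFun {n} {n} c (finToFun {n} {n} d i) ≡ i) ×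
                         (∀ i → finToFun {n} {n} d (finToFun {n} {n} c i) ≡ i) ×
                         P (finToFun c))
  to : Codes → Σ[ π ∈ Permutation′ n ] P (π ⟨$⟩ʳ_)
  to (c , d , cd , dc , p) = permutation (finToFun c) (finToFun d) cd dc , p
  from : Σ[ π ∈ Permutation′ n ] P (π ⟨$⟩ʳ_) → Codes
  from (π , p) = funToFin f , funToFin g
    , (λ i → trans (f≗ _) (trans (cong f (g≗ i)) (inverseʳ π)))
    , (λ i → trans (g≗ _) (trans (cong g (f≗ i)) (inverseˡ π)))
    , resp (λ i → sym (f≗ i)) p
    where
    f g : Fin n → Fin n
    f = π ⟨$⟩ʳ_
    g = π ⟨$⟩ˡ_
    f≗ : ∀ i → finToFun (funToFin f) i ≡ f i
    f≗ = finToFun-funToFin f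
    g≗ : ∀ i → finToFun (funToFin g) i ≡ g i
    g≗ = finToFun-funToFin g

module _ {n m : ℕ} where

  cubic? : (G : Multigraph n m) → Dec (Cubic G)
  cubic? G = all? (λ v → degree G v ℕ.≟ 3) ×-dec all? λ u → all? λ v → star? u v
    where open Reachability {R = Neighbours G} (λ u v → Any.any? (joins? {n} {m} u v) G)

  _≋?_ : Decidable (_≋_ {n} {m})
  G ≋? H = all? λ u → all? λ v → multiplicity G u v ℕ.≟ multiplicity H u v

  _≅?_ : Decidable (_≅_ {n} {m})
  G ≅? H = anyPermutation?
    (λ f≗g p u v → trans (p u v) (cong₂ (multiplicity H) (f≗g u) (f≗g v)))
    (λ f → all? λ u → all? λ v → multiplicity G u v ℕ.≟ multiplicity H (f u) (f v))

  whiteheadMove? : ∀ {_∼_ : Rel (Multigraph n m) 0ℓ} → Decidable _∼_ →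
                   Decidable (WhiteheadMove _∼_)
  whiteheadMove? _∼?_ G H =
    any? λ e → any? λ e₁ → any? λ s₁ → any? λ e₂ → any? λ s₂ →
      (¬? (_ ≟ _) ×-dec ((¬? (_ ≟ _) ×-dec (_ ≟ _)) ×-dec (¬? (_ ≟ _) ×-dec (_ ≟ _))))
      ×-dec (_ ∼? H)

------------------------------------------------------------------------
allVecs : ∀ {A : Set} → List A → ∀ m → List (Vec A m)
allVecs xs zero    = [] ∷ []
allVecs xs (suc m) = cartesianProductWith _∷_ xs (allVecs xs m)

allMultigraphs : ∀ n m → List (Multigraph n m)
allMultigraphs n m = allVecs (allVecs (allFin n) 2) m

-- A cubic graph on n vertices has 3n/2 edges, since the degrees add up to
-- twice the number of edges.
edgeCount : ℕ → ℕ
edgeCount n = (3 ℕ.* n) div 2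

module _ (n : ℕ) {_∼_ : Rel (Multigraph n (edgeCount n)) 0ℓ} (_∼?_ : Decidable _∼_) where

  cubicGraphs : List (Multigraph n (edgeCount n))
  cubicGraphs = deduplicate _∼?_ (filter cubic? (allMultigraphs n (edgeCount n)))

  -- One vertex for each ∼-class of cubic graphs on Fin n.
  whiteheadGraph : SimpleGraph
  whiteheadGraph = record
    { order      = List.length cubicGraphs
    ; Adj        = λ i j → i ≢ j × (Move i j ⊎ Move j i)
    ; adj?       = λ i j → ¬? (i ≟ j) ×-dec (move? i j ⊎-dec move? j i)
    ; adj-sym    = λ (i≢j , p) → (λ j≡i → i≢j (sym j≡i)) , Sum.swap p
    ; adj-irrefl = λ i≡j (i≢j , _) → i≢j i≡j
    }
    where
    Move : Rel (Fin (List.length cubicGraphs)) 0ℓ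
    Move i j = WhiteheadMove _∼_ (List.lookup cubicGraphs i) (List.lookup cubicGraphs j)
    move? : Decidable Move
    move? i j = whiteheadMove? _∼?_ (List.lookup cubicGraphs i) (List.lookup cubicGraphs j)

Γˡ Γᵘ : ℕ → SimpleGraph
Γˡ n = whiteheadGraph n _≋?_
Γᵘ n = whiteheadGraph n _≅?_

{-# OPTIONS --safe #-}

-- Test functions constant on the classes of a vertex colouring bound λₖ: if each
-- of k nonempty colour classes has on average at most C edges to other colours per
-- vertex, the span of the k indicator functions has Rayleigh quotients at most 2 C.
--
-- Labelled graphs are coloured by their number t of loops.  A move changes t only
-- at a loop or at a double edge, so it is enough that graphs with t loops have
-- boundedly many double edges on average.  Given a double edge uv and any other
-- edge gh, replacing one copy of uv and gh by ug and vh keeps the graph connected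
-- and t unchanged; for each graph there are about n choices of gh for every double
-- edge, while the result together with the path g u v h, one of at most 27 n such
-- paths, determines the original.
--
-- Unlabelled graphs are too symmetric for this count.  There the k classes are
-- single vertices of bounded degree: the graphs with edges from aᵢ to bᵢ, bᵢ₊₁ and
-- bᵢ₊ₛ, indices modulo n/2, have two vertex orbits, hence O(1) moves up to
-- isomorphism, and for s = 8ᵗ their diameters are too far apart for any two of them
-- to be isomorphic.
module Submission where

-- Constructive reals shape the spectral half. Their order is undecidable, so neither signs nor
-- pivots can be chosen, and the eigenvectors come only as an independent family. But `≤` is stable
-- under double negation, so inside the proof of an inequality every such choice may be made, and
-- the variational bound is arranged to avoid orthogonality and division.
--
-- In the labelled half only averages can be bounded: a single graph may contain linearly many
-- double edges and then has linearly many moves that change its loop number. The replacement of uv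
-- and gh is a device for comparing cardinalities; it does not have to be a Whitehead move.
--
-- In the unlabelled half the base 8 comes from two estimates of the diameter. With N = n/2, the
-- graph with parameter s has diameter at least about N/(2s) and at most about 2N/s + 2s. The main
-- terms differ by a factor 4, so parameters whose ratio exceeds 4 are separated for large n, and
-- the ratio 8 leaves ample room for the lower-order terms. The resulting constant is the same for
-- all k.

-- Finite counting: indicators, codes, dependent products of lists.

module Counting where
  import Algebra.Properties.Semiring.Sum as Sum
  open import Data.Fin.Base using (Fin; zero; suc; punchIn)
  open import Data.Fin.Properties using (_≟_; injective⇒≤; punchInᵢ≢i)
  open import Data.List.Base using (List; []; _∷_; _++_; length; map; lookup; allFin; filter; tabulate)
  open import Data.List.Membership.DecPropositional using (_∈?_)
  open import Data.List.Membership.Propositional using (_∈_)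
  open import Data.List.Membership.Propositional.Properties
    using (∈-lookup; ∈-map⁺; ∈-map⁻; ∈-++⁺ˡ; ∈-++⁺ʳ; ∈-++⁻; ∈-allFin; ∈-filter⁺)
  open import Data.List.Properties using (length-++; length-map; length-tabulate)
  import Data.List.Relation.Unary.All as All
  open import Data.List.Relation.Unary.Any using (here; there; index)
  open import Data.List.Relation.Unary.Any.Properties using (lookup-index)
  open import Data.List.Relation.Unary.AllPairs using (AllPairs; []; _∷_)
  open import Data.List.Relation.Unary.Unique.Propositional using (Unique)
  import Data.List.Relation.Unary.Unique.Propositional.Properties as Unique
  open import Data.Nat.Base using (ℕ; zero; suc; _+_; _*_; _≤_; z≤n)
  open import Data.Nat.ListAction using (sum)
  open import Data.Nat.Properties hiding (_≟_)
  open import Data.Nat.Solver using (module +-*-Solver)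
  open import Data.Product using (_×_; _,_; ∃-syntax; proj₁; proj₂)
  open import Data.Sum.Base using (inj₁; inj₂)
  open import Function.Base using (_∘_; id)
  open import Level using (0ℓ)
  open import Relation.Binary.Core using (Rel)
  open import Relation.Binary.Definitions using (Symmetric)
  open import Relation.Binary.PropositionalEquality
  open import Relation.Nullary.Decidable using (Dec; yes; no; ¬?)
  open import Relation.Nullary.Negation using (¬_; contradiction)
  open import Relation.Unary using (Decidable)

  module ℕΣ = Sum +-*-semiring

  private
    variable
      A B : Set

  lookup-injective : ∀ {_∼_ : Rel A 0ℓ} → Symmetric _∼_ → ∀ {xs} → AllPairs (λ x y → ¬ x ∼ y) xs →
    ∀ i j → lookup xs i ∼ lookup xs j → i ≡ j
  lookup-injective ∼-sym (p ∷ ps) zero    zero    r = refl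
  lookup-injective ∼-sym (p ∷ ps) zero    (suc j) r = contradiction r (All.lookup p (∈-lookup j))
  lookup-injective ∼-sym (p ∷ ps) (suc i) zero    r = contradiction (∼-sym r) (All.lookup p (∈-lookup i))
  lookup-injective ∼-sym (p ∷ ps) (suc i) (suc j) r = cong suc (lookup-injective ∼-sym ps i j r)

  indicator : ∀ {p} {P : Set p} → Dec P → ℕ
  indicator (yes _) = 1
  indicator (no _)  = 0

  indicator-yes : ∀ {p} {P : Set p} (P? : Dec P) → P → indicator P? ≡ 1
  indicator-yes (yes _) p = refl
  indicator-yes (no ¬p) p = contradiction p ¬p

  indicator-no : ∀ {p} {P : Set p} (P? : Dec P) → ¬ P → indicator P? ≡ 0
  indicator-no (yes p) ¬p = contradiction p ¬p
  indicator-no (no _)  ¬p = refl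

  indicator-cong : ∀ {p q} {P : Set p} {Q : Set q} (P? : Dec P) (Q? : Dec Q) → (P → Q) → (Q → P) →
    indicator P? ≡ indicator Q?
  indicator-cong (yes p) Q? f g = sym (indicator-yes Q? (f p))
  indicator-cong (no ¬p) Q? f g = sym (indicator-no Q? λ q → ¬p (g q))

  indicator-≥1 : ∀ {p} {P : Set p} (P? : Dec P) → 1 ≤ indicator P? → P
  indicator-≥1 (yes p) _ = p

  sum-zeros : ∀ {n} {f : Fin n → ℕ} → (∀ i → f i ≡ 0) → ℕΣ.sum f ≡ 0
  sum-zeros {n} h = trans (ℕΣ.sum-cong-≗ {n} h) (ℕΣ.sum-replicate-zero n)

  sum-single : ∀ {n} (v : Fin n) → ℕΣ.sum (λ w → indicator (v ≟ w)) ≡ 1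
  sum-single {suc n} v = trans (ℕΣ.sum-remove {i = v} λ w → indicator (v ≟ w))
    (cong₂ _+_ (indicator-yes (v ≟ v) refl)
      (trans (ℕΣ.sum-cong-≗ {n} λ j → indicator-no (v ≟ punchIn v j) (punchInᵢ≢i v j ∘ sym)) (ℕΣ.sum-replicate-zero n)))

  sum-mono-≤ : ∀ {n} {f g : Fin n → ℕ} → (∀ i → f i ≤ g i) → ℕΣ.sum f ≤ ℕΣ.sum g
  sum-mono-≤ {zero}  h = z≤n
  sum-mono-≤ {suc n} h = +-mono-≤ (h zero) (sum-mono-≤ (h ∘ suc))

  filter-length : ∀ {A : Set} {P : A → Set} (P? : Decidable P) {n} (f : Fin n → A) →
    length (filter P? (tabulate f)) ≡ ℕΣ.sum (λ i → indicator (P? (f i)))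
  filter-length P? {zero}  f = refl
  filter-length P? {suc n} f with P? (f zero)
  ... | yes _ = cong suc (filter-length P? (f ∘ suc))
  ... | no _  = filter-length P? (f ∘ suc)

  -- `R` need not be a function: an element may have several codes, and the one used may depend on
  -- the membership proof. Two positions with the same code carry equal entries, and `Unique` then
  -- makes the positions equal.
  length-≤-by-coding : ∀ {xs : List A} {ys : List B} (R : A → B → Set) → Unique xs →
    (∀ {x} → x ∈ xs → ∃[ y ] (y ∈ ys × R x y)) →
    (∀ {x x′ y} → R x y → R x′ y → x ≡ x′) → length xs ≤ length ys
  length-≤-by-coding {xs = xs} {ys} R unique code decode = injective⇒≤ {f = f} λ {i} {j} eq →
      lookup-injective sym unique i j (decode (related i) (subst (λ k → R (lookup xs j) (lookup ys k)) (sym eq) (related j)))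
    where
    f : Fin (length xs) → Fin (length ys)
    f i = index (proj₁ (proj₂ (code (∈-lookup i))))
    related : ∀ i → R (lookup xs i) (lookup ys (f i))
    related i = let y , y∈ys , r = code (∈-lookup i) in subst (R (lookup xs i)) (lookup-index y∈ys) r

  sum-map-≤ : ∀ (f g : A → ℕ) xs → (∀ {x} → x ∈ xs → f x ≤ g x) → sum (map f xs) ≤ sum (map g xs)
  sum-map-≤ f g []       h = z≤n
  sum-map-≤ f g (x ∷ xs) h = +-mono-≤ (h (here refl)) (sum-map-≤ f g xs (h ∘ there))

  sum-map-≤-* : ∀ (f : A → ℕ) c xs → (∀ {x} → x ∈ xs → f x ≤ c) → sum (map f xs) ≤ c * length xs
  sum-map-≤-* f c []       h = z≤n
  sum-map-≤-* f c (x ∷ xs) h = ≤-trans (+-mono-≤ (h (here refl)) (sum-map-≤-* f c xs (h ∘ there)))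
    (≤-reflexive (sym (*-suc c (length xs))))

  *-≤-sum-map : ∀ (f : A → ℕ) c xs → (∀ {x} → x ∈ xs → c ≤ f x) → c * length xs ≤ sum (map f xs)
  *-≤-sum-map f c []       h = ≤-reflexive (*-zeroʳ c)
  *-≤-sum-map f c (x ∷ xs) h = ≤-trans (≤-reflexive (*-suc c (length xs)))
    (+-mono-≤ (h (here refl)) (*-≤-sum-map f c xs (h ∘ there)))

  sum-map-affine : ∀ (f : A → ℕ) c d xs → sum (map (λ x → c * f x + d) xs) ≡ c * sum (map f xs) + d * length xs
  sum-map-affine f c d []       = sym (trans (cong₂ _+_ (*-zeroʳ c) (*-zeroʳ d)) refl)
  sum-map-affine f c d (x ∷ xs) = begin
    c * f x + d + sum (map (λ x → c * f x + d) xs)        ≡⟨ cong (c * f x + d +_) (sum-map-affine f c d xs) ⟩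
    c * f x + d + (c * s + d * l)                         ≡⟨ solve 5 (λ c y d s l → c :* y :+ d :+ (c :* s :+ d :* l) :=
                                                                c :* (y :+ s) :+ d :* (con 1 :+ l)) refl c (f x) d s l ⟩
    c * (f x + s) + d * suc l                             ∎
    where
    open ≡-Reasoning
    open +-*-Solver
    s = sum (map f xs)
    l = length xs

  infixr 5 _⊗_
  -- The list version of a Σ-type. Iterated, it lists paths whose next vertex ranges over the
  -- neighbours of an earlier one.
  _⊗_ : List A → (A → List B) → List (A × B)
  []       ⊗ f = []
  (x ∷ xs) ⊗ f = map (x ,_) (f x) ++ (xs ⊗ f)

  length-⊗ : ∀ xs (f : A → List B) → length (xs ⊗ f) ≡ sum (map (length ∘ f) xs)
  length-⊗ []       f = refl
  length-⊗ (x ∷ xs) f = trans (length-++ (map (x ,_) (f x)))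
    (cong₂ _+_ (length-map (x ,_) (f x)) (length-⊗ xs f))

  length-⊗-≤ : ∀ xs (f : A → List B) c → (∀ {x} → x ∈ xs → length (f x) ≤ c) → length (xs ⊗ f) ≤ c * length xs
  length-⊗-≤ xs f c h = ≤-trans (≤-reflexive (length-⊗ xs f)) (sum-map-≤-* (length ∘ f) c xs h)

  ∈-⊗⁺ : ∀ {xs} {f : A → List B} {x y} → x ∈ xs → y ∈ f x → (x , y) ∈ xs ⊗ f
  ∈-⊗⁺ (here refl) q = ∈-++⁺ˡ (∈-map⁺ _ q)
  ∈-⊗⁺ {xs = x′ ∷ _} {f} (there p) q = ∈-++⁺ʳ (map (x′ ,_) (f x′)) (∈-⊗⁺ p q)

  ∈-⊗⁻ : ∀ xs {f : A → List B} {x y} → (x , y) ∈ xs ⊗ f → x ∈ xs × y ∈ f x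
  ∈-⊗⁻ (x′ ∷ xs) {f} r with ∈-++⁻ (map (x′ ,_) (f x′)) r
  ... | inj₂ r′ = let p , q = ∈-⊗⁻ xs r′ in there p , q
  ... | inj₁ r′ with _ , q , refl ← ∈-map⁻ (x′ ,_) r′ = here refl , q

  ⊗-unique : ∀ {xs} {f : A → List B} → Unique xs → (∀ x → Unique (f x)) → Unique (xs ⊗ f)
  ⊗-unique [] h = []
  ⊗-unique {xs = x ∷ xs} {f} (x∉ ∷ u) h =
    Unique.++⁺ (Unique.map⁺ (λ { refl → refl }) (h x)) (⊗-unique u h) disjoint
    where
    disjoint : ∀ {z} → ¬ (z ∈ map (x ,_) (f x) × z ∈ xs ⊗ f)
    disjoint (p , q) with _ , _ , refl ← ∈-map⁻ (x ,_) p = All.lookup x∉ (proj₁ (∈-⊗⁻ xs q)) refl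

  outside : ∀ {n} → List (Fin n) → List (Fin n)
  outside {n} bad = filter (λ v → ¬? (_∈?_ _≟_ v bad)) (allFin n)

  length-outside : ∀ {n} (bad : List (Fin n)) → n ≤ length (outside bad) + length bad
  length-outside {n} bad = ≤-trans (≤-reflexive (sym (length-tabulate id)))
    (≤-trans (length-≤-by-coding _≡_ (Unique.allFin⁺ n) (λ {v} _ → v , place v , refl) (λ { refl refl → refl }))
      (≤-reflexive (length-++ (outside bad))))
    where
    place : ∀ v → v ∈ outside bad ++ bad
    place v with _∈?_ _≟_ v bad
    ... | yes v∈ = ∈-++⁺ʳ (outside bad) v∈
    ... | no v∉  = ∈-++⁺ˡ (∈-filter⁺ _ (∈-allFin v) v∉)

-- The axioms under which the linear algebra is done.

module OrderedRings where
  open import Algebra.Bundles using (CommutativeRing)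
  open import Algebra.Solver.Ring.AlmostCommutativeRing using (fromCommutativeRing; _-Raw-AlmostCommutative⟶_)
  import Data.Integer.Properties as ℤ
  open import Level using (0ℓ)
  open import Relation.Binary.Core using (Rel)
  open import Relation.Nullary.Negation using (¬_)

  -- Neither a total order nor inverses are asked for, since signs of constructive reals cannot be
  -- decided. Stability and `≰⇒≥` stand in for totality, and `*-cancelˡ-≈0` for division. `integers`
  -- gives the ring solver coefficients with decidable equality, and it also carries the entries of
  -- the Laplacian.
  record OrderedRing : Set₁ where
    infix 4 _≤_
    field
      commutativeRing : CommutativeRing 0ℓ 0ℓ
    open CommutativeRing commutativeRing public
    field
      integers     : CommutativeRing.rawRing ℤ.+-*-commutativeRing
                     -Raw-AlmostCommutative⟶ fromCommutativeRing commutativeRing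
      _≤_          : Rel Carrier 0ℓ
      ≤-reflexive  : ∀ {x y} → x ≈ y → x ≤ y
      ≤-trans      : ∀ {x y z} → x ≤ y → y ≤ z → x ≤ z
      ≤-antisym    : ∀ {x y} → x ≤ y → y ≤ x → x ≈ y
      ≤-stable     : ∀ {x y} → ¬ ¬ x ≤ y → x ≤ y
      ≰⇒≥          : ∀ {x y} → ¬ x ≤ y → y ≤ x
      +-mono-≤     : ∀ {x x′ y y′} → x ≤ x′ → y ≤ y′ → (x + y) ≤ (x′ + y′)
      *-≥0         : ∀ {x y} → 0# ≤ x → 0# ≤ y → 0# ≤ (x * y)
      x*x≥0        : ∀ x → 0# ≤ (x * x)
      ≈-stable     : ∀ {x y} → ¬ ¬ x ≈ y → x ≈ y
      *-cancelˡ-≈0 : ∀ {x y} → ¬ x ≈ 0# → (x * y) ≈ 0# → y ≈ 0#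
      1≉0          : ¬ 1# ≈ 0#

-- The Cauchy reals as an ordered ring.

module Reals where
  open import Algebra.Bundles using (CommutativeRing)
  open import Data.Integer.Base as ℤ using (+_)
  open import Data.Nat.Base as ℕ using (ℕ; _⊔_)
  import Data.Integer.Properties as ℤ
  import Data.Nat.Properties as ℕ
  open import Data.Product using (_×_; _,_; ∃-syntax; proj₁; proj₂)
  open import Data.Rational.Base as ℚ using (ℚ; 0ℚ; 1ℚ; ½; ∣_∣)
  import Data.Rational.Properties as ℚ
  import Data.Rational.Unnormalised.Base as ℚᵘ
  import Data.Rational.Unnormalised.Properties as ℚᵘ
  open import Data.Rational.Solver using (module +-*-Solver)
  open import Data.Sum.Base using (_⊎_; inj₁; inj₂)
  open import Defs
  open OrderedRings using (OrderedRing)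
  open import Level using (0ℓ)
  open import Relation.Binary.PropositionalEquality using (_≡_; refl; sym; trans; cong; cong₂; subst; subst₂)
  open import Relation.Nullary.Decidable using (yes; no)
  open import Relation.Nullary.Negation using (¬_; contradiction)

  open +-*-Solver using (solve; _:+_; _:*_; :-_; _:-_; _:=_; con)

  private
    variable
      p q r ε : ℚ

    half-pos : 0ℚ ℚ.< ε → 0ℚ ℚ.< ½ ℚ.* ε
    half-pos {ε} 0<ε = subst (ℚ._< ½ ℚ.* ε) (ℚ.*-zeroʳ ½) (ℚ.*-monoʳ-<-pos ½ 0<ε)

    halves : ∀ ε → ½ ℚ.* ε ℚ.+ ½ ℚ.* ε ≡ ε
    halves = solve 1 (λ e → con ½ :* e :+ con ½ :* e := e) refl

    ∣0∣<ε : 0ℚ ℚ.< ε → p ≡ q → ∣ p ℚ.- q ∣ ℚ.< ε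
    ∣0∣<ε {ε} {p} 0<ε refl = subst (ℚ._< ε) (sym (cong ∣_∣ (ℚ.+-inverseʳ p))) 0<ε

    triangle : ∀ p q → p ℚ.+ q ≡ r → ∣ r ∣ ℚ.≤ ∣ p ∣ ℚ.+ ∣ q ∣
    triangle p q refl = ℚ.∣p+q∣≤∣p∣+∣q∣ p q

    sum-halves : ∀ p q → p ℚ.+ q ≡ r → ∣ p ∣ ℚ.< ½ ℚ.* ε → ∣ q ∣ ℚ.< ½ ℚ.* ε → ∣ r ∣ ℚ.< ε
    sum-halves {ε = ε} p q eq hp hq =
      ℚ.≤-<-trans (triangle p q eq) (ℚ.<-≤-trans (ℚ.+-mono-< hp hq) (ℚ.≤-reflexive (halves ε)))

    telescope : ∀ a b c → (a ℚ.- b) ℚ.+ (b ℚ.- c) ≡ a ℚ.- c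
    telescope = solve 3 (λ a b c → (a :- b) :+ (b :- c) := a :- c) refl

    p≤∣p∣ : ∀ p → p ℚ.≤ ∣ p ∣
    p≤∣p∣ p with ℚ.≤-total 0ℚ p
    ... | inj₁ 0≤p = ℚ.≤-reflexive (sym (ℚ.0≤p⇒∣p∣≡p 0≤p))
    ... | inj₂ p≤0 = ℚ.≤-trans p≤0 (ℚ.0≤∣p∣ p)

    ∣-∣-sym : ∀ p q → ∣ p ℚ.- q ∣ ≡ ∣ q ℚ.- p ∣
    ∣-∣-sym p q = trans (cong ∣_∣ (flip p q)) (ℚ.∣-p∣≡∣p∣ (q ℚ.- p))
      where
      flip : ∀ p q → p ℚ.- q ≡ ℚ.- (q ℚ.- p)
      flip = solve 2 (λ p q → p :- q := :- (q :- p)) refl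

    ∣-∣<⇒≤ : ∣ p ℚ.- q ∣ ℚ.< ε → p ℚ.≤ q ℚ.+ ε
    ∣-∣<⇒≤ {p} {q} {ε} h = subst (ℚ._≤ q ℚ.+ ε) (eq p q)
        (ℚ.+-monoʳ-≤ q (ℚ.≤-trans (p≤∣p∣ (p ℚ.- q)) (ℚ.<⇒≤ h)))
      where
      eq : ∀ p q → q ℚ.+ (p ℚ.- q) ≡ p
      eq = solve 2 (λ p q → q :+ (p :- q) := p) refl

    ≤⇒∣-∣< : p ℚ.< q ℚ.+ ε → q ℚ.< p ℚ.+ ε → ∣ p ℚ.- q ∣ ℚ.< ε
    ≤⇒∣-∣< {p} {q} {ε} h₁ h₂ with ℚ.∣p∣≡p∨∣p∣≡-p (p ℚ.- q)
    ... | inj₁ e = subst₂ ℚ._<_ (sym e) (eq q ε) (ℚ.+-monoˡ-< (ℚ.- q) h₁)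
      where
      eq : ∀ q ε → q ℚ.+ ε ℚ.- q ≡ ε
      eq = solve 2 (λ q ε → q :+ ε :- q := ε) refl
    ... | inj₂ e = subst₂ ℚ._<_ (trans (eq′ p q) (sym e)) (eq p ε) (ℚ.+-monoˡ-< (ℚ.- p) h₂)
      where
      eq : ∀ q ε → q ℚ.+ ε ℚ.- q ≡ ε
      eq = solve 2 (λ q ε → q :+ ε :- q := ε) refl
      eq′ : ∀ p q → q ℚ.- p ≡ ℚ.- (p ℚ.- q)
      eq′ = solve 2 (λ p q → q :- p := :- (p :- q)) refl

    half<self : 0ℚ ℚ.< ε → ½ ℚ.* ε ℚ.< ε
    half<self {ε} 0<ε = subst₂ ℚ._<_ (ℚ.+-identityʳ _) (halves ε)
      (ℚ.+-monoʳ-< (½ ℚ.* ε) (half-pos 0<ε))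

  pointwise : ∀ {x y} → (∀ n → seq x n ≡ seq y n) → x ≈ y
  pointwise eq ε 0<ε = 0 , λ n _ → ∣0∣<ε 0<ε (eq n)

  ≈-refl : ∀ {x} → x ≈ x
  ≈-refl {x} = pointwise {x} {x} λ _ → refl

  ≈-sym : ∀ {x y} → x ≈ y → y ≈ x
  ≈-sym {x} {y} h ε 0<ε = let N , p = h ε 0<ε in
    N , λ n N≤n → subst (ℚ._< ε) (∣-∣-sym (seq x n) (seq y n)) (p n N≤n)

  ≈-trans : ∀ {x y z} → x ≈ y → y ≈ z → x ≈ z
  ≈-trans {x} {y} {z} h k ε 0<ε =
    let M , p = h (½ ℚ.* ε) (half-pos 0<ε)
        N , q = k (½ ℚ.* ε) (half-pos 0<ε)
    in M ⊔ N , λ n ≤n → sum-halves (seq x n ℚ.- seq y n) (seq y n ℚ.- seq z n)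
         (telescope (seq x n) (seq y n) (seq z n))
         (p n (ℕ.m⊔n≤o⇒m≤o M N ≤n)) (q n (ℕ.m⊔n≤o⇒n≤o M N ≤n))

  +-cong : ∀ {x x′ y y′} → x ≈ x′ → y ≈ y′ → (x + y) ≈ (x′ + y′)
  +-cong {x} {x′} {y} {y′} h k ε 0<ε =
    let M , p = h (½ ℚ.* ε) (half-pos 0<ε)
        N , q = k (½ ℚ.* ε) (half-pos 0<ε)
    in M ⊔ N , λ n ≤n → sum-halves (seq x n ℚ.- seq x′ n) (seq y n ℚ.- seq y′ n)
         (eq (seq x n) (seq x′ n) (seq y n) (seq y′ n))
         (p n (ℕ.m⊔n≤o⇒m≤o M N ≤n)) (q n (ℕ.m⊔n≤o⇒n≤o M N ≤n))
    where
    eq : ∀ a b c d → (a ℚ.- b) ℚ.+ (c ℚ.- d) ≡ (a ℚ.+ c) ℚ.- (b ℚ.+ d)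
    eq = solve 4 (λ a b c d → (a :- b) :+ (c :- d) := (a :+ c) :- (b :+ d)) refl

  infix 8 -_
  -_ : ℝ → ℝ
  - x = mkℝ (λ n → ℚ.- seq x n) λ ε 0<ε → let N , p = cauchy x ε 0<ε in
    N , λ m n N≤m N≤n → subst (ℚ._< ε)
      (trans (∣-∣-sym (seq x m) (seq x n)) (cong ∣_∣ (eq (seq x m) (seq x n)))) (p m n N≤m N≤n)
    where
    eq : ∀ p q → q ℚ.- p ≡ ℚ.- p ℚ.- (ℚ.- q)
    eq = solve 2 (λ p q → q :- p := :- p :- (:- q)) refl

  -‿cong : ∀ {x y} → x ≈ y → (- x) ≈ (- y)
  -‿cong {x} {y} h ε 0<ε = let N , p = h ε 0<ε in
    N , λ n N≤n → subst (ℚ._< ε)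
      (trans (∣-∣-sym (seq x n) (seq y n)) (cong ∣_∣ (eq (seq x n) (seq y n)))) (p n N≤n)
    where
    eq : ∀ p q → q ℚ.- p ≡ ℚ.- p ℚ.- (ℚ.- q)
    eq = solve 2 (λ p q → q :- p := :- p :- (:- q)) refl

  private
    eventually-bounded : ∀ x → ∃[ B ] (0ℚ ℚ.< B × ∃[ N ] ∀ n → N ℕ.≤ n → ∣ seq x n ∣ ℚ.≤ B)
    eventually-bounded x with cauchy x 1ℚ (ℚ.positive⁻¹ 1ℚ)
    ... | N , p = 1ℚ ℚ.+ ∣ seq x N ∣
                , ℚ.+-mono-<-≤ (ℚ.positive⁻¹ 1ℚ) (ℚ.0≤∣p∣ (seq x N))
                , N , λ n N≤n → ℚ.≤-trans
                    (triangle (seq x n ℚ.- seq x N) (seq x N) (cancel (seq x n) (seq x N)))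
                    (ℚ.+-monoˡ-≤ ∣ seq x N ∣ (ℚ.<⇒≤ (p n N N≤n ℕ.≤-refl)))
      where
      cancel : ∀ a b → (a ℚ.- b) ℚ.+ b ≡ a
      cancel = solve 2 (λ a b → (a :- b) :+ b := a) refl

    quotient : ∀ {B} → 0ℚ ℚ.< B → 0ℚ ℚ.< ε → ∃[ δ ] (0ℚ ℚ.< δ × B ℚ.* δ ≡ ε)
    quotient {ε} {B} 0<B 0<ε = B⁻¹ ℚ.* ε
      , subst (ℚ._< B⁻¹ ℚ.* ε) (ℚ.*-zeroʳ B⁻¹) (ℚ.*-monoʳ-<-pos B⁻¹ 0<ε)
      , trans (sym (ℚ.*-assoc B B⁻¹ ε))
          (trans (cong (ℚ._* ε) (ℚ.*-inverseʳ B)) (ℚ.*-identityˡ ε))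
      where
      instance
        B-pos : ℚ.Positive B
        B-pos = ℚ.positive 0<B
        B-nonZero : ℚ.NonZero B
        B-nonZero = ℚ.pos⇒nonZero B
      B⁻¹ : ℚ
      B⁻¹ = ℚ.1/ B
      instance
        B⁻¹-pos : ℚ.Positive B⁻¹
        B⁻¹-pos = ℚ.1/pos⇒pos B

    ∣*∣<-mono : ∀ {B δ} → 0ℚ ℚ.< B → ∣ p ∣ ℚ.≤ B → ∣ q ∣ ℚ.< δ → ∣ p ℚ.* q ∣ ℚ.< B ℚ.* δ
    ∣*∣<-mono {p} {q} {B} {δ} 0<B p≤B q<δ = ℚ.≤-<-trans (ℚ.≤-reflexive (ℚ.∣p*q∣≡∣p∣*∣q∣ p q))
      (ℚ.≤-<-trans
        (ℚ.*-monoʳ-≤-nonNeg ∣ q ∣ {{ℚ.nonNegative (ℚ.0≤∣p∣ q)}} p≤B)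
        (ℚ.*-monoʳ-<-pos B {{ℚ.positive 0<B}} q<δ))

  *-congˡ : ∀ z {x y} → x ≈ y → (z * x) ≈ (z * y)
  *-congˡ z {x} {y} h ε 0<ε =
    let B , 0<B , M , b = eventually-bounded z
        δ , 0<δ , eq = quotient 0<B 0<ε
        N , p = h δ 0<δ
    in M ⊔ N , λ n ≤n → subst₂ ℚ._<_ (cong ∣_∣ (distrib (seq z n) (seq x n) (seq y n))) eq
         (∣*∣<-mono {seq z n} 0<B (b n (ℕ.m⊔n≤o⇒m≤o M N ≤n)) (p n (ℕ.m⊔n≤o⇒n≤o M N ≤n)))
    where
    distrib : ∀ a b c → a ℚ.* (b ℚ.- c) ≡ a ℚ.* b ℚ.- a ℚ.* c
    distrib = solve 3 (λ a b c → a :* (b :- c) := a :* b :- a :* c) refl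

  *-comm : ∀ x y → (x * y) ≈ (y * x)
  *-comm x y = pointwise {x * y} {y * x} λ n → ℚ.*-comm (seq x n) (seq y n)

  *-cong : ∀ {x x′ y y′} → x ≈ x′ → y ≈ y′ → (x * y) ≈ (x′ * y′)
  *-cong {x} {x′} {y} {y′} h k = ≈-trans {x * y} {x * y′} {x′ * y′} (*-congˡ x {y} {y′} k)
    (≈-trans {x * y′} {y′ * x} {x′ * y′} (*-comm x y′)
      (≈-trans {y′ * x} {y′ * x′} {x′ * y′} (*-congˡ y′ {x} {x′} h) (*-comm y′ x′)))

  1ℝ : ℝ
  1ℝ = fromℚ 1ℚ

  ≤-reflexive : ∀ {x y} → x ≈ y → x ≤ y
  ≤-reflexive {x} {y} h ε 0<ε = let N , p = h ε 0<ε in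
    N , λ n N≤n → ∣-∣<⇒≤ {seq x n} {seq y n} (p n N≤n)

  ≤-trans : ∀ {x y z} → x ≤ y → y ≤ z → x ≤ z
  ≤-trans {x} {y} {z} h k ε 0<ε =
    let M , p = h (½ ℚ.* ε) (half-pos 0<ε)
        N , q = k (½ ℚ.* ε) (half-pos 0<ε)
    in M ⊔ N , λ n ≤n →
      ℚ.≤-trans (p n (ℕ.m⊔n≤o⇒m≤o M N ≤n))
        (ℚ.≤-trans (ℚ.+-monoˡ-≤ (½ ℚ.* ε) (q n (ℕ.m⊔n≤o⇒n≤o M N ≤n)))
          (ℚ.≤-reflexive (trans (ℚ.+-assoc (seq z n) (½ ℚ.* ε) (½ ℚ.* ε))
            (cong (seq z n ℚ.+_) (halves ε)))))

  ≤-antisym : ∀ {x y} → x ≤ y → y ≤ x → x ≈ y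
  ≤-antisym {x} {y} h k ε 0<ε =
    let M , p = h (½ ℚ.* ε) (half-pos 0<ε)
        N , q = k (½ ℚ.* ε) (half-pos 0<ε)
    in M ⊔ N , λ n ≤n → ≤⇒∣-∣< {seq x n} {seq y n}
         (ℚ.≤-<-trans (p n (ℕ.m⊔n≤o⇒m≤o M N ≤n)) (ℚ.+-monoʳ-< (seq y n) (half<self 0<ε)))
         (ℚ.≤-<-trans (q n (ℕ.m⊔n≤o⇒n≤o M N ≤n)) (ℚ.+-monoʳ-< (seq x n) (half<self 0<ε)))

  +-mono-≤ : ∀ {x x′ y y′} → x ≤ x′ → y ≤ y′ → (x + y) ≤ (x′ + y′)
  +-mono-≤ {x} {x′} {y} {y′} h k ε 0<ε =
    let M , p = h (½ ℚ.* ε) (half-pos 0<ε)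
        N , q = k (½ ℚ.* ε) (half-pos 0<ε)
    in M ⊔ N , λ n ≤n → ℚ.≤-trans
         (ℚ.+-mono-≤ (p n (ℕ.m⊔n≤o⇒m≤o M N ≤n)) (q n (ℕ.m⊔n≤o⇒n≤o M N ≤n)))
         (ℚ.≤-reflexive (trans (eq (seq x′ n) (seq y′ n) (½ ℚ.* ε))
           (cong ((seq x′ n ℚ.+ seq y′ n) ℚ.+_) (halves ε))))
    where
    eq : ∀ a b e → (a ℚ.+ e) ℚ.+ (b ℚ.+ e) ≡ (a ℚ.+ b) ℚ.+ (e ℚ.+ e)
    eq = solve 3 (λ a b e → (a :+ e) :+ (b :+ e) := (a :+ b) :+ (e :+ e)) refl

  -- Comparing far-out terms with threshold 4η decides which alternative holds.
  private
    eighth : ℚ → ℚ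
    eighth ε = ½ ℚ.* (½ ℚ.* (½ ℚ.* ε))

    dichotomy : ∀ x y ε → 0ℚ ℚ.< ε →
      ∃[ N ] ((∀ n → N ℕ.≤ n → seq x n ℚ.≤ seq y n ℚ.+ ε) ⊎
              (∀ n → N ℕ.≤ n → seq y n ℚ.+ eighth ε ℚ.≤ seq x n))
    dichotomy x y ε 0<ε = M ⊔ N , by (seq x K ℚ.≤? seq y K ℚ.+ (η ℚ.+ η ℚ.+ η ℚ.+ η))
      where
      η : ℚ
      η = eighth ε
      0<η : 0ℚ ℚ.< η
      0<η = half-pos (half-pos (half-pos 0<ε))
      M N K : ℕ
      M = proj₁ (cauchy x η 0<η)
      N = proj₁ (cauchy y η 0<η)
      K = M ⊔ N
      near : ∀ z → (∀ m n → K ℕ.≤ m → K ℕ.≤ n → ∣ seq z m ℚ.- seq z n ∣ ℚ.< η) →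
             ∀ n → K ℕ.≤ n → seq z n ℚ.≤ seq z K ℚ.+ η × seq z K ℚ.≤ seq z n ℚ.+ η
      near z h n K≤n = ∣-∣<⇒≤ {seq z n} {seq z K} (h n K K≤n ℕ.≤-refl)
                     , ∣-∣<⇒≤ {seq z K} {seq z n} (h K n ℕ.≤-refl K≤n)
      near-x = near x λ m n ≤m ≤n → proj₂ (cauchy x η 0<η) m n (ℕ.m⊔n≤o⇒m≤o M N ≤m) (ℕ.m⊔n≤o⇒m≤o M N ≤n)
      near-y = near y λ m n ≤m ≤n → proj₂ (cauchy y η 0<η) m n (ℕ.m⊔n≤o⇒n≤o M N ≤m) (ℕ.m⊔n≤o⇒n≤o M N ≤n)
      4η : ℚ
      4η = η ℚ.+ η ℚ.+ η ℚ.+ η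
      grow : ∀ b → b ℚ.≤ b ℚ.+ (η ℚ.+ η)
      grow b = subst (ℚ._≤ b ℚ.+ (η ℚ.+ η)) (ℚ.+-identityʳ b)
        (ℚ.+-monoʳ-≤ b (ℚ.<⇒≤ (ℚ.+-mono-< 0<η 0<η)))
      8η : ∀ b e → let h = eighth e in
           b ℚ.+ h ℚ.+ (h ℚ.+ h ℚ.+ h ℚ.+ h) ℚ.+ h ℚ.+ (h ℚ.+ h) ≡ b ℚ.+ e
      8η = solve 2 (λ b e → let h = con ½ :* (con ½ :* (con ½ :* e)) in
        b :+ h :+ (h :+ h :+ h :+ h) :+ h :+ (h :+ h) := b :+ e) refl
      4-2 : ∀ b h → b ℚ.+ h ℚ.+ h ≡ b ℚ.+ (h ℚ.+ h ℚ.+ h ℚ.+ h) ℚ.+ (ℚ.- h ℚ.- h)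
      4-2 = solve 2 (λ b h → b :+ h :+ h := b :+ (h :+ h :+ h :+ h) :+ (:- h :- h)) refl
      1-2 : ∀ a h → a ℚ.+ h ℚ.+ (ℚ.- h ℚ.- h) ℚ.+ h ≡ a
      1-2 = solve 2 (λ a h → a :+ h :+ (:- h :- h) :+ h := a) refl
      by : _ → _
      by (yes x≤) = inj₁ λ n K≤n → begin
        seq x n                                     ≤⟨ proj₁ (near-x n K≤n) ⟩
        seq x K ℚ.+ η                               ≤⟨ ℚ.+-monoˡ-≤ η x≤ ⟩
        seq y K ℚ.+ 4η ℚ.+ η                        ≤⟨ ℚ.+-monoˡ-≤ η (ℚ.+-monoˡ-≤ 4η (proj₂ (near-y n K≤n))) ⟩
        seq y n ℚ.+ η ℚ.+ 4η ℚ.+ η                  ≤⟨ grow _ ⟩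
        seq y n ℚ.+ η ℚ.+ 4η ℚ.+ η ℚ.+ (η ℚ.+ η)    ≡⟨ 8η (seq y n) ε ⟩
        seq y n ℚ.+ ε                               ∎
        where open ℚ.≤-Reasoning
      by (no x≰) = inj₂ λ n K≤n → begin
        seq y n ℚ.+ η                               ≤⟨ ℚ.+-monoˡ-≤ η (proj₁ (near-y n K≤n)) ⟩
        seq y K ℚ.+ η ℚ.+ η                         ≡⟨ 4-2 (seq y K) η ⟩
        seq y K ℚ.+ 4η ℚ.+ (ℚ.- η ℚ.- η)            ≤⟨ ℚ.+-monoˡ-≤ (ℚ.- η ℚ.- η) (ℚ.<⇒≤ (ℚ.≰⇒> x≰)) ⟩
        seq x K ℚ.+ (ℚ.- η ℚ.- η)                   ≤⟨ ℚ.+-monoˡ-≤ (ℚ.- η ℚ.- η) (proj₂ (near-x n K≤n)) ⟩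
        seq x n ℚ.+ η ℚ.+ (ℚ.- η ℚ.- η)             ≤⟨ step _ ⟩
        seq x n ℚ.+ η ℚ.+ (ℚ.- η ℚ.- η) ℚ.+ η       ≡⟨ 1-2 (seq x n) η ⟩
        seq x n                                     ∎
        where
        open ℚ.≤-Reasoning
        step : ∀ b → b ℚ.≤ b ℚ.+ η
        step b = subst (ℚ._≤ b ℚ.+ η) (ℚ.+-identityʳ b) (ℚ.+-monoʳ-≤ b (ℚ.<⇒≤ 0<η))

    -- The strict order in positive form, with an explicit rational gap. `≤` is exactly its
    -- negation, and negations are stable; all double-negation arguments below rest on this.
    Exceeds : ℝ → ℝ → Set
    Exceeds x y = ∃[ δ ] (0ℚ ℚ.< δ × ∃[ N ] ∀ n → N ℕ.≤ n → seq y n ℚ.+ δ ℚ.≤ seq x n)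

    exceeds⇒≰ : ∀ {x y} → Exceeds x y → ¬ x ≤ y
    exceeds⇒≰ {x} {y} (δ , 0<δ , M , p) x≤y =
      let N , q = x≤y (½ ℚ.* δ) (half-pos 0<δ) in
      ℚ.<-irrefl refl (ℚ.<-≤-trans (ℚ.+-monoʳ-< (seq y (M ⊔ N)) (half<self 0<δ))
        (ℚ.≤-trans (p (M ⊔ N) (ℕ.m≤m⊔n M N)) (q (M ⊔ N) (ℕ.m≤n⊔m M N))))

    exceeds⇒≥ : ∀ {x y} → Exceeds x y → y ≤ x
    exceeds⇒≥ {x} {y} (δ , 0<δ , M , p) ε 0<ε = M , λ n M≤n →
      ℚ.≤-trans (grow (seq y n) 0<δ) (ℚ.≤-trans (p n M≤n) (grow (seq x n) 0<ε))
      where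
      grow : ∀ {r} b → 0ℚ ℚ.< r → b ℚ.≤ b ℚ.+ r
      grow {r} b 0<r = subst (ℚ._≤ b ℚ.+ r) (ℚ.+-identityʳ b) (ℚ.+-monoʳ-≤ b (ℚ.<⇒≤ 0<r))

    ¬exceeds⇒≤ : ∀ {x y} → ¬ Exceeds x y → x ≤ y
    ¬exceeds⇒≤ {x} {y} ¬e ε 0<ε with dichotomy x y ε 0<ε
    ... | N , inj₁ p = N , p
    ... | N , inj₂ p = contradiction (eighth ε , half-pos (half-pos (half-pos 0<ε)) , N , p) ¬e

  ≤-stable : ∀ {x y} → ¬ ¬ x ≤ y → x ≤ y
  ≤-stable {x} {y} h = ¬exceeds⇒≤ {x} {y} λ e → h (exceeds⇒≰ {x} {y} e)

  ≰⇒≥ : ∀ {x y} → ¬ x ≤ y → y ≤ x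
  ≰⇒≥ {x} {y} h = ≤-stable {y} {x} λ ¬y≤x → h (¬exceeds⇒≤ {x} {y} λ e → ¬y≤x (exceeds⇒≥ {x} {y} e))

  ≈-stable : ∀ {x y} → ¬ ¬ x ≈ y → x ≈ y
  ≈-stable {x} {y} h = ≤-antisym {x} {y}
    (≤-stable {x} {y} λ k → h λ e → k (≤-reflexive {x} {y} e))
    (≤-stable {y} {x} λ k → h λ e → k (≤-reflexive {y} {x} (≈-sym {x} {y} e)))

  private
    Apart : ℝ → Set
    Apart x = ∃[ δ ] (0ℚ ℚ.< δ × ∃[ N ] ∀ n → N ℕ.≤ n → δ ℚ.≤ ∣ seq x n ∣)

    ¬apart⇒≈0 : ∀ {x} → ¬ Apart x → x ≈ 0ℝ
    ¬apart⇒≈0 {x} h = ≤-antisym {x} {0ℝ}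
      (¬exceeds⇒≤ {x} {0ℝ} λ (δ , 0<δ , N , p) → h (δ , 0<δ , N , λ n N≤n →
        ℚ.≤-trans (ℚ.≤-reflexive (sym (ℚ.+-identityˡ δ))) (ℚ.≤-trans (p n N≤n) (p≤∣p∣ (seq x n)))))
      (¬exceeds⇒≤ {0ℝ} {x} λ (δ , 0<δ , N , p) → h (δ , 0<δ , N , λ n N≤n →
        subst₂ ℚ._≤_ (eq (seq x n) δ) (trans (ℚ.+-identityˡ _) (ℚ.∣-p∣≡∣p∣ (seq x n)))
          (ℚ.≤-trans (ℚ.+-monoˡ-≤ (ℚ.- seq x n) (p n N≤n))
            (ℚ.+-monoʳ-≤ 0ℚ (p≤∣p∣ (ℚ.- seq x n))))))
      where
      eq : ∀ a d → a ℚ.+ d ℚ.- a ≡ d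
      eq = solve 2 (λ a d → a :+ d :- a := d) refl

    apart-cancel : ∀ {x y} → Apart x → (x * y) ≈ 0ℝ → y ≈ 0ℝ
    apart-cancel {x} {y} (δ , 0<δ , M , p) h ε 0<ε =
      let N , q = h (δ ℚ.* ε) (subst (ℚ._< δ ℚ.* ε) (ℚ.*-zeroʳ δ)
                    (ℚ.*-monoʳ-<-pos δ {{ℚ.positive 0<δ}} 0<ε))
      in M ⊔ N , λ n ≤n → subst (ℚ._< ε) (cong ∣_∣ (sym (ℚ.+-identityʳ (seq y n))))
        (ℚ.*-cancelˡ-<-nonNeg δ {{ℚ.nonNegative (ℚ.<⇒≤ 0<δ)}} (ℚ.≤-<-trans
          (ℚ.*-monoʳ-≤-nonNeg ∣ seq y n ∣ {{ℚ.nonNegative (ℚ.0≤∣p∣ (seq y n))}}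
            (p n (ℕ.m⊔n≤o⇒m≤o M N ≤n)))
          (subst (ℚ._< δ ℚ.* ε)
            (trans (cong ∣_∣ (ℚ.+-identityʳ (seq x n ℚ.* seq y n))) (ℚ.∣p*q∣≡∣p∣*∣q∣ (seq x n) (seq y n)))
            (q n (ℕ.m⊔n≤o⇒n≤o M N ≤n)))))

  -- Without Markov's principle `¬ x ≈ 0ℝ` yields no lower bound on the absolute values of the terms
  -- of x. The conclusion being stable, `Apart x` may be assumed all the same.
  *-cancelˡ-≈0 : ∀ {x y} → ¬ x ≈ 0ℝ → (x * y) ≈ 0ℝ → y ≈ 0ℝ
  *-cancelˡ-≈0 {x} {y} x≉0 xy≈0 = ≈-stable {y} {0ℝ} λ y≉0 →
    x≉0 (¬apart⇒≈0 {x} λ a → y≉0 (apart-cancel {x} {y} a xy≈0))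

  private
    *-nonNeg : 0ℚ ℚ.≤ p → 0ℚ ℚ.≤ q → 0ℚ ℚ.≤ p ℚ.* q
    *-nonNeg {p} {q} 0≤p 0≤q = subst (ℚ._≤ p ℚ.* q) (ℚ.*-zeroˡ q)
      (ℚ.*-monoʳ-≤-nonNeg q {{ℚ.nonNegative 0≤q}} 0≤p)

    eventually≥0⇒≥0 : ∀ {x} → ∃[ N ] (∀ n → N ℕ.≤ n → 0ℚ ℚ.≤ seq x n) → 0ℝ ≤ x
    eventually≥0⇒≥0 (N , h) ε 0<ε = N , λ n N≤n →
      ℚ.≤-trans (ℚ.≤-reflexive (sym (ℚ.+-identityʳ 0ℚ))) (ℚ.+-mono-≤ (h n N≤n) (ℚ.<⇒≤ 0<ε))

  x*x≥0 : ∀ x → 0ℝ ≤ (x * x)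
  x*x≥0 x = eventually≥0⇒≥0 {x * x} (0 , λ n _ → square n)
    where
    eq : ∀ p → ℚ.- p ℚ.* ℚ.- p ≡ p ℚ.* p
    eq = solve 1 (λ p → :- p :* :- p := p :* p) refl
    square : ∀ n → 0ℚ ℚ.≤ seq x n ℚ.* seq x n
    square n with ℚ.≤-total 0ℚ (seq x n)
    ... | inj₁ 0≤p = *-nonNeg {seq x n} {seq x n} 0≤p 0≤p
    ... | inj₂ p≤0 = subst (0ℚ ℚ.≤_) (eq (seq x n))
      (*-nonNeg {ℚ.- seq x n} {ℚ.- seq x n} (ℚ.neg-antimono-≤ p≤0) (ℚ.neg-antimono-≤ p≤0))

  -- By stability one may split on whether each factor exceeds 0. A nonnegative factor that does not
  -- is 0, and so is the product; if both do, their terms are eventually positive.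
  *-≥0 : ∀ {x y} → 0ℝ ≤ x → 0ℝ ≤ y → 0ℝ ≤ (x * y)
  *-≥0 {x} {y} 0≤x 0≤y = ≤-stable {0ℝ} {x * y} λ k →
    k (vanishing x y 0≤x λ ex → k (≤-trans {0ℝ} {y * x} {x * y}
      (vanishing y x 0≤y λ ey → k (positive ex ey))
      (≤-reflexive {y * x} {x * y} (*-comm y x))))
    where
    vanishing : ∀ x y → 0ℝ ≤ x → ¬ Exceeds x 0ℝ → 0ℝ ≤ (x * y)
    vanishing x y 0≤x ¬e = ≤-reflexive {0ℝ} {x * y}
      (≈-trans {0ℝ} {0ℝ * y} {x * y}
        (pointwise {0ℝ} {0ℝ * y} λ n → sym (ℚ.*-zeroˡ (seq y n)))
        (*-cong {0ℝ} {x} {y} {y} (≤-antisym {0ℝ} {x} 0≤x (¬exceeds⇒≤ {x} {0ℝ} ¬e)) (≈-refl {y})))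
    weaken : ∀ {δ} → 0ℚ ℚ.< δ → 0ℚ ℚ.+ δ ℚ.≤ p → 0ℚ ℚ.≤ p
    weaken 0<δ h = ℚ.≤-trans (ℚ.<⇒≤ 0<δ) (ℚ.≤-trans (ℚ.≤-reflexive (sym (ℚ.+-identityˡ _))) h)
    positive : Exceeds x 0ℝ → Exceeds y 0ℝ → 0ℝ ≤ (x * y)
    positive (δ , 0<δ , M , p) (ε , 0<ε , N , q) = eventually≥0⇒≥0 {x * y} (M ⊔ N , λ n ≤n →
      *-nonNeg {seq x n} {seq y n} (weaken 0<δ (p n (ℕ.m⊔n≤o⇒m≤o M N ≤n)))
                                   (weaken 0<ε (q n (ℕ.m⊔n≤o⇒n≤o M N ≤n))))

  1≉0 : ¬ 1ℝ ≈ 0ℝ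
  1≉0 h = let N , p = h 1ℚ (ℚ.positive⁻¹ 1ℚ) in ℚ.<-irrefl refl (p N ℕ.≤-refl)

  -- _≈_ and _≤_ unfold to function types, which defeats the inference of their
  -- arguments; the record types below do not.
  infix 4 _≃_ _≼_

  record _≃_ (x y : ℝ) : Set where
    constructor ↑≃
    field ↓≃ : x ≈ y
  open _≃_ public

  record _≼_ (x y : ℝ) : Set where
    constructor ↑≼
    field ↓≼ : x ≤ y
  open _≼_ public

  identity : ∀ {x y} → (∀ n → seq x n ≡ seq y n) → x ≃ y
  identity {x} {y} h = ↑≃ (pointwise {x} {y} h)

  ℝ-commutativeRing : CommutativeRing 0ℓ 0ℓ
  ℝ-commutativeRing = record
    { Carrier = ℝ ; _≈_ = _≃_ ; _+_ = _+_ ; _*_ = _*_ ; -_ = -_ ; 0# = 0ℝ ; 1# = 1ℝ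
    ; isCommutativeRing = record
      { isRing = record
        { +-isAbelianGroup = record
          { isGroup = record
            { isMonoid = record
              { isSemigroup = record
                { isMagma = record
                  { isEquivalence = record
                    { refl = identity λ _ → refl
                    ; sym = λ {x} {y} (↑≃ h) → ↑≃ (≈-sym {x} {y} h)
                    ; trans = λ {x} {y} {z} (↑≃ h) (↑≃ k) → ↑≃ (≈-trans {x} {y} {z} h k) }
                  ; ∙-cong = λ {x} {x′} {y} {y′} (↑≃ h) (↑≃ k) → ↑≃ (+-cong {x} {x′} {y} {y′} h k) }
                ; assoc = λ x y z → identity λ n → ℚ.+-assoc (seq x n) (seq y n) (seq z n) }
              ; identity = (λ x → identity λ n → ℚ.+-identityˡ (seq x n))
                         , (λ x → identity λ n → ℚ.+-identityʳ (seq x n)) }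
            ; inverse = (λ x → identity λ n → ℚ.+-inverseˡ (seq x n))
                      , (λ x → identity λ n → ℚ.+-inverseʳ (seq x n))
            ; ⁻¹-cong = λ {x} {y} (↑≃ h) → ↑≃ (-‿cong {x} {y} h) }
          ; comm = λ x y → identity λ n → ℚ.+-comm (seq x n) (seq y n) }
        ; *-cong = λ {x} {x′} {y} {y′} (↑≃ h) (↑≃ k) → ↑≃ (*-cong {x} {x′} {y} {y′} h k)
        ; *-assoc = λ x y z → identity λ n → ℚ.*-assoc (seq x n) (seq y n) (seq z n)
        ; *-identity = (λ x → identity λ n → ℚ.*-identityˡ (seq x n))
                     , (λ x → identity λ n → ℚ.*-identityʳ (seq x n))
        ; distrib = (λ x y z → identity λ n → ℚ.*-distribˡ-+ (seq x n) (seq y n) (seq z n))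
                  , (λ x y z → identity λ n → ℚ.*-distribʳ-+ (seq x n) (seq y n) (seq z n)) }
      ; *-comm = λ x y → ↑≃ (*-comm x y) } }

  private
    -- Addition in ℚ normalises by a gcd; on unnormalised fractions over 1 the claim is an identity
    -- of integers.
    /1-homo-+ : ∀ i j → (i ℤ.+ j) ℚ./ 1 ≡ i ℚ./ 1 ℚ.+ j ℚ./ 1
    /1-homo-+ i j = ℚ.toℚᵘ-injective (ℚᵘ.≃-trans (ℚ.toℚᵘ-fromℚᵘ (ℚᵘ.mkℚᵘ (i ℤ.+ j) 0))
      (ℚᵘ.≃-trans (ℚᵘ.*≡* (eq i j)) (ℚᵘ.≃-sym (ℚᵘ.≃-trans (ℚ.toℚᵘ-homo-+ (i ℚ./ 1) (j ℚ./ 1))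
        (ℚᵘ.+-cong (ℚ.toℚᵘ-fromℚᵘ (ℚᵘ.mkℚᵘ i 0)) (ℚ.toℚᵘ-fromℚᵘ (ℚᵘ.mkℚᵘ j 0)))))))
      where
      eq : ∀ i j → (i ℤ.+ j) ℤ.* + 1 ≡ (i ℤ.* + 1 ℤ.+ j ℤ.* + 1) ℤ.* + 1
      eq i j = trans (ℤ.*-identityʳ (i ℤ.+ j)) (sym (trans (ℤ.*-identityʳ _)
        (cong₂ ℤ._+_ (ℤ.*-identityʳ i) (ℤ.*-identityʳ j))))

    /1-homo-* : ∀ i j → (i ℤ.* j) ℚ./ 1 ≡ (i ℚ./ 1) ℚ.* (j ℚ./ 1)
    /1-homo-* i j = ℚ.toℚᵘ-injective (ℚᵘ.≃-trans (ℚ.toℚᵘ-fromℚᵘ (ℚᵘ.mkℚᵘ (i ℤ.* j) 0))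
      (ℚᵘ.≃-sym (ℚᵘ.≃-trans (ℚ.toℚᵘ-homo-* (i ℚ./ 1) (j ℚ./ 1))
        (ℚᵘ.*-cong (ℚ.toℚᵘ-fromℚᵘ (ℚᵘ.mkℚᵘ i 0)) (ℚ.toℚᵘ-fromℚᵘ (ℚᵘ.mkℚᵘ j 0))))))

    /1-homo-neg : ∀ i → (ℤ.- i) ℚ./ 1 ≡ ℚ.- (i ℚ./ 1)
    /1-homo-neg i = ℚ.toℚᵘ-injective (ℚᵘ.≃-trans (ℚ.toℚᵘ-fromℚᵘ (ℚᵘ.mkℚᵘ (ℤ.- i) 0))
      (ℚᵘ.≃-sym (ℚᵘ.≃-trans (ℚ.toℚᵘ-homo‿- (i ℚ./ 1))
        (ℚᵘ.-‿cong (ℚ.toℚᵘ-fromℚᵘ (ℚᵘ.mkℚᵘ i 0))))))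

  ℝ-orderedRing : OrderedRing
  ℝ-orderedRing = record
    { commutativeRing = ℝ-commutativeRing
    ; integers = record
      { ⟦_⟧    = fromℤ
      ; +-homo = λ i j → identity λ _ → /1-homo-+ i j
      ; *-homo = λ i j → identity λ _ → /1-homo-* i j
      ; -‿homo = λ i → identity λ _ → /1-homo-neg i
      ; 0-homo = identity λ _ → refl
      ; 1-homo = identity λ _ → refl }
    ; _≤_          = _≼_
    ; ≤-reflexive  = λ {x} {y} (↑≃ h) → ↑≼ (≤-reflexive {x} {y} h)
    ; ≤-trans      = λ {x} {y} {z} (↑≼ h) (↑≼ k) → ↑≼ (≤-trans {x} {y} {z} h k)
    ; ≤-antisym    = λ {x} {y} (↑≼ h) (↑≼ k) → ↑≃ (≤-antisym {x} {y} h k)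
    ; ≤-stable     = λ {x} {y} h → ↑≼ (≤-stable {x} {y} λ k → h λ (↑≼ e) → k e)
    ; ≰⇒≥          = λ {x} {y} h → ↑≼ (≰⇒≥ {x} {y} λ k → h (↑≼ k))
    ; +-mono-≤     = λ {x} {x′} {y} {y′} (↑≼ h) (↑≼ k) → ↑≼ (+-mono-≤ {x} {x′} {y} {y′} h k)
    ; *-≥0         = λ {x} {y} (↑≼ h) (↑≼ k) → ↑≼ (*-≥0 {x} {y} h k)
    ; x*x≥0        = λ x → ↑≼ (x*x≥0 x)
    ; ≈-stable     = λ {x} {y} h → ↑≃ (≈-stable {x} {y} λ k → h λ (↑≃ e) → k e)
    ; *-cancelˡ-≈0 = λ {x} {y} h (↑≃ k) → ↑≃ (*-cancelˡ-≈0 {x} {y} (λ e → h (↑≃ e)) k)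
    ; 1≉0          = λ (↑≃ h) → 1≉0 h }

open OrderedRings using (OrderedRing)

-- Variational eigenvalue bounds and colourings.

module Spectral (K : OrderedRing) where
  open Counting using (indicator; module ℕΣ)
  open import Algebra.Solver.Ring.AlmostCommutativeRing using (fromCommutativeRing; _-Raw-AlmostCommutative⟶_)
  import Algebra.Solver.Ring as RingSolver
  import Data.Integer.Base as ℤ
  import Data.Integer.Properties as ℤ
  open import Data.Fin.Base as Fin using (Fin; zero; suc; toℕ; fromℕ<; punchIn; splitAt; _↑ˡ_; _↑ʳ_)
  open import Data.Fin.Properties using (_≟_; toℕ-↑ʳ; toℕ-injective; toℕ<n; toℕ-fromℕ<; punchInᵢ≢i; splitAt⁻¹-↑ˡ; splitAt⁻¹-↑ʳ)
  open import Data.Maybe.Base using (Maybe; just; nothing)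
  open import Data.Nat.Base as ℕ using (ℕ; zero; suc; z≤n; s≤s)
  import Data.Nat.Properties as ℕ
  open import Data.Product using (_×_; _,_; ∃-syntax; Σ-syntax)
  open import Data.Vec.Functional using (Vector; insertAt; _++_)
  open import Data.Vec.Functional.Properties using (insertAt-lookup; insertAt-punchIn; lookup-++ˡ; lookup-++ʳ)
  open import Data.Sum.Base using (inj₁; inj₂)
  open import Function.Base using (_∘_)
  open import Relation.Binary.PropositionalEquality as ≡ using (_≡_)
  open import Relation.Nullary.Decidable using (yes; no; ¬?)
  open import Relation.Nullary.Negation using (¬_; contradiction)

  open OrderedRing K hiding (zero)
  open import Algebra.Properties.AbelianGroup +-abelianGroup using (ε⁻¹≈ε)
  open import Algebra.Properties.Semiring.Sum semiring
    using (sum; sum-cong-≋; sum-replicate-zero; sum-remove; ∑-distrib-+; ∑-comm; *-distribˡ-sum; *-distribʳ-sum)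
  open import Relation.Binary.Reasoning.Setoid setoid

  private
    open module Integers = _-Raw-AlmostCommutative⟶_ integers using (⟦_⟧; 0-homo)

    _≟⟦⟧_ : ∀ i j → Maybe (⟦ i ⟧ ≈ ⟦ j ⟧)
    i ≟⟦⟧ j with i ℤ.≟ j
    ... | yes ≡.refl = just refl
    ... | no _       = nothing

    open RingSolver _ (fromCommutativeRing commutativeRing) integers _≟⟦⟧_
      using (solve; _:+_; _:*_; :-_; _:-_; _:=_; con)

  Matrix : ℕ → Set
  Matrix N = Fin N → Fin N → Carrier

  sum-zero : ∀ {n} {f : Vector Carrier n} → (∀ i → f i ≈ 0#) → sum f ≈ 0#
  sum-zero {n} h = trans (sum-cong-≋ h) (sum-replicate-zero n)

  sum-↑ : ∀ m {n} (f : Vector Carrier (m ℕ.+ n)) → sum f ≈ sum (λ i → f (i ↑ˡ n)) + sum (λ j → f (m ↑ʳ j))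
  sum-↑ zero    f = sym (+-identityˡ (sum f))
  sum-↑ (suc m) f = trans (+-congˡ (sum-↑ m (f ∘ suc))) (sym (+-assoc _ _ _))

  ≤-refl : ∀ {x} → x ≤ x
  ≤-refl = ≤-reflexive refl

  ≤⇒0≤- : ∀ {x y} → x ≤ y → 0# ≤ y + - x
  ≤⇒0≤- {x} {y} h = ≤-trans (≤-reflexive (sym (-‿inverseʳ x))) (+-mono-≤ h ≤-refl)

  0≤-⇒≤ : ∀ {x y} → 0# ≤ y + - x → x ≤ y
  0≤-⇒≤ {x} {y} h = ≤-trans (≤-reflexive (sym (+-identityˡ x)))
    (≤-trans (+-mono-≤ h (≤-refl {x})) (≤-reflexive (cancel y x)))
    where
    cancel : ∀ a b → (a + - b) + b ≈ a
    cancel = solve 2 (λ a b → (a :+ :- b) :+ b := a) refl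

  sum-mono-≤ : ∀ {n} {f g : Vector Carrier n} → (∀ i → f i ≤ g i) → sum f ≤ sum g
  sum-mono-≤ {zero}  h = ≤-refl
  sum-mono-≤ {suc n} h = +-mono-≤ (h zero) (sum-mono-≤ (h ∘ suc))

  sum-≥0 : ∀ {n} {f : Vector Carrier n} → (∀ i → 0# ≤ f i) → 0# ≤ sum f
  sum-≥0 {n} h = ≤-trans (≤-reflexive (sym (sum-replicate-zero n))) (sum-mono-≤ h)

  sum≈0⇒≈0 : ∀ {n} {f : Vector Carrier n} → (∀ i → 0# ≤ f i) → sum f ≈ 0# → ∀ i → f i ≈ 0#
  sum≈0⇒≈0 {suc n} {f} h eq i = ≤-antisym
    (≤-trans (≤-reflexive (sym (+-identityʳ (f i))))
      (≤-trans (+-mono-≤ (≤-refl {f i}) (sum-≥0 λ j → h (punchIn i j)))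
        (≤-reflexive (trans (sym (sum-remove f)) eq))))
    (h i)

  x*x≈0⇒x≈0 : ∀ {x} → x * x ≈ 0# → x ≈ 0#
  x*x≈0⇒x≈0 h = ≈-stable λ k → k (*-cancelˡ-≈0 k h)

  -- Elimination with a pivot A 0 p, kept free of division by multiplying the
  -- other rows and the solution by the pivot.
  underdetermined : ∀ n (A : Fin n → Fin (suc n) → Carrier) →
    ¬ ¬ (Σ[ x ∈ Vector Carrier (suc n) ] ((∃[ j ] ¬ x j ≈ 0#) × ∀ i → sum (λ j → A i j * x j) ≈ 0#))
  underdetermined zero A k = k ((λ _ → 1#) , (zero , λ h → 1≉0 h) , λ ())
  underdetermined (suc n) A k = underdetermined n (λ i j → A (suc i) (suc j)) λ (y , (j , y≉0) , Ay≈0) →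
    k (x₀ y , (suc j , y≉0) , λ
      { zero → sum-zero {suc (suc n)} λ j → trans (*-congʳ (row-zero j)) (zeroˡ (x₀ y j))
      ; (suc i) → trans (+-cong (zeroʳ (A (suc i) zero)) (Ay≈0 i)) (+-identityˡ 0#) })
    where
    x₀ : Vector Carrier (suc n) → Vector Carrier (suc (suc n))
    x₀ y zero    = 0#
    x₀ y (suc j) = y j
    -- A nonzero entry of the first row would serve as pivot and contradict `k`, so the whole row
    -- vanishes. It then imposes no condition, and the remaining rows are solved with first
    -- coordinate 0.
    row-zero : ∀ p → A zero p ≈ 0#
    row-zero p = ≈-stable λ a≉0 → underdetermined n (B p) λ (y , (j , y≉0) , By≈0) →
        k (x p y , (punchIn p j , λ x≈0 → y≉0 (*-cancelˡ-≈0 a≉0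
              (trans (sym (reflexive (insertAt-punchIn _ p _ j))) x≈0)))
          , λ { zero → trans (expand p y zero) (row₀ p y)
              ; (suc i) → trans (expand p y (suc i)) (trans (rowₛ p y i) (By≈0 i)) })
      where
      B : Fin (suc (suc n)) → Fin n → Fin (suc n) → Carrier
      B p i j = A zero p * A (suc i) (punchIn p j) + - (A (suc i) p * A zero (punchIn p j))
      S : Fin (suc (suc n)) → Vector Carrier (suc n) → Carrier
      S p y = sum λ j → A zero (punchIn p j) * y j
      x : Fin (suc (suc n)) → Vector Carrier (suc n) → Vector Carrier (suc (suc n))
      x p y = insertAt (λ j → A zero p * y j) p (- S p y)
      expand : ∀ p y i → sum (λ j → A i j * x p y j) ≈
               A i p * - S p y + sum (λ j → A i (punchIn p j) * (A zero p * y j))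
      expand p y i = trans (sum-remove {i = p} λ j → A i j * x p y j)
        (+-cong (*-congˡ (reflexive (insertAt-lookup (λ j → A zero p * y j) p (- S p y))))
          (sum-cong-≋ {suc n} λ j → *-congˡ {A i (punchIn p j)}
            (reflexive (insertAt-punchIn (λ j → A zero p * y j) p (- S p y) j))))
      row₀ : ∀ p y → A zero p * - S p y + sum (λ j → A zero (punchIn p j) * (A zero p * y j)) ≈ 0#
      row₀ p y = begin
        a * - S p y + sum (λ j → A zero (punchIn p j) * (a * y j))
          ≈⟨ +-congˡ (sum-cong-≋ {suc n} λ j → swap a (A zero (punchIn p j)) (y j)) ⟩
        a * - S p y + sum (λ j → a * (A zero (punchIn p j) * y j))
          ≈⟨ +-congˡ (sym (*-distribˡ-sum a λ j → A zero (punchIn p j) * y j)) ⟩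
        a * - S p y + a * S p y
          ≈⟨ trans (cancel a (S p y)) 0-homo ⟩
        0# ∎
        where
        a = A zero p
        swap : ∀ a b c → b * (a * c) ≈ a * (b * c)
        swap = solve 3 (λ a b c → b :* (a :* c) := a :* (b :* c)) refl
        cancel : ∀ a s → a * - s + a * s ≈ ⟦ ℤ.0ℤ ⟧
        cancel = solve 2 (λ a s → a :* :- s :+ a :* s := con ℤ.0ℤ) refl
      rowₛ : ∀ p y i → A (suc i) p * - S p y + sum (λ j → A (suc i) (punchIn p j) * (A zero p * y j))
                       ≈ sum (λ j → B p i j * y j)
      rowₛ p y i = begin
        b * - S p y + sum (λ j → A (suc i) (punchIn p j) * (a * y j))
          ≈⟨ +-congʳ (neg b (S p y)) ⟩
        - b * S p y + sum (λ j → A (suc i) (punchIn p j) * (a * y j))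
          ≈⟨ +-congʳ (*-distribˡ-sum (- b) λ j → A zero (punchIn p j) * y j) ⟩
        sum (λ j → - b * (A zero (punchIn p j) * y j)) + sum (λ j → A (suc i) (punchIn p j) * (a * y j))
          ≈⟨ sym (∑-distrib-+ (λ j → - b * (A zero (punchIn p j) * y j)) λ j → A (suc i) (punchIn p j) * (a * y j)) ⟩
        sum (λ j → - b * (A zero (punchIn p j) * y j) + A (suc i) (punchIn p j) * (a * y j))
          ≈⟨ sum-cong-≋ {suc n} (λ j → collect a b (A zero (punchIn p j)) (A (suc i) (punchIn p j)) (y j)) ⟩
        sum (λ j → B p i j * y j) ∎
        where
        a = A zero p
        b = A (suc i) p
        neg : ∀ b s → b * - s ≈ - b * s
        neg = solve 2 (λ b s → b :* :- s := :- b :* s) refl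
        collect : ∀ a b c d y → - b * (c * y) + d * (a * y) ≈ (a * d + - (b * c)) * y
        collect = solve 5 (λ a b c d y → :- b :* (c :* y) :+ d :* (a :* y) := (a :* d :+ :- (b :* c)) :* y) refl

  infix 9 ⟨_,_⟩
  ⟨_,_⟩ : ∀ {N} → Vector Carrier N → Vector Carrier N → Carrier
  ⟨ x , y ⟩ = sum λ i → x i * y i

  combination : ∀ {r N} → Vector Carrier r → (Fin r → Vector Carrier N) → Vector Carrier N
  combination a v j = sum λ t → a t * v t j

  ⟨⟩-cong : ∀ {N} {x x′ y y′ : Vector Carrier N} → (∀ i → x i ≈ x′ i) → (∀ i → y i ≈ y′ i) → ⟨ x , y ⟩ ≈ ⟨ x′ , y′ ⟩
  ⟨⟩-cong {N} h k = sum-cong-≋ {N} λ i → *-cong (h i) (k i)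

  ⟨x,x⟩≥0 : ∀ {N} (x : Vector Carrier N) → 0# ≤ ⟨ x , x ⟩
  ⟨x,x⟩≥0 {N} x = sum-≥0 {N} λ i → x*x≥0 (x i)

  ⟨⟩-linear : ∀ {N} (x z : Vector Carrier N) b (y : Vector Carrier N) →
    ⟨ (λ i → x i + b * z i) , y ⟩ ≈ ⟨ x , y ⟩ + b * ⟨ z , y ⟩
  ⟨⟩-linear {N} x z b y = begin
    sum (λ i → (x i + b * z i) * y i)             ≈⟨ sum-cong-≋ {N} (λ i → expand (x i) b (z i) (y i)) ⟩
    sum (λ i → x i * y i + b * (z i * y i))       ≈⟨ ∑-distrib-+ {N} _ _ ⟩
    ⟨ x , y ⟩ + sum (λ i → b * (z i * y i))       ≈⟨ +-congˡ (sym (*-distribˡ-sum {N} b _)) ⟩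
    ⟨ x , y ⟩ + b * ⟨ z , y ⟩ ∎
    where
    expand : ∀ x b z y → (x + b * z) * y ≈ x * y + b * (z * y)
    expand = solve 4 (λ x b z y → (x :+ b :* z) :* y := x :* y :+ b :* (z :* y)) refl

  ⟨⟩-comm : ∀ {N} (x y : Vector Carrier N) → ⟨ x , y ⟩ ≈ ⟨ y , x ⟩
  ⟨⟩-comm {N} x y = sum-cong-≋ {N} λ i → *-comm (x i) (y i)

  module _ {N} (M : Matrix N) (M-sym : ∀ i j → M i j ≈ M j i) where

    infixr 10 M·_
    M·_ : Vector Carrier N → Vector Carrier N
    (M· x) i = sum λ j → M i j * x j

    self-adjoint : ∀ x y → ⟨ x , M· y ⟩ ≈ ⟨ M· x , y ⟩
    self-adjoint x y = begin
      sum (λ i → x i * sum (λ j → M i j * y j))     ≈⟨ sum-cong-≋ {N} (λ i → *-distribˡ-sum {N} (x i) _) ⟩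
      sum (λ i → sum (λ j → x i * (M i j * y j)))   ≈⟨ ∑-comm {N} {N} _ ⟩
      sum (λ j → sum (λ i → x i * (M i j * y j)))
        ≈⟨ sum-cong-≋ {N} (λ j → sum-cong-≋ {N} λ i → trans (*-congˡ (*-congʳ (M-sym i j))) (swap (x i) (M j i) (y j))) ⟩
      sum (λ j → sum (λ i → M j i * x i * y j))     ≈⟨ sum-cong-≋ {N} (λ j → sym (*-distribʳ-sum {N} (y j) λ i → M j i * x i)) ⟩
      ⟨ M· x , y ⟩ ∎
      where
      swap : ∀ x m y → x * (m * y) ≈ m * x * y
      swap = solve 3 (λ x m y → x :* (m :* y) := m :* x :* y) refl

    L : Carrier → Vector Carrier N → Vector Carrier N
    L μ x i = (M· x) i + - μ * x i

    -- The quadratic form of M - μ. That it is nonnegative at x says, without dividing, that the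
    -- Rayleigh quotient of x is at least μ.
    E : Carrier → Vector Carrier N → Carrier
    E μ x = ⟨ x , L μ x ⟩

    E-expand : ∀ μ x → E μ x ≈ ⟨ M· x , x ⟩ + - μ * ⟨ x , x ⟩
    E-expand μ x = trans (⟨⟩-comm x (L μ x)) (⟨⟩-linear (M· x) x (- μ) x)

    L-self-adjoint : ∀ μ x y → ⟨ x , L μ y ⟩ ≈ ⟨ L μ x , y ⟩
    L-self-adjoint μ x y = begin
      ⟨ x , L μ y ⟩                        ≈⟨ ⟨⟩-comm x (L μ y) ⟩
      ⟨ L μ y , x ⟩                        ≈⟨ ⟨⟩-linear (M· y) y (- μ) x ⟩
      ⟨ M· y , x ⟩ + - μ * ⟨ y , x ⟩
        ≈⟨ +-cong (trans (sym (self-adjoint y x)) (⟨⟩-comm y (M· x))) (*-congˡ (⟨⟩-comm y x)) ⟩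
      ⟨ M· x , y ⟩ + - μ * ⟨ x , y ⟩       ≈⟨ sym (⟨⟩-linear (M· x) x (- μ) y) ⟩
      ⟨ L μ x , y ⟩ ∎

    E-shift : ∀ μ ν x → E μ x ≈ E ν x + (ν + - μ) * ⟨ x , x ⟩
    E-shift μ ν x = begin
      E μ x                                                 ≈⟨ E-expand μ x ⟩
      ⟨ M· x , x ⟩ + - μ * ⟨ x , x ⟩                        ≈⟨ shift ⟨ M· x , x ⟩ μ ν ⟨ x , x ⟩ ⟩
      ⟨ M· x , x ⟩ + - ν * ⟨ x , x ⟩ + (ν + - μ) * ⟨ x , x ⟩  ≈⟨ +-congʳ (sym (E-expand ν x)) ⟩
      E ν x + (ν + - μ) * ⟨ x , x ⟩ ∎
      where
      shift : ∀ a μ ν s → a + - μ * s ≈ a + - ν * s + (ν + - μ) * s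
      shift = solve 4 (λ a μ ν s → a :+ :- μ :* s := a :+ :- ν :* s :+ (ν :+ :- μ) :* s) refl

    -- Eigenvectors are not assumed orthogonal: M - λ₀ kills the first one, hence
    -- E λ₀ does not see it.
    E≥0 : ∀ r (v : Fin r → Vector Carrier N) (λs : Vector Carrier r) →
          (∀ i j → (M· v i) j ≈ λs i * v i j) → (∀ i j → i Fin.≤ j → λs i ≤ λs j) →
          ∀ μ → (∀ i → μ ≤ λs i) → ∀ b → 0# ≤ E μ (combination b v)
    E≥0 zero v λs eigen sorted μ μ≤ b = ≤-reflexive (sym (sum-zero {N} λ i → zeroˡ (L μ (combination b v) i)))
    E≥0 (suc r) v λs eigen sorted μ μ≤ b = ≤-trans
      (≤-trans (≤-reflexive (sym (+-identityˡ 0#)))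
        (+-mono-≤ (≤-trans (E≥0 r (v ∘ suc) (λs ∘ suc) (eigen ∘ suc) (λ i j i≤j → sorted (suc i) (suc j) (s≤s i≤j)) λ₀
                      (λ i → sorted zero (suc i) z≤n) (b ∘ suc))
                    (≤-reflexive (sym drop)))
                  (*-≥0 (≤⇒0≤- (μ≤ zero)) (⟨x,x⟩≥0 u))))
      (≤-reflexive (sym (E-shift μ λ₀ u)))
      where
      λ₀ = λs zero
      v₀ u′ u : Vector Carrier N
      v₀ = v zero
      u′ = combination (b ∘ suc) (v ∘ suc)
      u = combination b v
      Lv₀ : ∀ i → L λ₀ v₀ i ≈ 0#
      Lv₀ i = trans (+-congʳ (eigen zero i)) (trans (cancel λ₀ (v₀ i)) 0-homo)
        where
        cancel : ∀ l v → l * v + - l * v ≈ ⟦ ℤ.0ℤ ⟧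
        cancel = solve 2 (λ l v → l :* v :+ :- l :* v := con ℤ.0ℤ) refl
      kill : ∀ y → ⟨ v₀ , L λ₀ y ⟩ ≈ 0#
      kill y = trans (L-self-adjoint λ₀ v₀ y) (sum-zero {N} λ i → trans (*-congʳ (Lv₀ i)) (zeroˡ (y i)))
      skip : ∀ y → ⟨ u , L λ₀ y ⟩ ≈ ⟨ u′ , L λ₀ y ⟩
      skip y = begin
        ⟨ u , L λ₀ y ⟩                               ≈⟨ ⟨⟩-cong {N} {u} (λ i → +-comm (b zero * v₀ i) (u′ i)) (λ i → refl {L λ₀ y i}) ⟩
        ⟨ (λ i → u′ i + b zero * v₀ i) , L λ₀ y ⟩    ≈⟨ ⟨⟩-linear u′ v₀ (b zero) (L λ₀ y) ⟩
        ⟨ u′ , L λ₀ y ⟩ + b zero * ⟨ v₀ , L λ₀ y ⟩   ≈⟨ +-congˡ (trans (*-congˡ (kill y)) (zeroʳ (b zero))) ⟩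
        ⟨ u′ , L λ₀ y ⟩ + 0#                         ≈⟨ +-identityʳ _ ⟩
        ⟨ u′ , L λ₀ y ⟩ ∎
      drop : E λ₀ u ≈ E λ₀ u′
      drop = begin
        ⟨ u , L λ₀ u ⟩    ≈⟨ skip u ⟩
        ⟨ u′ , L λ₀ u ⟩   ≈⟨ L-self-adjoint λ₀ u′ u ⟩
        ⟨ L λ₀ u′ , u ⟩   ≈⟨ ⟨⟩-comm (L λ₀ u′) u ⟩
        ⟨ u , L λ₀ u′ ⟩   ≈⟨ skip u′ ⟩
        ⟨ u′ , L λ₀ u′ ⟩  ∎

    -- The k test vectors and the eigenvectors for the eigenvalues from the k-th
    -- on are N + 1 vectors in an N-dimensional space.
    courant-fischer : ∀ {k} (f : Fin (suc k) → Vector Carrier N) (c : Carrier) →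
      (∀ a → ⟨ M· combination a f , combination a f ⟩ ≤ c * ⟨ combination a f , combination a f ⟩) →
      (∀ a → (∀ i → combination a f i ≈ 0#) → ∀ t → a t ≈ 0#) →
      ∀ r → N ≡ k ℕ.+ r → (v : Fin r → Vector Carrier N) (λs : Vector Carrier r) →
      (∀ i j → (M· v i) j ≈ λs i * v i j) → (∀ i j → i Fin.≤ j → λs i ≤ λs j) →
      (∀ b → (∀ i → combination b v i ≈ 0#) → ∀ t → b t ≈ 0#) →
      ∀ μ → (∀ i → μ ≤ λs i) → μ ≤ c
    courant-fischer {k} f c bound f-indep r ≡.refl v λs eigen sorted v-indep μ μ≤ =
      ≤-stable λ μ≰c → underdetermined N (λ p q → (f ++ v) q p) λ (x , (j , xj≉0) , rel) → xj≉0 (vanish μ≰c x rel j)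
      where
      module _ (μ≰c : ¬ μ ≤ c) (x : Vector Carrier (suc k ℕ.+ r))
               (rel : ∀ i → sum (λ q → (f ++ v) q i * x q) ≈ 0#) where
        a : Vector Carrier (suc k)
        a = λ t → x (t ↑ˡ r)
        b : Vector Carrier r
        b = λ t → x (suc k ↑ʳ t)
        w u : Vector Carrier N
        w = combination a f
        u = combination b v
        w+u≈0 : ∀ i → w i + u i ≈ 0#
        w+u≈0 i = trans (sym (trans (sum-↑ (suc k) λ q → (f ++ v) q i * x q)
          (+-cong (sum-cong-≋ {suc k} λ t → trans (*-congʳ (reflexive (≡.cong (λ g → g i) (lookup-++ˡ f v t)))) (*-comm (f t i) (a t)))
                  (sum-cong-≋ {r} λ t → trans (*-congʳ (reflexive (≡.cong (λ g → g i) (lookup-++ʳ f v t)))) (*-comm (v t i) (b t))))))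
          (rel i)
        M·w+M·u≈0 : ∀ i → (M· w) i + (M· u) i ≈ 0#
        M·w+M·u≈0 i = trans (sym (∑-distrib-+ {N} _ _)) (sum-zero {N} λ j →
          trans (sym (distribˡ (M i j) (w j) (u j))) (trans (*-congˡ (w+u≈0 j)) (zeroʳ (M i j))))
        opposite : ∀ {p q} → p + q ≈ 0# → q ≈ - p
        opposite {p} {q} h = trans (from p q) (trans (+-congʳ h) (+-identityˡ _))
          where
          from : ∀ p q → q ≈ (p + q) + - p
          from = solve 2 (λ p q → q := (p :+ q) :+ :- p) refl
        product : ∀ {p p′ q q′} → p + p′ ≈ 0# → q + q′ ≈ 0# → p′ * q′ ≈ p * q
        product {p} {q = q} h k = trans (*-cong (opposite h) (opposite k)) (signs p q)
          where
          signs : ∀ p q → - p * - q ≈ p * q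
          signs = solve 2 (λ p q → :- p :* :- q := p :* q) refl
        s : Carrier
        s = ⟨ w , w ⟩
        -- Since u = -w, the form has the same value at both vectors: the eigenvectors bound it from
        -- below by 0, the test functions from above by (c - μ) s.
        Eu : E μ u ≈ ⟨ M· w , w ⟩ + - μ * s
        Eu = trans (E-expand μ u) (+-cong (sum-cong-≋ {N} λ i → product (M·w+M·u≈0 i) (w+u≈0 i))
          (*-congˡ (sum-cong-≋ {N} λ i → product (w+u≈0 i) (w+u≈0 i))))
        0≤[c-μ]s : 0# ≤ (c + - μ) * s
        0≤[c-μ]s = ≤-trans (E≥0 r v λs eigen sorted μ μ≤ b) (≤-trans (≤-reflexive Eu)
          (≤-trans (+-mono-≤ (bound a) ≤-refl) (≤-reflexive (sym (distribʳ s c (- μ))))))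
        -- `μ≰c` gives c ≤ μ, so this product is nonnegative as well as nonpositive. As μ - c is
        -- nonzero, s vanishes, and with it w and then u.
        [μ-c]s≈0 : (μ + - c) * s ≈ 0#
        [μ-c]s≈0 = ≤-antisym
          (0≤-⇒≤ (≤-trans 0≤[c-μ]s (≤-reflexive (trans (flip c μ s) (+-cong 0-homo refl)))))
          (*-≥0 (≤⇒0≤- (≰⇒≥ μ≰c)) (⟨x,x⟩≥0 w))
          where
          flip : ∀ c μ s → (c + - μ) * s ≈ ⟦ ℤ.0ℤ ⟧ + - ((μ + - c) * s)
          flip = solve 3 (λ c μ s → (c :+ :- μ) :* s := con ℤ.0ℤ :+ :- ((μ :+ :- c) :* s)) refl
        μ-c≉0 : ¬ μ + - c ≈ 0#
        μ-c≉0 h = μ≰c (0≤-⇒≤ (≤-reflexive (trans (sym ε⁻¹≈ε) (trans (-‿cong (sym h)) (swap μ c)))))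
          where
          swap : ∀ μ c → - (μ + - c) ≈ c + - μ
          swap = solve 2 (λ μ c → :- (μ :+ :- c) := c :+ :- μ) refl
        w≈0 : ∀ i → w i ≈ 0#
        w≈0 i = x*x≈0⇒x≈0 (sum≈0⇒≈0 {N} (λ i → x*x≥0 (w i)) (*-cancelˡ-≈0 μ-c≉0 [μ-c]s≈0) i)
        u≈0 : ∀ i → u i ≈ 0#
        u≈0 i = trans (opposite (w+u≈0 i)) (trans (-‿cong (w≈0 i)) ε⁻¹≈ε)
        vanish : ∀ j → x j ≈ 0#
        vanish j with splitAt (suc k) j in eq
        ... | inj₁ t = ≡.subst (λ j → x j ≈ 0#) (splitAt⁻¹-↑ˡ {suc k} eq) (f-indep a w≈0 t)
        ... | inj₂ t = ≡.subst (λ j → x j ≈ 0#) (splitAt⁻¹-↑ʳ {suc k} eq) (v-indep b u≈0 t)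

  ι : ℕ → Carrier
  ι n = ⟦ ℤ.+ n ⟧

  ι-+ : ∀ m n → ι (m ℕ.+ n) ≈ ι m + ι n
  ι-+ m n = Integers.+-homo (ℤ.+ m) (ℤ.+ n)

  ι-* : ∀ m n → ι (m ℕ.* n) ≈ ι m * ι n
  ι-* m n = trans (reflexive (≡.cong ⟦_⟧ (ℤ.pos-* m n))) (Integers.*-homo (ℤ.+ m) (ℤ.+ n))

  ι-sum : ∀ {n} (f : Fin n → ℕ) → ι (ℕΣ.sum f) ≈ sum λ i → ι (f i)
  ι-sum {zero}  f = 0-homo
  ι-sum {suc n} f = trans (ι-+ (f zero) _) (+-congˡ (ι-sum (f ∘ suc)))

  ι≥0 : ∀ n → 0# ≤ ι n
  ι≥0 zero    = ≤-reflexive (sym 0-homo)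
  ι≥0 (suc n) = ≤-trans (≤-reflexive (sym (+-identityˡ 0#)))
    (≤-trans (+-mono-≤ (≤-trans (x*x≥0 1#) (≤-reflexive (trans (*-identityˡ 1#) (sym Integers.1-homo)))) (ι≥0 n))
      (≤-reflexive (sym (ι-+ 1 n))))

  ι-mono-≤ : ∀ {m n} → m ℕ.≤ n → ι m ≤ ι n
  ι-mono-≤ {m} {n} m≤n = ≤-trans (≤-reflexive (sym (+-identityʳ (ι m)))) (≤-trans (+-mono-≤ ≤-refl (ι≥0 (n ℕ.∸ m)))
    (≤-reflexive (trans (sym (ι-+ m (n ℕ.∸ m))) (reflexive (≡.cong ι (ℕ.m+[n∸m]≡n m≤n))))))

  *-monoʳ-≤ : ∀ {x y z} → 0# ≤ x → y ≤ z → x * y ≤ x * z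
  *-monoʳ-≤ {x} {y} {z} 0≤x y≤z = 0≤-⇒≤ (≤-trans (*-≥0 0≤x (≤⇒0≤- y≤z)) (≤-reflexive (distribute x y z)))
    where
    distribute : ∀ x y z → x * (z + - y) ≈ x * z + - (x * y)
    distribute = solve 3 (λ x y z → x :* (z :+ :- y) := x :* z :+ :- (x :* y)) refl

  -- If x ≰ y, then d = x - y is nonnegative, so d ≤ d + d ≤ 0 and x ≤ y after all; stability
  -- concludes.
  halve : ∀ {x y} → x + x ≤ y + y → x ≤ y
  halve {x} {y} h = ≤-stable λ x≰y →
    let d≥0 = ≤⇒0≤- (≰⇒≥ x≰y)
        d+d≤0 = 0≤-⇒≤ (≤-trans (≤⇒0≤- h) (≤-reflexive (trans (regroup x y) (+-congʳ 0-homo))))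
        d≤d+d = ≤-trans (≤-reflexive (sym (+-identityʳ (x + - y)))) (+-mono-≤ (≤-refl {x + - y}) d≥0)
    in x≰y (0≤-⇒≤ (≤-trans (≤⇒0≤- (≤-trans d≤d+d d+d≤0)) (≤-reflexive (trans (+-congʳ (sym 0-homo)) (negate x y)))))
    where
    regroup : ∀ x y → (y + y) + - (x + x) ≈ ⟦ ℤ.0ℤ ⟧ + - ((x + - y) + (x + - y))
    regroup = solve 2 (λ x y → (y :+ y) :+ :- (x :+ x) := con ℤ.0ℤ :+ :- ((x :+ :- y) :+ (x :+ :- y))) refl
    negate : ∀ x y → ⟦ ℤ.0ℤ ⟧ + - (x + - y) ≈ y + - x
    negate = solve 2 (λ x y → con ℤ.0ℤ :+ :- (x :+ :- y) := y :+ :- x) refl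

  select : ∀ {K} (b : Vector Carrier K) c t → toℕ t ≡ c → sum (λ t → b t * ι (indicator (toℕ t ℕ.≟ c))) ≈ b t
  select {suc K} b _ t ≡.refl = trans (sum-remove {i = t} λ s → b s * ι (indicator (toℕ s ℕ.≟ toℕ t)))
    (trans (+-cong here (sum-zero {K} there)) (+-identityʳ (b t)))
    where
    here : b t * ι (indicator (toℕ t ℕ.≟ toℕ t)) ≈ b t
    here with toℕ t ℕ.≟ toℕ t
    ... | yes _ = trans (*-congˡ Integers.1-homo) (*-identityʳ (b t))
    ... | no t≢t = contradiction ≡.refl t≢t
    there : ∀ j → b (punchIn t j) * ι (indicator (toℕ (punchIn t j) ℕ.≟ toℕ t)) ≈ 0#
    there j with toℕ (punchIn t j) ℕ.≟ toℕ t
    ... | yes eq = contradiction (toℕ-injective eq) (punchInᵢ≢i t j)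
    ... | no _ = trans (*-congˡ 0-homo) (zeroʳ (b (punchIn t j)))

  select-none : ∀ {K} (b : Vector Carrier K) c → ¬ c ℕ.< K → sum (λ t → b t * ι (indicator (toℕ t ℕ.≟ c))) ≈ 0#
  select-none {K} b c c≮K = sum-zero {K} vanish
    where
    vanish : ∀ t → b t * ι (indicator (toℕ t ℕ.≟ c)) ≈ 0#
    vanish t with toℕ t ℕ.≟ c
    ... | yes ≡.refl = contradiction (toℕ<n t) c≮K
    ... | no _ = trans (*-congˡ 0-homo) (zeroʳ (b t))

  module Colouring {N} (A : Fin N → Fin N → ℕ) (A-sym : ∀ i j → A i j ≡ A j i) (col : Fin N → ℕ) where

    crossing : Fin N → Fin N → ℕ
    crossing i j = indicator (¬? (col i ℕ.≟ col j)) ℕ.* A i j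

    class : ℕ → Fin N → ℕ
    class t i = indicator (t ℕ.≟ col i)

    crossing-sym : ∀ i j → crossing i j ≡ crossing j i
    crossing-sym i j with col i ℕ.≟ col j | col j ℕ.≟ col i
    ... | yes _ | yes _ = ≡.refl
    ... | yes p | no ¬p = contradiction (≡.sym p) ¬p
    ... | no ¬p | yes p = contradiction (≡.sym p) ¬p
    ... | no _  | no _  = ≡.cong (1 ℕ.*_) (A-sym i j)

    module _ {K} (a : Vector Carrier K) where

      w : Vector Carrier N
      w = combination a λ t i → ι (class (toℕ t) i)

      -- The classes are disjoint, so squaring produces no mixed products of coefficients. At
      -- vertices whose colour is K or more both sides are 0.
      square-select : ∀ i → w i * w i ≈ sum λ t → (a t * a t) * ι (class (toℕ t) i)
      square-select i with col i ℕ.<? K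
      ... | yes c<K = trans (*-cong (select a _ t eq) (select a _ t eq)) (sym (select (λ t → a t * a t) _ t eq))
        where
        t = fromℕ< c<K
        eq = toℕ-fromℕ< c<K
      ... | no c≮K = trans (*-congʳ (select-none a _ c≮K))
        (trans (zeroˡ (w i)) (sym (select-none (λ t → a t * a t) _ c≮K)))

      weighted : ∀ (h : Fin N → ℕ) →
        sum (λ i → (w i * w i) * ι (h i)) ≈ sum λ t → (a t * a t) * ι (ℕΣ.sum λ i → class (toℕ t) i ℕ.* h i)
      weighted h = begin
        sum (λ i → (w i * w i) * ι (h i))
          ≈⟨ sum-cong-≋ {N} (λ i → trans (*-congʳ (square-select i)) (*-distribʳ-sum {K} (ι (h i)) (λ t → (a t * a t) * ι (class (toℕ t) i)))) ⟩
        sum (λ i → sum λ t → (a t * a t) * ι (class (toℕ t) i) * ι (h i))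
          ≈⟨ ∑-comm {N} {K} (λ i t → (a t * a t) * ι (class (toℕ t) i) * ι (h i)) ⟩
        sum (λ t → sum λ i → (a t * a t) * ι (class (toℕ t) i) * ι (h i))
          ≈⟨ sum-cong-≋ {K} (λ t → begin
            sum (λ i → (a t * a t) * ι (class (toℕ t) i) * ι (h i))
              ≈⟨ sum-cong-≋ {N} (λ i → trans (*-assoc _ _ _) (*-congˡ (sym (ι-* (class (toℕ t) i) (h i))))) ⟩
            sum (λ i → (a t * a t) * ι (class (toℕ t) i ℕ.* h i))
              ≈⟨ *-distribˡ-sum {N} (a t * a t) (λ i → ι (class (toℕ t) i ℕ.* h i)) ⟨
            (a t * a t) * sum (λ i → ι (class (toℕ t) i ℕ.* h i))
              ≈⟨ *-congˡ (ι-sum (λ i → class (toℕ t) i ℕ.* h i)) ⟨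
            (a t * a t) * ι (ℕΣ.sum λ i → class (toℕ t) i ℕ.* h i) ∎) ⟩
        sum (λ t → (a t * a t) * ι (ℕΣ.sum λ i → class (toℕ t) i ℕ.* h i)) ∎

      same-colour : ∀ i j → col i ≡ col j → w i ≈ w j
      same-colour i j eq = sum-cong-≋ {K} λ t → *-congˡ (reflexive (≡.cong (λ c → ι (indicator (toℕ t ℕ.≟ c))) eq))

      -- Edges within a class contribute no energy, because w is constant there.
      crossing-only : ∀ i j → ι (A i j) * (w i + - w j) ≈ ι (crossing i j) * (w i + - w j)
      crossing-only i j with col i ℕ.≟ col j
      ... | yes eq = trans (zero-difference (A i j)) (sym (zero-difference 0))
        where
        zero-difference : ∀ m → ι m * (w i + - w j) ≈ 0#
        zero-difference m = trans (*-congˡ (trans (+-congʳ (same-colour i j eq)) (-‿inverseʳ (w j)))) (zeroʳ (ι m))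
      ... | no _ = *-congʳ (reflexive (≡.cong ι (≡.sym (ℕ.*-identityˡ (A i j)))))

      module _ (M : Matrix N) (M-sym : ∀ i j → M i j ≈ M j i)
               (M≈ : ∀ x i → (M·_ M M-sym x) i ≈ sum λ j → ι (A i j) * (x i + - x j)) where

        private
          ⟨Mw,w⟩ = ⟨ M·_ M M-sym w , w ⟩
          out : Fin N → ℕ
          out i = ℕΣ.sum (crossing i)
          B : Fin N → Fin N → Carrier
          B i j = ι (crossing i j)

        energy : ⟨Mw,w⟩ ≈ sum λ i → sum λ j → B i j * (w i * (w i + - w j))
        energy = sum-cong-≋ {N} λ i → trans (*-congʳ (M≈ w i))
          (trans (*-distribʳ-sum {N} (w i) (λ j → ι (A i j) * (w i + - w j)))
            (sum-cong-≋ {N} λ j → trans (*-congʳ (crossing-only i j)) (swap (B i j) (w i) (w i + - w j))))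
          where
          swap : ∀ b x d → b * d * x ≈ b * (x * d)
          swap = solve 3 (λ b x d → b :* d :* x := b :* (x :* d)) refl

        S T : Carrier
        S = sum λ i → sum λ j → B i j * (w i * w i)
        T = sum λ i → sum λ j → B i j * (w j * w j)

        T≈S : T ≈ S
        T≈S = trans (∑-comm {N} {N} λ i j → B i j * (w j * w j)) (sum-cong-≋ {N} λ j → sum-cong-≋ {N} λ i →
          *-congʳ (reflexive (≡.cong ι (crossing-sym i j))))

        S≈ : S ≈ sum λ i → (w i * w i) * ι (out i)
        S≈ = sum-cong-≋ {N} λ i → trans (sym (*-distribʳ-sum {N} (w i * w i) (B i)))
          (trans (*-congʳ (sym (ι-sum (crossing i)))) (*-comm _ _))

        -- 2 x (x - y) = 3 x² + y² - (x + y)²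
        2energy≤ : ⟨Mw,w⟩ + ⟨Mw,w⟩ ≤ (S + S) + (S + S)
        2energy≤ = ≤-trans (≤-reflexive (+-cong energy energy))
          (≤-trans (≤-reflexive (sym (double (λ i j → B i j * (w i * (w i + - w j))) (λ i j → B i j * (w i * (w i + - w j))))))
          (≤-trans (sum-mono-≤ {N} λ i → sum-mono-≤ {N} λ j → pointwise (B i j) (w i) (w j) (ι≥0 (crossing i j)))
          (≤-reflexive (trans (double (λ i j → B i j * (w i * w i) + B i j * (w i * w i)) (λ i j → B i j * (w i * w i) + B i j * (w j * w j)))
            (+-cong (double (λ i j → B i j * (w i * w i)) (λ i j → B i j * (w i * w i)))
              (trans (double (λ i j → B i j * (w i * w i)) (λ i j → B i j * (w j * w j))) (+-congˡ T≈S)))))))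
          where
          double : ∀ (f g : Fin N → Fin N → Carrier) →
            sum (λ i → sum λ j → f i j + g i j) ≈ sum (λ i → sum (f i)) + sum (λ i → sum (g i))
          double f g = trans (sum-cong-≋ {N} λ i → ∑-distrib-+ {N} (f i) (g i)) (∑-distrib-+ {N} (λ i → sum (f i)) (λ i → sum (g i)))
          complete : ∀ b x y → b * ((x + y) * (x + y)) ≈ (b * (x * x) + b * (x * x)) + (b * (x * x) + b * (y * y))
                                                         + - (b * (x * (x + - y)) + b * (x * (x + - y)))
          complete = solve 3 (λ b x y → b :* ((x :+ y) :* (x :+ y)) := (b :* (x :* x) :+ b :* (x :* x)) :+ (b :* (x :* x) :+ b :* (y :* y))
                       :+ :- (b :* (x :* (x :+ :- y)) :+ b :* (x :* (x :+ :- y)))) refl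
          pointwise : ∀ b x y → 0# ≤ b → b * (x * (x + - y)) + b * (x * (x + - y)) ≤
                      (b * (x * x) + b * (x * x)) + (b * (x * x) + b * (y * y))
          pointwise b x y 0≤b = 0≤-⇒≤ (≤-trans (*-≥0 0≤b (x*x≥0 (x + y))) (≤-reflexive (complete b x y)))

        -- S weights each class by the number of its outgoing edges, so the hypothesis gives S ≤ C
        -- ⟨w,w⟩. As twice the energy is at most 4 S, the energy is at most 2 C ⟨w,w⟩.
        rayleigh : ∀ C → (∀ t → ℕΣ.sum (λ i → class (toℕ {K} t) i ℕ.* out i) ℕ.≤ C ℕ.* ℕΣ.sum (class (toℕ t))) →
                   ⟨Mw,w⟩ ≤ ι (C ℕ.+ C) * ⟨ w , w ⟩
        rayleigh C bound = halve (≤-trans 2energy≤ (≤-trans (+-mono-≤ (+-mono-≤ S≤ S≤) (+-mono-≤ S≤ S≤))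
            (≤-reflexive (+-cong collect collect))))
          where
          s = ⟨ w , w ⟩
          s≈ : ι C * s ≈ sum λ t → (a t * a t) * ι (C ℕ.* ℕΣ.sum (class (toℕ t)))
          s≈ = begin
            ι C * s
              ≈⟨ *-congˡ (sum-cong-≋ {N} λ i → trans (sym (*-identityʳ (w i * w i))) (*-congˡ (sym Integers.1-homo))) ⟩
            ι C * sum (λ i → (w i * w i) * ι 1)
              ≈⟨ *-congˡ (weighted (λ _ → 1)) ⟩
            ι C * sum (λ t → (a t * a t) * ι (ℕΣ.sum λ i → class (toℕ t) i ℕ.* 1))
              ≈⟨ *-distribˡ-sum {K} (ι C) (λ t → (a t * a t) * ι (ℕΣ.sum λ i → class (toℕ t) i ℕ.* 1)) ⟩
            sum (λ t → ι C * ((a t * a t) * ι (ℕΣ.sum λ i → class (toℕ t) i ℕ.* 1)))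
              ≈⟨ sum-cong-≋ {K} (λ t → trans (*-congˡ (*-congˡ (reflexive (≡.cong ι (ℕΣ.sum-cong-≗ λ i → ℕ.*-identityʳ (class (toℕ t) i))))))
                   (trans (swap (ι C) (a t * a t) _) (*-congˡ (sym (ι-* C _))))) ⟩
            sum (λ t → (a t * a t) * ι (C ℕ.* ℕΣ.sum (class (toℕ t)))) ∎
            where
            swap : ∀ c q x → c * (q * x) ≈ q * (c * x)
            swap = solve 3 (λ c q x → c :* (q :* x) := q :* (c :* x)) refl
          S≤ : S ≤ ι C * s
          S≤ = ≤-trans (≤-reflexive (trans S≈ (weighted out)))
            (≤-trans (sum-mono-≤ {K} λ t → *-monoʳ-≤ (x*x≥0 (a t)) (ι-mono-≤ (bound t))) (≤-reflexive (sym s≈)))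
          collect : ι C * s + ι C * s ≈ ι (C ℕ.+ C) * s
          collect = trans (sym (distribʳ s (ι C) (ι C))) (*-congʳ (sym (ι-+ C C)))

    detects : ∀ {K} (a : Vector Carrier K) → (∀ t → ∃[ i ] col i ≡ toℕ {K} t) → (∀ i → w a i ≈ 0#) → ∀ t → a t ≈ 0#
    detects a nonempty w≈0 t = let i , eq = nonempty t in trans (sym (select a (col i) t (≡.sym eq))) (w≈0 i)

  -- Indices start at 0, so index k means the (k+1)-st smallest eigenvalue. It is a lower bound for
  -- the N - k eigenvalues from there on, whose eigenvectors are played against k + 1 test
  -- functions.
  spectral-bound : ∀ k r {N} → N ≡ k ℕ.+ r → (M : Matrix N) (M-sym : ∀ i j → M i j ≈ M j i)
    (f : Fin (suc k) → Vector Carrier N) (c : Carrier) →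
    (∀ a → ⟨ M·_ M M-sym (combination a f) , combination a f ⟩ ≤ c * ⟨ combination a f , combination a f ⟩) →
    (∀ a → (∀ i → combination a f i ≈ 0#) → ∀ t → a t ≈ 0#) →
    ∀ (λs : Vector Carrier N) (v : Fin N → Vector Carrier N) →
    (∀ i j → i Fin.≤ j → λs i ≤ λs j) → (∀ i j → (M·_ M M-sym (v i)) j ≈ λs i * v i j) →
    (∀ a → (∀ j → combination a v j ≈ 0#) → ∀ i → a i ≈ 0#) →
    ∀ i → toℕ i ≡ k → λs i ≤ c
  spectral-bound k r {N} ≡.refl M M-sym f c bound f-indep λs v sorted eigen independent i i≡k =
    courant-fischer M M-sym f c bound f-indep r ≡.refl (λ j → v (k ↑ʳ j)) (λ j → λs (k ↑ʳ j))
      (λ j → eigen (k ↑ʳ j))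
      (λ p q p≤q → sorted (k ↑ʳ p) (k ↑ʳ q)
        (≡.subst₂ ℕ._≤_ (≡.sym (toℕ-↑ʳ k p)) (≡.sym (toℕ-↑ʳ k q)) (ℕ.+-monoʳ-≤ k p≤q)))
      v-indep (λs i)
      (λ j → sorted i (k ↑ʳ j) (≡.subst₂ ℕ._≤_ (≡.sym i≡k) (≡.sym (toℕ-↑ʳ k j)) (ℕ.m≤m+n k (toℕ j))))
    where
    v-indep : ∀ b → (∀ j → combination b (λ j → v (k ↑ʳ j)) j ≈ 0#) → ∀ t → b t ≈ 0#
    -- A subfamily stays independent: extend the coefficients by zeros.
    v-indep b h t = trans (reflexive (≡.sym (lookup-++ʳ zeros b t))) (independent (zeros ++ b) relation (k ↑ʳ t))
      where
      zeros : Vector Carrier k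
      zeros _ = 0#
      relation : ∀ j → combination (zeros ++ b) v j ≈ 0#
      relation j = trans (sum-↑ k (λ i → (zeros ++ b) i * v i j))
        (trans (+-cong
          (sum-zero {k} λ p → trans (*-congʳ (reflexive (lookup-++ˡ zeros b p))) (zeroˡ (v (p ↑ˡ r) j)))
          (trans (sum-cong-≋ {r} λ p → *-congʳ (reflexive (lookup-++ʳ zeros b p))) (h j)))
          (+-identityˡ 0#))

  diagonal : ∀ {n} i d (x : Vector Carrier n) → sum (λ j → ι (indicator (i ≟ j) ℕ.* d) * x j) ≈ ι d * x i
  diagonal {suc n} i d x = trans (sum-remove {i = i} λ j → ι (indicator (i ≟ j) ℕ.* d) * x j)
    (trans (+-cong here (sum-zero {n} there)) (+-identityʳ (ι d * x i)))
    where
    here : ι (indicator (i ≟ i) ℕ.* d) * x i ≈ ι d * x i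
    here with i ≟ i
    ... | yes _ = *-congʳ (reflexive (≡.cong ι (ℕ.+-identityʳ d)))
    ... | no i≢i = contradiction ≡.refl i≢i
    there : ∀ j → ι (indicator (i ≟ punchIn i j) ℕ.* d) * x (punchIn i j) ≈ 0#
    there j with i ≟ punchIn i j
    ... | yes eq = contradiction (≡.sym eq) (punchInᵢ≢i i j)
    ... | no _ = trans (*-congʳ 0-homo) (zeroˡ (x (punchIn i j)))

  module _ {N} (A : Fin N → Fin N → ℕ) (A-sym : ∀ i j → A i j ≡ A j i) (col : Fin N → ℕ) where
    open Colouring A A-sym col

    laplacian-bound : ∀ (D : Fin N → Fin N → ℤ.ℤ) →
      (∀ i j → D i j ≡ ℤ.+ (indicator (i ≟ j) ℕ.* ℕΣ.sum (A i)) ℤ.- ℤ.+ A i j) →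
      (∀ i j → D i j ≡ D j i) →
      ∀ k C → k ℕ.< N → (∀ t → ∃[ i ] col i ≡ toℕ {suc k} t) →
      (∀ t → ℕΣ.sum (λ i → class (toℕ {suc k} t) i ℕ.* ℕΣ.sum (crossing i)) ℕ.≤ C ℕ.* ℕΣ.sum (class (toℕ t))) →
      ∀ (λs : Vector Carrier N) (v : Fin N → Vector Carrier N) →
      (∀ i j → i Fin.≤ j → λs i ≤ λs j) → (∀ i j → sum (λ l → ⟦ D j l ⟧ * v i l) ≈ λs i * v i j) →
      (∀ a → (∀ j → combination a v j ≈ 0#) → ∀ i → a i ≈ 0#) →
      ∀ i → toℕ i ≡ k → λs i ≤ ι (C ℕ.+ C)
    laplacian-bound D D≡ D-sym k C k<N nonempty bound =
      spectral-bound k (N ℕ.∸ k) (≡.sym (ℕ.m+[n∸m]≡n (ℕ.<⇒≤ k<N))) (λ i j → ⟦ D i j ⟧) M-sym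
        (λ t i → ι (class (toℕ t) i)) (ι (C ℕ.+ C))
        (λ a → rayleigh a (λ i j → ⟦ D i j ⟧) M-sym action C bound)
        (λ a → detects a nonempty)
      where
      M-sym : ∀ i j → ⟦ D i j ⟧ ≈ ⟦ D j i ⟧
      M-sym i j = reflexive (≡.cong ⟦_⟧ (D-sym i j))
      action : ∀ x i → sum (λ j → ⟦ D i j ⟧ * x j) ≈ sum (λ j → ι (A i j) * (x i + - x j))
      action x i = begin
        sum (λ j → ⟦ D i j ⟧ * x j)
          ≈⟨ sum-cong-≋ {N} (λ j → trans (*-congʳ (entry j)) (distribʳ (x j) (δ j) (- ι (A i j)))) ⟩
        sum (λ j → δ j * x j + - ι (A i j) * x j)
          ≈⟨ ∑-distrib-+ {N} (λ j → δ j * x j) (λ j → - ι (A i j) * x j) ⟩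
        sum (λ j → δ j * x j) + sum (λ j → - ι (A i j) * x j)
          ≈⟨ +-congʳ (trans (diagonal i (ℕΣ.sum (A i)) x) (trans (*-congʳ (ι-sum (A i))) (*-distribʳ-sum {N} (x i) (λ j → ι (A i j))))) ⟩
        sum (λ j → ι (A i j) * x i) + sum (λ j → - ι (A i j) * x j)
          ≈⟨ ∑-distrib-+ {N} (λ j → ι (A i j) * x i) (λ j → - ι (A i j) * x j) ⟨
        sum (λ j → ι (A i j) * x i + - ι (A i j) * x j)
          ≈⟨ sum-cong-≋ {N} (λ j → collect (ι (A i j)) (x i) (x j)) ⟩
        sum (λ j → ι (A i j) * (x i + - x j)) ∎
        where
        δ : Fin N → Carrier
        δ j = ι (indicator (i ≟ j) ℕ.* ℕΣ.sum (A i))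
        entry : ∀ j → ⟦ D i j ⟧ ≈ δ j + - ι (A i j)
        entry j = trans (reflexive (≡.cong ⟦_⟧ (D≡ i j))) (trans (Integers.+-homo _ (ℤ.- ℤ.+ A i j)) (+-congˡ (Integers.-‿homo (ℤ.+ A i j))))
        collect : ∀ a x y → a * x + - a * y ≈ a * (x + - y)
        collect = solve 3 (λ a x y → a :* x :+ :- a :* y := a :* (x :+ :- y)) refl

-- The eigenvalue bound for coloured simple graphs.

module Laplacian where
  open import Data.Fin.Base as Fin using (Fin; zero; suc; toℕ; fromℕ<)
  open import Data.Fin.Properties using (_≟_; toℕ<n; toℕ-fromℕ<; toℕ-injective; injective⇒≤)
  open import Data.Integer.Base as ℤ using (+_)
  open import Data.List.Base as List using (List; allFin; filter; length; map; tabulate)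
  open import Data.Nat.Base as ℕ using (ℕ; zero; suc)
  import Data.Nat.ListAction as ℕ
  import Data.Nat.Properties as ℕ
  open import Data.Product using (_,_; ∃-syntax; proj₁; proj₂)
  open import Defs using (fromℤ; IsSpectrum; SimpleGraph; degreeMatrix; adjacencyMatrix; KthLaplacianEigenvalue≤)
  open import Function.Base using (_∘_)
  open Reals using (↑≃; ↓≃; ↑≼; ↓≼; ℝ-orderedRing)
  open import Relation.Binary.PropositionalEquality as ≡ using (_≡_)
  open import Relation.Nullary.Decidable using (yes; no; ¬?; _×-dec_)
  open import Relation.Nullary.Negation using (contradiction)
  open import Relation.Unary using (Decidable)

  open Counting using (indicator; filter-length; module ℕΣ)
  open Spectral ℝ-orderedRing hiding (Matrix)

  filter-sum : ∀ {A : Set} {P : A → Set} (P? : Decidable P) (h : A → ℕ) {n} (f : Fin n → A) →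
    ℕ.sum (map h (filter P? (tabulate f))) ≡ ℕΣ.sum (λ i → indicator (P? (f i)) ℕ.* h (f i))
  filter-sum P? h {zero}  f = ≡.refl
  filter-sum P? h {suc n} f with P? (f zero)
  ... | yes _ = ≡.cong₂ ℕ._+_ (≡.sym (ℕ.+-identityʳ _)) (filter-sum P? h (f ∘ suc))
  ... | no _  = filter-sum P? h (f ∘ suc)

  module _ (G : SimpleGraph) (col : Fin (SimpleGraph.order G) → ℕ) where
    open SimpleGraph G

    colourClass : ℕ → List (Fin order)
    colourClass t = filter (λ i → t ℕ.≟ col i) (allFin order)

    exits : Fin order → List (Fin order)
    exits i = filter (λ j → ¬? (col i ℕ.≟ col j) ×-dec adj? i j) (allFin order)

    private
      A : Fin order → Fin order → ℕ
      A i j = indicator (adj? i j)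

      A-sym : ∀ i j → A i j ≡ A j i
      A-sym i j with adj? i j | adj? j i
      ... | yes _ | yes _ = ≡.refl
      ... | no _  | no _  = ≡.refl
      ... | yes p | no ¬p = contradiction (adj-sym p) ¬p
      ... | no ¬p | yes p = contradiction (adj-sym p) ¬p

      open Colouring A A-sym col

      D : Fin order → Fin order → ℤ.ℤ
      D i j = degreeMatrix G i j ℤ.- adjacencyMatrix G i j

      D≡ : ∀ i j → D i j ≡ + (indicator (i ≟ j) ℕ.* ℕΣ.sum (A i)) ℤ.- + A i j
      D≡ i j = ≡.cong₂ ℤ._-_ diag adj
        where
        diag : degreeMatrix G i j ≡ + (indicator (i ≟ j) ℕ.* ℕΣ.sum (A i))
        diag with i ≟ j
        ... | yes _ = ≡.cong +_ (≡.trans (filter-length (adj? i) (λ j → j)) (≡.sym (ℕ.+-identityʳ _)))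
        ... | no _  = ≡.refl
        adj : adjacencyMatrix G i j ≡ + A i j
        adj with adj? i j
        ... | yes _ = ≡.refl
        ... | no _  = ≡.refl

      D-sym : ∀ i j → D i j ≡ D j i
      D-sym i j = ≡.cong₂ ℤ._-_ diag adj
        where
        diag : degreeMatrix G i j ≡ degreeMatrix G j i
        diag with i ≟ j | j ≟ i
        ... | yes ≡.refl | yes _ = ≡.refl
        ... | no _  | no _  = ≡.refl
        ... | yes p | no ¬p = contradiction (≡.sym p) ¬p
        ... | no ¬p | yes p = contradiction (≡.sym p) ¬p
        adj : adjacencyMatrix G i j ≡ adjacencyMatrix G j i
        adj with adj? i j | adj? j i
        ... | yes _ | yes _ = ≡.refl
        ... | no _  | no _  = ≡.refl
        ... | yes p | no ¬p = contradiction (adj-sym p) ¬p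
        ... | no ¬p | yes p = contradiction (adj-sym p) ¬p

      crossing≡ : ∀ i → ℕΣ.sum (crossing i) ≡ length (exits i)
      crossing≡ i = ≡.trans (ℕΣ.sum-cong-≗ same) (≡.sym (filter-length (λ j → ¬? (col i ℕ.≟ col j) ×-dec adj? i j) (λ j → j)))
        where
        same : ∀ j → crossing i j ≡ indicator (¬? (col i ℕ.≟ col j) ×-dec adj? i j)
        same j with col i ℕ.≟ col j | adj? i j
        ... | yes _ | yes _ = ≡.refl
        ... | yes _ | no _  = ≡.refl
        ... | no _  | yes _ = ≡.refl
        ... | no _  | no _  = ≡.refl

    -- The classes 0, ..., k carry the test functions. Colours above k are unrestricted, as every
    -- test function vanishes on them. The nonempty classes also show that the graph has more than k
    -- vertices.
    eigenvalue-bound : ∀ k C → (∀ t → t ℕ.≤ k → ∃[ i ] col i ≡ t) →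
      (∀ t → t ℕ.≤ k → ℕ.sum (map (length ∘ exits) (colourClass t)) ℕ.≤ C ℕ.* length (colourClass t)) →
      KthLaplacianEigenvalue≤ G (suc k) (fromℤ (+ (C ℕ.+ C)))
    eigenvalue-bound k C nonempty small = fromℕ< k<order , ≡.cong suc (toℕ-fromℕ< k<order) , λ λs spectrum →
        let open IsSpectrum spectrum in
        ↓≼ (laplacian-bound A A-sym col D D≡ D-sym k C k<order
          (λ t → nonempty (toℕ t) (ℕ.s≤s⁻¹ (toℕ<n t))) (λ t → bound (toℕ t) (ℕ.s≤s⁻¹ (toℕ<n t)))
          λs eigenvectors (λ i j i≤j → ↑≼ (sorted i j i≤j)) (λ i j → ↑≃ (eigen i j))
          (λ a h i → ↑≃ (independent a (λ j → ↓≃ (h j)) i))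
          (fromℕ< k<order) (toℕ-fromℕ< k<order))
      where
      pick : Fin (suc k) → Fin order
      pick t = proj₁ (nonempty (toℕ t) (ℕ.s≤s⁻¹ (toℕ<n t)))
      col-pick : ∀ t → col (pick t) ≡ toℕ t
      col-pick t = proj₂ (nonempty (toℕ t) (ℕ.s≤s⁻¹ (toℕ<n t)))
      k<order : k ℕ.< order
      k<order = injective⇒≤ {f = pick} λ {s} {t} eq →
        toℕ-injective (≡.trans (≡.sym (col-pick s)) (≡.trans (≡.cong col eq) (col-pick t)))
      bound : ∀ t → t ℕ.≤ k → ℕΣ.sum (λ i → class t i ℕ.* ℕΣ.sum (crossing i)) ℕ.≤ C ℕ.* ℕΣ.sum (class t)
      bound t t≤k = ≡.subst₂ ℕ._≤_
        (≡.trans (filter-sum (λ i → t ℕ.≟ col i) (length ∘ exits) (λ i → i))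
          (ℕΣ.sum-cong-≗ λ i → ≡.cong (class t i ℕ.*_) (≡.sym (crossing≡ i))))
        (≡.cong (C ℕ.*_) (filter-length (λ i → t ℕ.≟ col i) (λ i → i)))
        (small t t≤k)

-- Multigraphs as multiplicity functions.

open import Data.Fin.Base using (Fin; combine; remQuot; suc; toℕ; zero)
open import Data.Fin.Permutation using (Permutation′; _⟨$⟩ʳ_; _⟨$⟩ˡ_; inverseʳ; inverseˡ; permutation)
open import Data.Fin.Properties using (_≟_; combine-remQuot; remQuot-combine; toℕ-fromℕ<; toℕ-injective; toℕ<n)
open import Data.List.Base using (List; []; _++_; _∷_; allFin; cartesianProduct; filter; length; map)
open import Data.List.Membership.Propositional using (_∈_; _∉_)
open import Data.List.Membership.Propositional.Properties using (∈-++⁺ʳ; ∈-++⁺ˡ; ∈-allFin; ∈-cartesianProduct⁺; ∈-filter⁺; ∈-filter⁻; ∈-map⁺)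
open import Data.List.Properties using (length-++; length-map; length-tabulate)
open import Data.List.Relation.Unary.Any using (here; there)
open import Data.List.Relation.Unary.Unique.Propositional using (Unique)
import Data.List.Relation.Unary.Unique.Propositional.Properties as Unique
open import Data.Nat.Base using (>-nonZero; NonZero; _*_; _+_; _<_; _∸_; _≤_; suc; s≤s; s≤s⁻¹; zero; z≤n; ℕ)
open import Data.Nat.DivMod
open import Data.Nat.ListAction using (sum)
import Data.Nat.Properties as ℕ
open import Data.Nat.Properties hiding (_≟_; suc-injective)
open import Data.Nat.Solver using (module +-*-Solver)
open import Data.Product using (_,_; _×_; proj₁; proj₂; Σ-syntax; ∃-syntax)
open import Data.Sum.Base as ⊎ using ([_,_]′; _⊎_; inj₁; inj₂)
open import Data.Vec.Base as Vec using (Vec; []; _[_]%=_; _[_]≔_; _∷_; concat; count; lookup; tabulate)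
open import Data.Vec.Properties using (lookup∘updateAt; lookup∘updateAt′)
open import Data.Vec.Relation.Unary.Any as Any using (Any; here; there)
open import Defs hiding (_+_; _*_; _≤_)
open import Function.Base using (_∘_; const; id)
open import Relation.Binary.Construct.Closure.ReflexiveTransitive as Star using (Star; _◅_; _◅◅_; kleisliStar) renaming (ε to done)
open import Relation.Binary.PropositionalEquality using (_≡_; _≢_; cong; cong₂; module ≡-Reasoning; refl; subst; subst₂; sym; trans)
open import Relation.Nullary.Decidable using (Dec; _×-dec_; no; yes; ¬?)
open import Relation.Nullary.Negation using (contradiction; ¬_)
open import Relation.Unary using (Decidable)

open Counting

-- Multiplicities forget the names and orientations of edges, so that `≋` becomes pointwise equality
-- and a local change of a graph becomes an equation in ℕ.
Mult : ℕ → Set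
Mult n = Fin n → Fin n → ℕ

private
  variable
    n m : ℕ
    f g : Mult n

δ : Fin n → Fin n → Mult n
δ a b u v = indicator (joins? {m = 0} u v (a ∷ b ∷ []))

Ends : Fin n → Fin n → Fin n → Fin n → Set
Ends a b u v = (a ≡ u × b ≡ v) ⊎ (a ≡ v × b ≡ u)

δ-cong : ∀ {n′} {a b u v : Fin n} {a′ b′ u′ v′ : Fin n′} →
  (Ends a b u v → Ends a′ b′ u′ v′) → (Ends a′ b′ u′ v′ → Ends a b u v) → δ a b u v ≡ δ a′ b′ u′ v′
δ-cong {a = a} {b} {u} {v} {a′} {b′} {u′} {v′} =
  indicator-cong (joins? {m = 0} u v (a ∷ b ∷ [])) (joins? {m = 0} u′ v′ (a′ ∷ b′ ∷ []))

δ-self : ∀ (a b : Fin n) → δ a b a b ≡ 1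
δ-self a b = indicator-yes (joins? {m = 0} a b (a ∷ b ∷ [])) (inj₁ (refl , refl))

δ-≥1 : ∀ (a b : Fin n) u v → 1 ≤ δ a b u v → Ends a b u v
δ-≥1 a b u v = indicator-≥1 (joins? {m = 0} u v (a ∷ b ∷ []))

δ-0 : ∀ (a b : Fin n) u v → ¬ Ends a b u v → δ a b u v ≡ 0
δ-0 a b u v = indicator-no (joins? {m = 0} u v (a ∷ b ∷ []))

δ-swap : ∀ (a b u v : Fin n) → δ a b u v ≡ δ b a u v
δ-swap a b u v = δ-cong {a = a} {b} {u} {v} {b} {a} {u} {v} swap swap
  where
  swap : ∀ {a b u v : Fin n} → Ends a b u v → Ends b a u v
  swap (inj₁ (p , q)) = inj₂ (q , p)
  swap (inj₂ (p , q)) = inj₁ (q , p)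

δ-sym : ∀ (a b u v : Fin n) → δ a b u v ≡ δ a b v u
δ-sym a b u v = δ-cong {a = a} {b} {u} {v} {a} {b} {v} {u} ⊎.swap ⊎.swap

count-∷ : ∀ {A : Set} {P : A → Set} (P? : Decidable P) x (xs : Vec A n) →
  count P? (x ∷ xs) ≡ indicator (P? x) + count P? xs
count-∷ P? x xs with P? x
... | yes _ = refl
... | no _  = refl

-- joins? carries the number of edges as a parameter, so that multiplicity does
-- not reduce along the list of edges; mult does.
mult : Vec (Edge n) m → Mult n
mult []                  u v = 0
mult ((a ∷ b ∷ []) ∷ G) u v = δ a b u v + mult G u v

multiplicity≡mult : ∀ (G : Multigraph n m) u v → multiplicity G u v ≡ mult G u v
multiplicity≡mult {m = m} G = any-length m G
  where
  any-length : ∀ {n l} m (G : Vec (Edge n) l) u v → count (joins? {m = m} u v) G ≡ mult G u v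
  any-length m []                  u v = refl
  any-length m ((a ∷ b ∷ []) ∷ G) u v = trans (count-∷ (joins? {m = m} u v) (a ∷ b ∷ []) G)
    (cong (δ a b u v +_) (any-length m G u v))

edge : Edge n → Mult n
edge (a ∷ b ∷ []) = δ a b

mult-sym : ∀ (G : Multigraph n m) u v → mult G u v ≡ mult G v u
mult-sym []                  u v = refl
mult-sym ((a ∷ b ∷ []) ∷ G) u v = cong₂ _+_ (δ-sym a b u v) (mult-sym G u v)

-- The replaced edge is added on the left instead of being subtracted on the right, because
-- subtraction in ℕ is truncated. All later balances have this form.
updateAt-mult : ∀ (G : Multigraph n m) p h u v →
  mult (G [ p ]%= h) u v + edge (lookup G p) u v ≡ mult G u v + edge (h (lookup G p)) u v
updateAt-mult (e@(a ∷ b ∷ []) ∷ G) zero h u v with h e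
... | c ∷ d ∷ [] = solve 3 (λ x y z → x :+ y :+ z := z :+ y :+ x) refl (δ c d u v) (mult G u v) (δ a b u v)
  where open +-*-Solver
updateAt-mult ((a ∷ b ∷ []) ∷ G) (suc p) h u v = trans (+-assoc (δ a b u v) _ _)
  (trans (cong (δ a b u v +_) (updateAt-mult G p h u v)) (sym (+-assoc (δ a b u v) _ _)))

edge-≤ : ∀ (G : Multigraph n m) p u v → edge (lookup G p) u v ≤ mult G u v
edge-≤ ((a ∷ b ∷ []) ∷ G) zero    u v = m≤m+n _ _
edge-≤ ((a ∷ b ∷ []) ∷ G) (suc p) u v = ≤-trans (edge-≤ G p u v) (m≤n+m _ _)

-- Distinct positions count separately even when they hold parallel edges; this is how a
-- multiplicity of 2 is detected later.
edges-≤ : ∀ (G : Multigraph n m) p q → p ≢ q → ∀ u v → edge (lookup G p) u v + edge (lookup G q) u v ≤ mult G u v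
edges-≤ G zero zero p≢q u v = contradiction refl p≢q
edges-≤ ((a ∷ b ∷ []) ∷ G) zero (suc q) p≢q u v = +-monoʳ-≤ (δ a b u v) (edge-≤ G q u v)
edges-≤ ((a ∷ b ∷ []) ∷ G) (suc p) zero p≢q u v = ≤-trans (≤-reflexive (+-comm (edge (lookup G p) u v) _))
  (+-monoʳ-≤ (δ a b u v) (edge-≤ G p u v))
edges-≤ ((a ∷ b ∷ []) ∷ G) (suc p) (suc q) p≢q u v = ≤-trans (edges-≤ G p q (p≢q ∘ cong suc) u v) (m≤n+m _ _)

position : ∀ (G : Multigraph n m) u v → 1 ≤ mult G u v → ∃[ p ] 1 ≤ edge (lookup G p) u v
position ((a ∷ b ∷ []) ∷ G) u v h with joins? {m = 0} u v (a ∷ b ∷ [])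
... | yes j = zero , ≤-reflexive (sym (indicator-yes (joins? {m = 0} u v (a ∷ b ∷ [])) j))
... | no ¬j = let p , q = position G u v h in suc p , q

≥1⇒neighbours : ∀ (G : Multigraph n m) {u v} → 1 ≤ mult G u v → Neighbours G u v
≥1⇒neighbours {m = m} G = any-length m G
  where
  any-length : ∀ {n l} m (G : Vec (Edge n) l) {u v} → 1 ≤ mult G u v → Any (Joins {m = m} u v) G
  any-length m ((a ∷ b ∷ []) ∷ G) {u} {v} h with joins? {m = 0} u v (a ∷ b ∷ [])
  ... | yes j = here j
  ... | no ¬j = there (any-length m G h)

neighbours⇒≥1 : ∀ (G : Multigraph n m) {u v} → Neighbours G u v → 1 ≤ mult G u v
neighbours⇒≥1 {m = m} G = any-length m G
  where
  any-length : ∀ {n l} m (G : Vec (Edge n) l) {u v} → Any (Joins {m = m} u v) G → 1 ≤ mult G u v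
  any-length m ((a ∷ b ∷ []) ∷ G) {u} {v} (here j)  =
    ≤-trans (≤-reflexive (sym (indicator-yes (joins? {m = 0} u v (a ∷ b ∷ [])) j))) (m≤m+n _ _)
  any-length m ((a ∷ b ∷ []) ∷ G) (there h) = ≤-trans (any-length m G h) (m≤n+m _ _)

-- The extra summand gives every loop at v its second half-edge.
deg : Mult n → Fin n → ℕ
deg {n} f v = ℕΣ.sum (f v) + f v v

loops : Mult n → ℕ
loops f = ℕΣ.sum λ v → f v v

deg-cong : (∀ u v → f u v ≡ g u v) → ∀ v → deg f v ≡ deg g v
deg-cong {n} f≗g v = cong₂ _+_ (ℕΣ.sum-cong-≗ {n} (f≗g v)) (f≗g v v)

loops-cong : (∀ u v → f u v ≡ g u v) → loops f ≡ loops g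
loops-cong {n} f≗g = ℕΣ.sum-cong-≗ {n} λ v → f≗g v v

_⊕_ : Mult n → Mult n → Mult n
(f ⊕ g) u v = f u v + g u v

deg-⊕ : ∀ (f g : Mult n) v → deg (f ⊕ g) v ≡ deg f v + deg g v
deg-⊕ {n} f g v = trans (cong (_+ (f v v + g v v)) (ℕΣ.∑-distrib-+ {n} (f v) (g v)))
  (solve 4 (λ a b c d → a :+ b :+ (c :+ d) := a :+ c :+ (b :+ d)) refl (ℕΣ.sum (f v)) (ℕΣ.sum (g v)) (f v v) (g v v))
  where open +-*-Solver

loops-⊕ : ∀ (f g : Mult n) → loops (f ⊕ g) ≡ loops f + loops g
loops-⊕ {n} f g = ℕΣ.∑-distrib-+ {n} (λ v → f v v) (λ v → g v v)

sum-δ : ∀ {a b u : Fin n} c → (∀ w → Ends a b u w → c ≡ w) → (∀ w → c ≡ w → Ends a b u w) →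
  ℕΣ.sum (δ a b u) ≡ 1
sum-δ {n} {a} {b} {u} c to from = trans (ℕΣ.sum-cong-≗ {n} λ w →
  indicator-cong (joins? {m = 0} u w (a ∷ b ∷ [])) (c ≟ w) (to w) (from w)) (sum-single c)

deg-δ : ∀ (a b v : Fin n) → deg (δ a b) v ≡ indicator (a ≟ v) + indicator (b ≟ v)
deg-δ {n} a b v = cases (a ≟ v) (b ≟ v)
  where
  cases : Dec (a ≡ v) → Dec (b ≡ v) → deg (δ a b) v ≡ indicator (a ≟ v) + indicator (b ≟ v)
  cases (yes refl) (yes refl) = trans
    (cong₂ _+_ (sum-δ a (λ { w (inj₁ (_ , q)) → q ; w (inj₂ (q , _)) → q }) (λ w q → inj₁ (refl , q))) (δ-self a a))
    (sym (cong₂ _+_ (indicator-yes (a ≟ a) refl) (indicator-yes (a ≟ a) refl)))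
  cases (yes refl) (no b≢a) = trans
    (cong₂ _+_ (sum-δ b (λ { w (inj₁ (_ , q)) → q ; w (inj₂ (_ , q)) → contradiction q b≢a }) (λ w q → inj₁ (refl , q)))
               (δ-0 a b a a λ { (inj₁ (_ , q)) → b≢a q ; (inj₂ (_ , q)) → b≢a q }))
    (sym (cong₂ _+_ (indicator-yes (a ≟ a) refl) (indicator-no (b ≟ a) b≢a)))
  cases (no a≢b) (yes refl) = trans
    (cong₂ _+_ (sum-δ a (λ { w (inj₁ (q , _)) → contradiction q a≢b ; w (inj₂ (q , _)) → q }) (λ w q → inj₂ (q , refl)))
               (δ-0 a b b b λ { (inj₁ (q , _)) → a≢b q ; (inj₂ (q , _)) → a≢b q }))
    (sym (cong₂ _+_ (indicator-no (a ≟ b) a≢b) (indicator-yes (b ≟ b) refl)))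
  cases (no a≢v) (no b≢v) = trans
    (cong₂ _+_ (sum-zeros λ w → δ-0 a b v w λ { (inj₁ (q , _)) → a≢v q ; (inj₂ (_ , q)) → b≢v q })
               (δ-0 a b v v λ { (inj₁ (q , _)) → a≢v q ; (inj₂ (q , _)) → a≢v q }))
    (sym (cong₂ _+_ (indicator-no (a ≟ v) a≢v) (indicator-no (b ≟ v) b≢v)))

loops-δ : ∀ (a b : Fin n) → loops (δ a b) ≡ indicator (a ≟ b)
loops-δ {n} a b = cases (a ≟ b)
  where
  cases : Dec (a ≡ b) → loops (δ a b) ≡ indicator (a ≟ b)
  cases (yes refl) = trans (trans (ℕΣ.sum-cong-≗ {n} λ v → indicator-cong (joins? {m = 0} v v (a ∷ a ∷ [])) (a ≟ v)
      (λ { (inj₁ (q , _)) → q ; (inj₂ (q , _)) → q }) (λ q → inj₁ (q , q))) (sum-single a))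
    (sym (indicator-yes (a ≟ a) refl))
  cases (no a≢b) = trans
    (sum-zeros λ v → δ-0 a b v v λ { (inj₁ (p , q)) → a≢b (trans p (sym q)) ; (inj₂ (p , q)) → a≢b (trans p (sym q)) })
    (sym (indicator-no (a ≟ b) a≢b))

degree-deg : ∀ (G : Multigraph n m) v → degree G v ≡ deg (mult G) v
degree-deg {n} [] v = sym (cong (_+ 0) (sum-zeros {n} λ _ → refl))
degree-deg ((a ∷ b ∷ []) ∷ G) v = begin
  degree ((a ∷ b ∷ []) ∷ G) v
    ≡⟨ count-∷ (_≟ v) a (b ∷ concat G) ⟩
  indicator (a ≟ v) + count (_≟ v) (b ∷ concat G)
    ≡⟨ cong (indicator (a ≟ v) +_) (count-∷ (_≟ v) b (concat G)) ⟩
  indicator (a ≟ v) + (indicator (b ≟ v) + degree G v)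
    ≡⟨ sym (+-assoc (indicator (a ≟ v)) _ _) ⟩
  indicator (a ≟ v) + indicator (b ≟ v) + degree G v
    ≡⟨ cong₂ _+_ (sym (deg-δ a b v)) (degree-deg G v) ⟩
  deg (δ a b) v + deg (mult G) v
    ≡⟨ sym (deg-⊕ (δ a b) (mult G) v) ⟩
  deg (mult ((a ∷ b ∷ []) ∷ G)) v ∎
  where open ≡-Reasoning

support : (Fin n → ℕ) → List (Fin n)
support {n} h = filter (λ w → 1 ≤? h w) (allFin n)

∈-support⁺ : ∀ {h : Fin n → ℕ} {w} → 1 ≤ h w → w ∈ support h
∈-support⁺ {w = w} = ∈-filter⁺ _ (∈-allFin w)

∈-support⁻ : ∀ {h : Fin n → ℕ} {w} → w ∈ support h → 1 ≤ h w
∈-support⁻ {n} {h} w∈ = proj₂ (∈-filter⁻ (λ w → 1 ≤? h w) {xs = allFin n} w∈)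

length-support : ∀ (h : Fin n → ℕ) → length (support h) ≤ ℕΣ.sum h
length-support h = ≤-trans (≤-reflexive (filter-length (λ w → 1 ≤? h w) id)) (sum-mono-≤ λ w → bound (h w) (1 ≤? h w))
  where
  bound : ∀ k (d : Dec (1 ≤ k)) → indicator d ≤ k
  bound k (yes p) = p
  bound k (no _)  = z≤n

nb : Mult n → Fin n → List (Fin n)
nb f v = support (f v)

loopVertices : Mult n → List (Fin n)
loopVertices f = support λ v → f v v

length-nb : (∀ v → deg f v ≡ 3) → ∀ v → length (nb f v) ≤ 3
length-nb {f = f} cubic v = ≤-trans (length-support (f v)) (≤-trans (m≤m+n _ _) (≤-reflexive (cubic v)))

-- Whitehead moves as switches of multiplicity functions.

-- x is the other end of the half-edge moved from u₁ to u₂, and y the other end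
-- of the one moved from u₂ to u₁.
record Switch {n} (u₁ u₂ x y : Fin n) (f g : Mult n) : Set where
  field
    u₁≢u₂   : u₁ ≢ u₂
    balance : ∀ a b → g a b + (δ u₁ x a b + δ u₂ y a b) ≡ f a b + (δ u₂ x a b + δ u₁ y a b)
    old₁    : ∀ a b → δ u₁ u₂ a b + δ u₁ x a b ≤ f a b
    old₂    : ∀ a b → δ u₁ u₂ a b + δ u₂ y a b ≤ f a b
    new₁    : ∀ a b → δ u₁ u₂ a b + δ u₁ y a b ≤ g a b
    new₂    : ∀ a b → δ u₁ u₂ a b + δ u₂ x a b ≤ g a b

-- Swapping the same half-edges back. `Switch` records the edges present before and after the move
-- precisely so that both directions have the same form.
reverse : ∀ {u₁ u₂ x y : Fin n} → Switch u₁ u₂ x y f g → Switch u₁ u₂ y x g f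
reverse {f = f} {g} {u₁} {u₂} {x} {y} S = record
  { u₁≢u₂ = u₁≢u₂
  ; balance = λ a b → trans (cong (f a b +_) (+-comm (δ u₁ y a b) (δ u₂ x a b))) (trans (sym (balance a b)) (cong (g a b +_) (+-comm (δ u₁ x a b) (δ u₂ y a b))))
  ; old₁ = new₁ ; old₂ = new₂ ; new₁ = old₁ ; new₂ = old₂ }
  where open Switch S

exchange : ∀ {u₁ u₂ x y : Fin n} → Switch u₁ u₂ x y f g → Switch u₂ u₁ y x f g
exchange {f = f} {g} {u₁} {u₂} {x} {y} S = record
  { u₁≢u₂ = u₁≢u₂ ∘ sym
  ; balance = λ a b → trans (cong (g a b +_) (+-comm (δ u₂ y a b) (δ u₁ x a b))) (trans (balance a b) (cong (f a b +_) (+-comm (δ u₂ x a b) (δ u₁ y a b))))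
  ; old₁ = flip old₂ ; old₂ = flip old₁ ; new₁ = flip new₂ ; new₂ = flip new₁ }
  where
  open Switch S
  flip : ∀ {h k : Mult _} → (∀ a b → δ u₁ u₂ a b + h a b ≤ k a b) → ∀ a b → δ u₂ u₁ a b + h a b ≤ k a b
  flip p a b = ≤-trans (≤-reflexive (cong (_+ _) (δ-swap u₂ u₁ a b))) (p a b)

-- This makes the quadruple u₁, u₂, x, y a code: it determines the result of the move from f, so
-- counting quadruples bounds the number of neighbours.
deterministic : ∀ {u₁ u₂ x y : Fin n} {f g g′ : Mult n} → Switch u₁ u₂ x y f g → Switch u₁ u₂ x y f g′ → ∀ a b → g a b ≡ g′ a b
deterministic S S′ a b = +-cancelʳ-≡ _ _ _ (trans (Switch.balance S a b) (sym (Switch.balance S′ a b)))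

respects : ∀ {u₁ u₂ x y : Fin n} {f f′ g g′ : Mult n} → (∀ a b → f a b ≡ f′ a b) → (∀ a b → g a b ≡ g′ a b) →
  Switch u₁ u₂ x y f g → Switch u₁ u₂ x y f′ g′
respects f≗ g≗ S = record
  { u₁≢u₂ = u₁≢u₂
  ; balance = λ a b → trans (cong (_+ _) (sym (g≗ a b))) (trans (balance a b) (cong (_+ _) (f≗ a b)))
  ; old₁ = λ a b → ≤-trans (old₁ a b) (≤-reflexive (f≗ a b)) ; old₂ = λ a b → ≤-trans (old₂ a b) (≤-reflexive (f≗ a b))
  ; new₁ = λ a b → ≤-trans (new₁ a b) (≤-reflexive (g≗ a b)) ; new₂ = λ a b → ≤-trans (new₂ a b) (≤-reflexive (g≗ a b)) }
  where open Switch S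

transport : ∀ {u₁ u₂ x y : Fin n} (π : Permutation′ n) → Switch u₁ u₂ x y f g →
  Switch (π ⟨$⟩ʳ u₁) (π ⟨$⟩ʳ u₂) (π ⟨$⟩ʳ x) (π ⟨$⟩ʳ y)
         (λ a b → f (π ⟨$⟩ˡ a) (π ⟨$⟩ˡ b)) (λ a b → g (π ⟨$⟩ˡ a) (π ⟨$⟩ˡ b))
transport {n} {f} {g} {u₁} {u₂} {x} {y} π S = record
  { u₁≢u₂ = λ eq → u₁≢u₂ (trans (sym (inverseˡ π)) (trans (cong (π ⟨$⟩ˡ_) eq) (inverseˡ π)))
  ; balance = λ a b → trans (cong (g (π ⟨$⟩ˡ a) (π ⟨$⟩ˡ b) +_) (cong₂ _+_ (move u₁ x a b) (move u₂ y a b)))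
      (trans (balance (π ⟨$⟩ˡ a) (π ⟨$⟩ˡ b)) (sym (cong (f (π ⟨$⟩ˡ a) (π ⟨$⟩ˡ b) +_) (cong₂ _+_ (move u₂ x a b) (move u₁ y a b)))))
  ; old₁ = λ a b → ≤-trans (≤-reflexive (cong₂ _+_ (move u₁ u₂ a b) (move u₁ x a b))) (old₁ _ _)
  ; old₂ = λ a b → ≤-trans (≤-reflexive (cong₂ _+_ (move u₁ u₂ a b) (move u₂ y a b))) (old₂ _ _)
  ; new₁ = λ a b → ≤-trans (≤-reflexive (cong₂ _+_ (move u₁ u₂ a b) (move u₁ y a b))) (new₁ _ _)
  ; new₂ = λ a b → ≤-trans (≤-reflexive (cong₂ _+_ (move u₁ u₂ a b) (move u₂ x a b))) (new₂ _ _) }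
  where
  open Switch S
  to : ∀ {c a} → π ⟨$⟩ʳ c ≡ a → c ≡ π ⟨$⟩ˡ a
  to refl = sym (inverseˡ π)
  from : ∀ {c a} → c ≡ π ⟨$⟩ˡ a → π ⟨$⟩ʳ c ≡ a
  from refl = inverseʳ π
  move : ∀ c d a b → δ (π ⟨$⟩ʳ c) (π ⟨$⟩ʳ d) a b ≡ δ c d (π ⟨$⟩ˡ a) (π ⟨$⟩ˡ b)
  move c d a b = δ-cong {a = π ⟨$⟩ʳ c} {π ⟨$⟩ʳ d} {a} {b} {c} {d} {π ⟨$⟩ˡ a} {π ⟨$⟩ˡ b}
    (λ { (inj₁ (p , q)) → inj₁ (to p , to q) ; (inj₂ (p , q)) → inj₂ (to p , to q) })
    (λ { (inj₁ (p , q)) → inj₁ (from p , from q) ; (inj₂ (p , q)) → inj₂ (from p , from q) })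

-- Sum `balance` over the diagonal: a single edge contributes 1 there exactly when its ends
-- coincide.
loops-balance : ∀ {u₁ u₂ x y : Fin n} → Switch u₁ u₂ x y f g →
  loops g + (indicator (u₁ ≟ x) + indicator (u₂ ≟ y)) ≡ loops f + (indicator (u₂ ≟ x) + indicator (u₁ ≟ y))
loops-balance {n} {f} {g} {u₁} {u₂} {x} {y} S = trans (sym (expand g u₁ x u₂ y))
  (trans (loops-cong {f = g ⊕ (δ u₁ x ⊕ δ u₂ y)} {f ⊕ (δ u₂ x ⊕ δ u₁ y)} (Switch.balance S)) (expand f u₂ x u₁ y))
  where
  expand : ∀ (f : Mult n) a b c d → loops (f ⊕ (δ a b ⊕ δ c d)) ≡ loops f + (indicator (a ≟ b) + indicator (c ≟ d))
  expand f a b c d = trans (loops-⊕ f (δ a b ⊕ δ c d))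
    (cong (loops f +_) (trans (loops-⊕ (δ a b) (δ c d)) (cong₂ _+_ (loops-δ a b) (loops-δ c d))))

private
  otherEnd : ∀ (e : Edge n) s → ∃[ x ] ((∀ a b → edge e a b ≡ δ (lookup e s) x a b) ×
                                       (∀ w a b → edge (e [ s ]≔ w) a b ≡ δ w x a b))
  otherEnd (p ∷ q ∷ []) zero       = q , (λ a b → refl) , λ w a b → refl
  otherEnd (p ∷ q ∷ []) (suc zero) = p , (λ a b → δ-swap p q a b) , λ w a b → δ-swap p w a b

  -- Both chosen half-edges may belong to one edge parallel to the switched one. The move then only
  -- reverses that edge.
  swap-within : ∀ (G : Multigraph n m) p s₁ s₂ {u₁ u₂} → s₁ ≢ s₂ →
    lookup (lookup G p) s₁ ≡ u₁ → lookup (lookup G p) s₂ ≡ u₂ →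
    ∀ a b → mult ((G [ p ]%= (_[ s₂ ]≔ u₁)) [ p ]%= (_[ s₁ ]≔ u₂)) a b ≡ mult G a b
  swap-within G p zero zero s≢ = contradiction refl s≢
  swap-within G p (suc zero) (suc zero) s≢ = contradiction refl s≢
  swap-within ((c ∷ d ∷ []) ∷ G) zero zero (suc zero) s≢ refl refl a b = cong (_+ mult G a b) (δ-swap d c a b)
  swap-within ((c ∷ d ∷ []) ∷ G) zero (suc zero) zero s≢ refl refl a b = cong (_+ mult G a b) (δ-swap d c a b)
  swap-within ((c ∷ d ∷ []) ∷ G) (suc p) s₁ s₂ s≢ eq₁ eq₂ a b = cong (δ c d a b +_) (swap-within G p s₁ s₂ s≢ eq₁ eq₂ a b)

update-two : ∀ (G : Multigraph n m) p q h k → p ≢ q → ∀ a b →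
  mult ((G [ q ]%= k) [ p ]%= h) a b + (edge (lookup G p) a b + edge (lookup G q) a b)
  ≡ mult G a b + (edge (h (lookup G p)) a b + edge (k (lookup G q)) a b)
update-two G p q h k p≢q a b = begin
  mult G₁ a b + (edge (lookup G p) a b + edge (lookup G q) a b)
    ≡⟨ cong (λ z → mult G₁ a b + (edge z a b + edge (lookup G q) a b)) (sym same) ⟩
  mult G₁ a b + (edge (lookup G₂ p) a b + edge (lookup G q) a b)
    ≡⟨ sym (+-assoc (mult G₁ a b) _ _) ⟩
  mult G₁ a b + edge (lookup G₂ p) a b + edge (lookup G q) a b
    ≡⟨ cong (_+ edge (lookup G q) a b) (updateAt-mult G₂ p h a b) ⟩
  mult G₂ a b + edge (h (lookup G₂ p)) a b + edge (lookup G q) a b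
    ≡⟨ cong (λ z → mult G₂ a b + edge (h z) a b + edge (lookup G q) a b) same ⟩
  mult G₂ a b + edge (h (lookup G p)) a b + edge (lookup G q) a b
    ≡⟨ rotate (mult G₂ a b) (edge (h (lookup G p)) a b) (edge (lookup G q) a b) ⟩
  mult G₂ a b + edge (lookup G q) a b + edge (h (lookup G p)) a b
    ≡⟨ cong (_+ edge (h (lookup G p)) a b) (updateAt-mult G q k a b) ⟩
  mult G a b + edge (k (lookup G q)) a b + edge (h (lookup G p)) a b
    ≡⟨ rotate (mult G a b) (edge (k (lookup G q)) a b) (edge (h (lookup G p)) a b) ⟩
  mult G a b + edge (h (lookup G p)) a b + edge (k (lookup G q)) a b
    ≡⟨ +-assoc (mult G a b) _ _ ⟩
  mult G a b + (edge (h (lookup G p)) a b + edge (k (lookup G q)) a b) ∎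
  where
  open ≡-Reasoning
  open +-*-Solver
  G₂ = G [ q ]%= k
  G₁ = G₂ [ p ]%= h
  same : lookup G₂ p ≡ lookup G p
  same = lookup∘updateAt′ p q p≢q G
  rotate : ∀ x y z → x + y + z ≡ x + z + y
  rotate = solve 3 (λ x y z → x :+ y :+ z := x :+ z :+ y) refl

-- If the chosen half-edges lie on different edges, these and e occupy three distinct positions,
-- before and after the move; `edges-≤` turns this into the bounds required by `Switch`.
whitehead-switch : ∀ (G : Multigraph n m) e h₁ h₂ → AdmissibleChoice G e h₁ h₂ →
  (∀ a b → mult (whitehead G e h₁ h₂) a b ≡ mult G a b) ⊎
  ∃[ u₁ ] ∃[ u₂ ] ∃[ x ] ∃[ y ] Switch u₁ u₂ x y (mult G) (mult (whitehead G e h₁ h₂))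
whitehead-switch {n} {m} G e (e₁ , s₁) (e₂ , s₂) (u₁≢u₂ , (e₁≢e , at₁) , (e₂≢e , at₂)) with e₁ ≟ e₂
... | yes refl = inj₁ (swap-within G e₁ s₁ s₂ (λ { refl → u₁≢u₂ (trans (sym at₁) at₂) }) at₁ at₂)
... | no e₁≢e₂ = inj₂ (u₁ , u₂ , x , y , record
  { u₁≢u₂ = u₁≢u₂
  ; balance = λ a b → trans (cong (mult G₁ a b +_) (cong₂ _+_ (sym (old-x a b)) (sym (old-y a b))))
      (trans (update-two G e₁ e₂ (_[ s₁ ]≔ u₂) (_[ s₂ ]≔ u₁) e₁≢e₂ a b)
        (cong (mult G a b +_) (cong₂ _+_ (proj₂ (proj₂ other₁) u₂ a b) (proj₂ (proj₂ other₂) u₁ a b))))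
  ; old₁ = λ a b → ≤-trans (≤-reflexive (cong₂ _+_ (middle a b) (sym (old-x a b)))) (edges-≤ G e e₁ (e₁≢e ∘ sym) a b)
  ; old₂ = λ a b → ≤-trans (≤-reflexive (cong₂ _+_ (middle a b) (sym (old-y a b)))) (edges-≤ G e e₂ (e₂≢e ∘ sym) a b)
  ; new₁ = λ a b → ≤-trans (≤-reflexive (cong₂ _+_ (middle′ a b) (sym (new-y a b)))) (edges-≤ G₁ e e₂ (e₂≢e ∘ sym) a b)
  ; new₂ = λ a b → ≤-trans (≤-reflexive (cong₂ _+_ (middle′ a b) (sym (new-x a b)))) (edges-≤ G₁ e e₁ (e₁≢e ∘ sym) a b)
  })
  where
  u₁ u₂ x y : Fin n
  u₁ = end G (e , zero)
  u₂ = end G (e , suc zero)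
  G₂ G₁ : Multigraph n m
  G₂ = reattach (e₂ , s₂) u₁ G
  G₁ = reattach (e₁ , s₁) u₂ G₂
  other₁ = otherEnd (lookup G e₁) s₁
  other₂ = otherEnd (lookup G e₂) s₂
  x = proj₁ other₁
  y = proj₁ other₂
  old-x : ∀ a b → edge (lookup G e₁) a b ≡ δ u₁ x a b
  old-x a b = trans (proj₁ (proj₂ other₁) a b) (cong (λ w → δ w x a b) at₁)
  old-y : ∀ a b → edge (lookup G e₂) a b ≡ δ u₂ y a b
  old-y a b = trans (proj₁ (proj₂ other₂) a b) (cong (λ w → δ w y a b) at₂)
  new-x : ∀ a b → edge (lookup G₁ e₁) a b ≡ δ u₂ x a b
  new-x a b = trans (cong (λ z → edge z a b) (trans (lookup∘updateAt e₁ G₂) (cong (_[ s₁ ]≔ u₂) (lookup∘updateAt′ e₁ e₂ e₁≢e₂ G))))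
    (proj₂ (proj₂ other₁) u₂ a b)
  new-y : ∀ a b → edge (lookup G₁ e₂) a b ≡ δ u₁ y a b
  new-y a b = trans (cong (λ z → edge z a b) (trans (lookup∘updateAt′ e₂ e₁ (e₁≢e₂ ∘ sym) G₂) (lookup∘updateAt e₂ G)))
    (proj₂ (proj₂ other₂) u₁ a b)
  ends : ∀ (p : Edge n) a b → δ (lookup p zero) (lookup p (suc zero)) a b ≡ edge p a b
  ends (c ∷ d ∷ []) a b = refl
  middle : ∀ a b → δ u₁ u₂ a b ≡ edge (lookup G e) a b
  middle = ends (lookup G e)
  middle′ : ∀ a b → δ u₁ u₂ a b ≡ edge (lookup G₁ e) a b
  middle′ a b = trans (middle a b) (cong (λ z → edge z a b)
    (sym (trans (lookup∘updateAt′ e e₁ (e₁≢e ∘ sym) G₂) (lookup∘updateAt′ e e₂ (e₂≢e ∘ sym) G))))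

-- Vertices of the Whitehead graphs and their adjacencies.

module Enumeration where
  open Counting
  open import Data.Fin.Permutation as Perm using (Permutation′; _⟨$⟩ʳ_; _⟨$⟩ˡ_; inverseʳ)
  open import Data.List.Base as List using (List; []; _∷_; filter)
  open import Data.List.Membership.Propositional using (lose)
  open import Data.List.Membership.Propositional.Properties using (∈-lookup; ∈-cartesianProductWith⁺)
  open import Data.List.Relation.Unary.All as All using (All)
  import Data.List.Relation.Unary.All.Properties as All
  open import Data.List.Relation.Unary.Any using (index)
  open import Data.List.Relation.Unary.Any.Properties using (lookup-index; deduplicate⁺)
  open import Data.List.Relation.Unary.Unique.DecSetoid.Properties using (deduplicate-!)
  open import Level using (0ℓ)

  open import Relation.Binary.Bundles using (DecSetoid)
  open import Relation.Binary.Core using (Rel)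
  import Relation.Binary.Definitions as B
  open import Relation.Binary.Structures using (IsEquivalence)

  ∈-allVecs : ∀ {A : Set} {xs : List A} → (∀ x → x ∈ xs) → ∀ {m} (v : Vec A m) → v ∈ allVecs xs m
  ∈-allVecs all []      = here refl
  ∈-allVecs all (x ∷ v) = ∈-cartesianProductWith⁺ _∷_ (all x) (∈-allVecs all v)

  ∈-allMultigraphs : ∀ {n m} (G : Multigraph n m) → G ∈ allMultigraphs n m
  ∈-allMultigraphs = ∈-allVecs (∈-allVecs ∈-allFin)

  module Classes (n : ℕ) {_∼_ : Rel (Multigraph n (edgeCount n)) 0ℓ} (_∼?_ : B.Decidable _∼_)
                 (∼-equivalence : IsEquivalence _∼_) where
    open IsEquivalence ∼-equivalence renaming (refl to ∼-refl; sym to ∼-sym; trans to ∼-trans)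

    Vertex : Set
    Vertex = Fin (SimpleGraph.order (whiteheadGraph n _∼?_))

    representative : Vertex → Multigraph n (edgeCount n)
    representative = List.lookup (cubicGraphs n _∼?_)

    representative-injective : ∀ {i j} → representative i ∼ representative j → i ≡ j
    representative-injective {i} {j} = lookup-injective (λ {x} {y} → ∼-sym {x} {y}) (deduplicate-! ∼-decSetoid (filter cubic? (allMultigraphs n (edgeCount n)))) i j
      where
      ∼-decSetoid : DecSetoid 0ℓ 0ℓ
      ∼-decSetoid = record { isDecEquivalence = record { isEquivalence = ∼-equivalence ; _≟_ = _∼?_ } }

    representative-cubic : ∀ i → Cubic (representative i)
    representative-cubic i = All.lookup (All.deduplicate⁺ _∼?_ (All.all-filter cubic? (allMultigraphs n (edgeCount n)))) (∈-lookup i)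

    class-of : ∀ G → Cubic G → ∃[ i ] G ∼ representative i
    class-of G cubic = index found , lookup-index found
      where
      found = deduplicate⁺ _∼?_ (λ {x} {y} y∼x G∼x → ∼-trans G∼x (∼-sym y∼x))
        (lose {P = G ∼_} (∈-filter⁺ cubic? (∈-allMultigraphs G) cubic) ∼-refl)

  module _ {n m : ℕ} where

    ≋⇒mult : ∀ {G H : Multigraph n m} → G ≋ H → ∀ u v → mult G u v ≡ mult H u v
    ≋⇒mult {G} {H} p u v = trans (sym (multiplicity≡mult G u v)) (trans (p u v) (multiplicity≡mult H u v))

    mult⇒≋ : ∀ {G H : Multigraph n m} → (∀ u v → mult G u v ≡ mult H u v) → G ≋ H
    mult⇒≋ {G} {H} p u v = trans (multiplicity≡mult G u v) (trans (p u v) (sym (multiplicity≡mult H u v)))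

    ≋-isEquivalence : IsEquivalence (_≋_ {n} {m})
    ≋-isEquivalence = record
      { refl = λ u v → refl ; sym = λ p u v → sym (p u v) ; trans = λ p q u v → trans (p u v) (q u v) }

  -- The analogue of `_≅_` on multiplicity functions. It is needed because transporting a switch
  -- along an isomorphism produces a multiplicity function without a list of edges.
  record Iso {n} (f g : Mult n) : Set where
    constructor iso
    field
      π         : Permutation′ n
      preserves : ∀ u v → f u v ≡ g (π ⟨$⟩ʳ u) (π ⟨$⟩ʳ v)

  Iso-refl : ∀ {n} {f g : Mult n} → (∀ u v → f u v ≡ g u v) → Iso f g
  Iso-refl h = iso Perm.id h

  Iso-sym : ∀ {n} {f g : Mult n} → Iso f g → Iso g f
  Iso-sym {g = g} (iso π p) = iso (Perm.flip π) λ u v → sym (trans (p _ _) (cong₂ g (inverseʳ π) (inverseʳ π)))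

  Iso-trans : ∀ {n} {f g h : Mult n} → Iso f g → Iso g h → Iso f h
  Iso-trans (iso π p) (iso ρ q) = iso (π Perm.∘ₚ ρ) λ u v → trans (p u v) (q _ _)

  module _ {n m : ℕ} where

    ≅⇒Iso : ∀ {G H : Multigraph n m} → G ≅ H → Iso (mult G) (mult H)
    ≅⇒Iso {G} {H} (π , p) = iso π λ u v → trans (sym (multiplicity≡mult G u v)) (trans (p u v) (multiplicity≡mult H _ _))

    Iso⇒≅ : ∀ {G H : Multigraph n m} → Iso (mult G) (mult H) → G ≅ H
    Iso⇒≅ {G} {H} (iso π p) = π , λ u v → trans (multiplicity≡mult G u v) (trans (p u v) (sym (multiplicity≡mult H _ _)))

    ≅-isEquivalence : IsEquivalence (_≅_ {n} {m})
    ≅-isEquivalence = record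
      { refl  = λ {G} → Iso⇒≅ {G} {G} (Iso-refl λ _ _ → refl)
      ; sym   = λ {G} {H} p → Iso⇒≅ {H} {G} (Iso-sym (≅⇒Iso {G} {H} p))
      ; trans = λ {G} {H} {K} p q → Iso⇒≅ {G} {K} (Iso-trans (≅⇒Iso {G} {H} p) (≅⇒Iso {H} {K} q)) }

  transport-iso : ∀ {n} {f f′ g : Mult n} {u₁ u₂ x y} → (φ : Iso f f′) → Switch u₁ u₂ x y f g →
    ∃[ g′ ] (Switch (Iso.π φ ⟨$⟩ʳ u₁) (Iso.π φ ⟨$⟩ʳ u₂) (Iso.π φ ⟨$⟩ʳ x) (Iso.π φ ⟨$⟩ʳ y) f′ g′ × Iso g′ g)
  transport-iso {f = f} {f′} {g} (iso π p) S = (λ a b → g (π ⟨$⟩ˡ a) (π ⟨$⟩ˡ b))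
    , respects (λ a b → trans (p _ _) (cong₂ f′ (inverseʳ π) (inverseʳ π))) (λ a b → refl) (transport π S)
    , iso (Perm.flip π) λ u v → refl

  Switchable : ∀ {n} → Mult n → Mult n → Set
  Switchable f g = ∃[ u₁ ] ∃[ u₂ ] ∃[ x ] ∃[ y ] Switch u₁ u₂ x y f g

  -- Adjacency admits a move in either direction. Read backwards, a move that ends in a copy of h
  -- becomes a move from h itself that ends in a copy of f.
  reverse-iso : ∀ {n} {f g h : Mult n} → Switchable f g → Iso g h → ∃[ g′ ] (Switchable h g′ × Iso g′ f)
  reverse-iso (u₁ , u₂ , x , y , S) φ = let g′ , S′ , ψ = transport-iso φ (reverse S) in g′ , (_ , _ , _ , _ , S′) , ψ

  module _ {n m : ℕ} where

    move⇒switch-≋ : ∀ (G H : Multigraph n m) → WhiteheadMove _≋_ G H → G ≋ H ⊎ Switchable (mult G) (mult H)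
    move⇒switch-≋ G H (e , e₁ , s₁ , e₂ , s₂ , ok , W≋H) with whitehead-switch G e (e₁ , s₁) (e₂ , s₂) ok
    ... | inj₁ same = inj₁ (mult⇒≋ {G = G} {H} λ u v →
            trans (sym (same u v)) (≋⇒mult {G = whitehead G e (e₁ , s₁) (e₂ , s₂)} {H} W≋H u v))
    ... | inj₂ (u₁ , u₂ , x , y , S) = inj₂ (u₁ , u₂ , x , y ,
            respects (λ a b → refl) (≋⇒mult {G = whitehead G e (e₁ , s₁) (e₂ , s₂)} {H} W≋H) S)

    move⇒switch-≅ : ∀ (G H : Multigraph n m) → WhiteheadMove _≅_ G H →
      G ≅ H ⊎ ∃[ g ] (Switchable (mult G) g × Iso g (mult H))
    move⇒switch-≅ G H (e , e₁ , s₁ , e₂ , s₂ , ok , W≅H) with whitehead-switch G e (e₁ , s₁) (e₂ , s₂) ok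
    ... | inj₁ same = inj₁ (Iso⇒≅ {G = G} {H}
            (Iso-trans (Iso-refl λ u v → sym (same u v)) (≅⇒Iso {G = whitehead G e (e₁ , s₁) (e₂ , s₂)} {H} W≅H)))
    ... | inj₂ S = inj₂ (mult (whitehead G e (e₁ , s₁) (e₂ , s₂)) , S , ≅⇒Iso {G = whitehead G e (e₁ , s₁) (e₂ , s₂)} {H} W≅H)

  module Labelled (n : ℕ) where
    open Classes n _≋?_ ≋-isEquivalence public
    open SimpleGraph (Γˡ n) public using (Adj)

    multOf : Vertex → Mult n
    multOf i = mult (representative i)

    adj⇒switch : ∀ {i j} → Adj i j → Switchable (multOf i) (multOf j)
    adj⇒switch {i} {j} (i≢j , inj₁ move) with move⇒switch-≋ (representative i) (representative j) move
    ... | inj₁ G≋H = contradiction (representative-injective G≋H) i≢j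
    ... | inj₂ S   = S
    adj⇒switch {i} {j} (i≢j , inj₂ move) with move⇒switch-≋ (representative j) (representative i) move
    ... | inj₁ H≋G = contradiction (sym (representative-injective H≋G)) i≢j
    ... | inj₂ (u₁ , u₂ , x , y , S) = u₁ , u₂ , y , x , reverse S

  module Unlabelled (n : ℕ) where
    open Classes n _≅?_ ≅-isEquivalence public
    open SimpleGraph (Γᵘ n) public using (Adj)

    multOf : Vertex → Mult n
    multOf i = mult (representative i)

    adj⇒switch : ∀ {i j} → Adj i j → ∃[ g ] (Switchable (multOf i) g × Iso g (multOf j))
    adj⇒switch {i} {j} (i≢j , inj₁ move) with move⇒switch-≅ (representative i) (representative j) move
    ... | inj₁ G≅H = contradiction (representative-injective G≅H) i≢j
    ... | inj₂ S   = S
    adj⇒switch {i} {j} (i≢j , inj₂ move) with move⇒switch-≅ (representative j) (representative i) move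
    ... | inj₁ H≅G = contradiction (sym (representative-injective H≅G)) i≢j
    ... | inj₂ (g , S , φ) = reverse-iso S φ

-- Moves that change the number of loops.

open Enumeration using (Switchable)

-- Each multiple edge is listed in both orientations, since its two ends play different parts in a
-- switch and in the rewiring.
doubles : ∀ {n} → Mult n → List (Fin n × Fin n)
doubles {n} f = filter (λ (u , v) → ¬? (u ≟ v) ×-dec (2 ≤? f u v)) (cartesianProduct (allFin n) (allFin n))

∈-doubles⁺ : ∀ {n} {f : Mult n} {u v} → u ≢ v → 2 ≤ f u v → (u , v) ∈ doubles f
∈-doubles⁺ u≢v 2≤ = ∈-filter⁺ _ (∈-cartesianProduct⁺ (∈-allFin _) (∈-allFin _)) (u≢v , 2≤)

∈-doubles⁻ : ∀ {n} {f : Mult n} {u v} → (u , v) ∈ doubles f → u ≢ v × 2 ≤ f u v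
∈-doubles⁻ {n} {f} p = proj₂ (∈-filter⁻ (λ (u , v) → ¬? (u ≟ v) ×-dec (2 ≤? f u v)) {xs = cartesianProduct (allFin n) (allFin n)} p)

doubles-unique : ∀ {n} (f : Mult n) → Unique (doubles f)
doubles-unique {n} f = Unique.filter⁺ _ (Unique.cartesianProduct⁺ (Unique.allFin⁺ n) (Unique.allFin⁺ n))

-- A switch changes the number of loops only if the switched edge is parallel to
-- one of the two others or one of these is a loop.
module Exits {n} {f : Mult n} (cubic : ∀ v → deg f v ≡ 3) (f-sym : ∀ u v → f u v ≡ f v u) where

  -- There are four coincidences that can change the number of loops; interchanging the ends of the
  -- switched edge leaves two. Either x = u₂, and the switched edge is double, or x = u₁, and there
  -- is a loop at u₁. In both cases x is redundant.
  Code : Set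
  Code = ((Fin n × Fin n) × Fin n) ⊎ (Fin n × Fin n × Fin n)

  codes : List Code
  codes = map inj₁ (doubles f ⊗ λ (u₁ , u₂) → nb f u₂)
       ++ map inj₂ (loopVertices f ⊗ λ u₁ → nb f u₁ ⊗ λ u₂ → nb f u₂)

  Decodes : Mult n → Code → Set
  Decodes g (inj₁ ((u₁ , u₂) , y)) = Switch u₁ u₂ u₂ y f g
  Decodes g (inj₂ (u₁ , u₂ , y))   = Switch u₁ u₂ u₁ y f g

  -- A double pair leaves three choices of y; a loop vertex leaves three choices of u₂ and then
  -- three of y.
  length-codes : length codes ≤ 3 * length (doubles f) + 9 * loops f
  length-codes = begin
    length codes
      ≡⟨ length-++ (map inj₁ first) ⟩
    length (map {B = Code} inj₁ first) + length (map {B = Code} inj₂ second)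
      ≡⟨ cong₂ _+_ (length-map inj₁ first) (length-map inj₂ second) ⟩
    length first + length second
      ≤⟨ +-mono-≤ (length-⊗-≤ (doubles f) (λ (u₁ , u₂) → nb f u₂) 3 λ {(u₁ , u₂)} _ → length-nb {f = f} cubic u₂)
                  (length-⊗-≤ (loopVertices f) (λ u₁ → nb f u₁ ⊗ λ u₂ → nb f u₂) 9 λ {u₁} _ → two u₁) ⟩
    3 * length (doubles f) + 9 * length (loopVertices f)
      ≤⟨ +-monoʳ-≤ (3 * length (doubles f)) (*-monoʳ-≤ 9 (length-support λ v → f v v)) ⟩
    3 * length (doubles f) + 9 * loops f ∎
    where
    open ≤-Reasoning
    first = doubles f ⊗ λ (u₁ , u₂) → nb f u₂
    second = loopVertices f ⊗ λ u₁ → nb f u₁ ⊗ λ u₂ → nb f u₂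
    two : ∀ u₁ → length (nb f u₁ ⊗ λ u₂ → nb f u₂) ≤ 9
    two u₁ = ≤-trans (length-⊗-≤ (nb f u₁) (λ u₂ → nb f u₂) 3 λ {u₂} _ → length-nb {f = f} cubic u₂)
      (*-monoʳ-≤ 3 (length-nb {f = f} cubic u₁))

  private
    adjacent : ∀ {h : Mult n} {a b c d} → (∀ u v → δ a b u v + h u v ≤ f u v) → a ≡ c → b ≡ d → 1 ≤ f c d
    adjacent {a = a} {b} p refl refl = ≤-trans (≤-reflexive (sym (δ-self a b))) (≤-trans (m≤m+n _ _) (p a b))

    adjacent′ : ∀ {h : Mult n} {a b} → (∀ u v → h u v + δ a b u v ≤ f u v) → 1 ≤ f a b
    adjacent′ {a = a} {b} p = ≤-trans (≤-reflexive (sym (δ-self a b))) (≤-trans (m≤n+m _ _) (p a b))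

    via-double : ∀ {g u₁ u₂ y} → Switch u₁ u₂ u₂ y f g → ∃[ c ] (c ∈ codes × Decodes g c)
    via-double {u₁ = u₁} {u₂} {y} S = inj₁ ((u₁ , u₂) , y) , ∈-++⁺ˡ (∈-map⁺ inj₁ (∈-⊗⁺ (∈-doubles⁺ u₁≢u₂ twice)
        (∈-support⁺ (adjacent′ {h = δ u₁ u₂} old₂)))) , S
      where
      open Switch S
      -- With x = u₂ the two summands on the left of `old₁` are the same edge, counted twice.
      twice : 2 ≤ f u₁ u₂
      twice = ≤-trans (≤-reflexive (sym (cong₂ _+_ (δ-self u₁ u₂) (δ-self u₁ u₂)))) (old₁ u₁ u₂)

    via-loop : ∀ {g u₁ u₂ y} → Switch u₁ u₂ u₁ y f g → ∃[ c ] (c ∈ codes × Decodes g c)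
    via-loop {u₁ = u₁} {u₂} {y} S = inj₂ (u₁ , u₂ , y) , ∈-++⁺ʳ (map inj₁ (doubles f ⊗ λ (u₁ , u₂) → nb f u₂))
        (∈-map⁺ inj₂ (∈-⊗⁺ (∈-support⁺ (adjacent′ {h = δ u₁ u₂} old₁))
          (∈-⊗⁺ (∈-support⁺ (adjacent {h = δ u₁ u₁} old₁ refl refl)) (∈-support⁺ (adjacent′ {h = δ u₁ u₂} old₂))))) , S
      where open Switch S

  encode : ∀ {g} → Switchable f g → loops f ≢ loops g → ∃[ c ] (c ∈ codes × Decodes g c)
  encode {g} (u₁ , u₂ , x , y , S) changed with u₁ ≟ x | u₂ ≟ y | u₂ ≟ x | u₁ ≟ y
  ... | yes refl | _ | _ | _ = via-loop S
  ... | _ | yes refl | _ | _ = via-loop (exchange S)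
  ... | _ | _ | yes refl | _ = via-double S
  ... | _ | _ | _ | yes refl = via-double (exchange S)
  ... | no p | no q | no r | no s = contradiction (sym (+-cancelʳ-≡ 0 _ _ (trans
      (cong (loops g +_) (sym (cong₂ _+_ (indicator-no (u₁ ≟ x) p) (indicator-no (u₂ ≟ y) q))))
      (trans (loops-balance S) (cong (loops f +_) (cong₂ _+_ (indicator-no (u₂ ≟ x) r) (indicator-no (u₁ ≟ y) s))))))) changed

  decode : ∀ {g g′} c → Decodes g c → Decodes g′ c → ∀ a b → g a b ≡ g′ a b
  decode (inj₁ _) = deterministic
  decode (inj₂ _) = deterministic

-- Double edges are few on average.

record Rewired {n} (u v g h : Fin n) (f f′ : Mult n) : Set where
  field
    removed : ∀ a b → δ u v a b + δ g h a b ≤ f a b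
    balance : ∀ a b → f′ a b + (δ u v a b + δ g h a b) ≡ f a b + (δ u g a b + δ v h a b)

  created : ∀ a b → δ u g a b + δ v h a b ≤ f′ a b
  created a b = +-cancelʳ-≤ (δ u v a b + δ g h a b) _ _ (begin
    δ u g a b + δ v h a b + (δ u v a b + δ g h a b)  ≤⟨ +-monoʳ-≤ (δ u g a b + δ v h a b) (removed a b) ⟩
    δ u g a b + δ v h a b + f a b                    ≡⟨ +-comm (δ u g a b + δ v h a b) (f a b) ⟩
    f a b + (δ u g a b + δ v h a b)                  ≡⟨ sym (balance a b) ⟩
    f′ a b + (δ u v a b + δ g h a b)                 ∎)
    where open ≤-Reasoning

  created₁ : 1 ≤ f′ u g
  created₁ = ≤-trans (≤-reflexive (sym (δ-self u g))) (≤-trans (m≤m+n _ _) (created u g))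

  created₂ : 1 ≤ f′ v h
  created₂ = ≤-trans (≤-reflexive (sym (δ-self v h))) (≤-trans (m≤n+m _ _) (created v h))

  -- uv survives because it was a multiple edge.
  survives : 2 ≤ f u v → g ≢ u → g ≢ v → 1 ≤ f′ u v
  survives 2≤uv g≢u g≢v = +-cancelʳ-≤ 1 1 (f′ u v) (begin
    2                                                ≤⟨ 2≤uv ⟩
    f u v                                            ≤⟨ m≤m+n (f u v) _ ⟩
    f u v + (δ u g u v + δ v h u v)                  ≡⟨ sym (balance u v) ⟩
    f′ u v + (δ u v u v + δ g h u v)                 ≡⟨ cong (f′ u v +_) (cong₂ _+_ (δ-self u v)
                                                          (δ-0 g h u v λ { (inj₁ (p , _)) → g≢u p ; (inj₂ (p , _)) → g≢v p })) ⟩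
    f′ u v + 1                                       ∎)
    where open ≤-Reasoning

module _ {n N : ℕ} (M : Fin N → Mult n) (M-cubic : ∀ i v → deg (M i) v ≡ 3) (M-sym : ∀ i u v → M i u v ≡ M i v u)
  (M-injective : ∀ {i j} → (∀ a b → M i a b ≡ M j a b) → i ≡ j)
  (rewire : ∀ i u v g h → u ≢ v → 2 ≤ M i u v → 1 ≤ M i g h → g ≢ h → g ≢ u → g ≢ v → h ≢ v →
            ∃[ j ] Rewired u v g h (M i) (M j))
  (t : ℕ) (large : 2 * (4 + t) ≤ n) (class : List (Fin N)) (class-unique : Unique class)
  (class-sound : ∀ {i} → i ∈ class → loops (M i) ≡ t) (class-complete : ∀ {i} → loops (M i) ≡ t → i ∈ class) where

  private
    -- Values of g to avoid. For all others g is neither v nor u, because u is a neighbour of v; no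
    -- neighbour h of g is v; and gh is not a loop. Hence no loop is destroyed or created. With t
    -- loops the list has at most 1 + 3 + t entries.
    bad : Fin N → Fin n → List (Fin n)
    bad i v = v ∷ nb (M i) v ++ loopVertices (M i)

    Source Target : Set
    Source = (Fin N × Fin n × Fin n) × Fin n
    Target = Fin N × Fin n × Fin n × Fin n × Fin n

    sources : List Source
    sources = (class ⊗ λ i → doubles (M i)) ⊗ λ (i , u , v) → outside (bad i v)

    targets : List Target
    targets = class ⊗ λ i → allFin n ⊗ λ u → nb (M i) u ⊗ λ v → nb (M i) u ⊗ λ g → nb (M i) v

    Related : Source → Target → Set
    Related ((i , u , v) , g) (j , u′ , v′ , g′ , h) = (u ≡ u′ × v ≡ v′ × g ≡ g′) × Rewired u′ v′ g′ h (M i) (M j)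

    sources-unique : Unique sources
    sources-unique = ⊗-unique (⊗-unique class-unique λ i → doubles-unique (M i))
      λ (i , u , v) → Unique.filter⁺ _ (Unique.allFin⁺ n)

    some-neighbour : ∀ i g → g ∉ loopVertices (M i) → ∃[ h ] 1 ≤ M i g h
    some-neighbour i g g∉ with nb (M i) g in eq
    ... | h ∷ _ = h , ∈-support⁻ {h = M i g} (subst (h ∈_) (sym eq) (here refl))
    ... | [] = contradiction (trans (sym (M-cubic i g)) (cong₂ _+_ (sum-zeros none) (none g))) λ ()
      where
      none : ∀ h → M i g h ≡ 0
      none h with M i g h in eq′
      ... | zero  = refl
      ... | suc _ = contradiction (subst (h ∈_) eq (∈-support⁺ {h = M i g} (subst (1 ≤_) (sym eq′) (s≤s z≤n)))) λ ()

    transfer : ∀ {s} → s ∈ sources → ∃[ r ] (r ∈ targets × Related s r)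
    transfer {(i , u , v) , g} s∈ =
        (j , u , v , g , h) ,
        ∈-⊗⁺ (class-complete (trans loops-same (class-sound i∈)))
          (∈-⊗⁺ (∈-allFin u) (∈-⊗⁺ (∈-support⁺ uv) (∈-⊗⁺ (∈-support⁺ ug) (∈-support⁺ vh)))) ,
        (refl , refl , refl) , rewired
      where
      s⁻ = ∈-⊗⁻ (class ⊗ λ i → doubles (M i)) s∈
      p⁻ = ∈-⊗⁻ class (proj₁ s⁻)
      i∈ = proj₁ p⁻
      u≢v = proj₁ (∈-doubles⁻ {f = M i} (proj₂ p⁻))
      2≤uv = proj₂ (∈-doubles⁻ {f = M i} (proj₂ p⁻))
      g∉ : g ∉ bad i v
      g∉ = proj₂ (∈-filter⁻ _ {xs = allFin n} (proj₂ s⁻))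
      g≢v : g ≢ v
      g≢v eq = g∉ (here eq)
      gv≡0 : ¬ 1 ≤ M i v g
      gv≡0 p = g∉ (there (∈-++⁺ˡ (∈-support⁺ p)))
      g≢u : g ≢ u
      g≢u refl = gv≡0 (≤-trans (s≤s z≤n) (≤-trans 2≤uv (≤-reflexive (M-sym i u v))))
      no-loop : g ∉ loopVertices (M i)
      no-loop p = g∉ (there (∈-++⁺ʳ (nb (M i) v) p))
      h = proj₁ (some-neighbour i g no-loop)
      gh = proj₂ (some-neighbour i g no-loop)
      g≢h : g ≢ h
      g≢h eq = no-loop (∈-support⁺ (subst (λ h → 1 ≤ M i g h) (sym eq) gh))
      h≢v : h ≢ v
      h≢v eq = gv≡0 (≤-trans (subst (λ h → 1 ≤ M i g h) eq gh) (≤-reflexive (M-sym i g v)))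
      j = proj₁ (rewire i u v g h u≢v 2≤uv gh g≢h g≢u g≢v h≢v)
      rewired = proj₂ (rewire i u v g h u≢v 2≤uv gh g≢h g≢u g≢v h≢v)
      loops-same : loops (M j) ≡ loops (M i)
      loops-same = +-cancelʳ-≡ 0 _ _ (trans (sym (expand (M j) u v g h u≢v g≢h))
        (trans (loops-cong {f = M j ⊕ (δ u v ⊕ δ g h)} {M i ⊕ (δ u g ⊕ δ v h)} (Rewired.balance rewired))
          (expand (M i) u g v h (g≢u ∘ sym) (h≢v ∘ sym))))
        where
        expand : ∀ (f : Mult n) a b c d → a ≢ b → c ≢ d → loops (f ⊕ (δ a b ⊕ δ c d)) ≡ loops f + 0
        expand f a b c d a≢b c≢d = trans (loops-⊕ f (δ a b ⊕ δ c d)) (cong (loops f +_)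
          (trans (loops-⊕ (δ a b) (δ c d)) (cong₂ _+_
            (trans (loops-δ a b) (indicator-no (a ≟ b) a≢b)) (trans (loops-δ c d) (indicator-no (c ≟ d) c≢d)))))
      uv : 1 ≤ M j u v
      uv = Rewired.survives rewired 2≤uv g≢u g≢v
      ug : 1 ≤ M j u g
      ug = Rewired.created₁ rewired
      vh : 1 ≤ M j v h
      vh = Rewired.created₂ rewired

    -- The target names u, v, g, h, so both rewirings have the same correction terms in `balance`,
    -- and cancelling them identifies the original graphs.
    recover : ∀ {s s′ r} → Related s r → Related s′ r → s ≡ s′
    recover {(i , u , v) , g} {(i′ , u′ , v′) , g′} ((refl , refl , refl) , p) ((refl , refl , refl) , q) =
      cong (λ i → (i , u , v) , g) (M-injective λ a b →
        +-cancelʳ-≡ _ _ _ (trans (sym (Rewired.balance p a b)) (Rewired.balance q a b)))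

    ΣD : ℕ
    ΣD = sum (map (length ∘ λ i → doubles (M i)) class)

    length-sources : (n ∸ (4 + t)) * ΣD ≤ length sources
    length-sources = begin
      (n ∸ (4 + t)) * ΣD
        ≡⟨ cong ((n ∸ (4 + t)) *_) (sym (length-⊗ class λ i → doubles (M i))) ⟩
      (n ∸ (4 + t)) * length (class ⊗ λ i → doubles (M i))
        ≤⟨ *-≤-sum-map (λ (i , u , v) → length (outside (bad i v))) (n ∸ (4 + t)) (class ⊗ λ i → doubles (M i))
             (λ {(i , u , v)} p → m≤n+o⇒m∸n≤o n (4 + t) (few i v (proj₁ (∈-⊗⁻ class p)))) ⟩
      sum (map (λ (i , u , v) → length (outside (bad i v))) (class ⊗ λ i → doubles (M i)))
        ≡⟨ sym (length-⊗ (class ⊗ λ i → doubles (M i)) λ (i , u , v) → outside (bad i v)) ⟩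
      length sources ∎
      where
      open ≤-Reasoning
      few : ∀ i v → i ∈ class → n ≤ 4 + t + length (outside (bad i v))
      few i v i∈ = ≤-trans (length-outside (bad i v)) (≤-trans (≤-reflexive (+-comm (length (outside (bad i v))) _))
        (+-monoˡ-≤ _ (s≤s (≤-trans (≤-reflexive (length-++ (nb (M i) v)))
          (+-mono-≤ (length-nb {f = M i} (M-cubic i) v) (≤-trans (length-support λ v → M i v v) (≤-reflexive (class-sound i∈))))))))

    length-targets : length targets ≤ 27 * n * length class
    length-targets = length-⊗-≤ class _ (27 * n) λ {i} _ →
      ≤-trans (length-⊗-≤ (allFin n) _ 27 λ {u} _ →
        ≤-trans (length-⊗-≤ (nb (M i) u) _ 9 λ {v} _ →
          ≤-trans (length-⊗-≤ (nb (M i) u) _ 3 λ {g} _ → length-nb {f = M i} (M-cubic i) v)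
            (*-monoʳ-≤ 3 (length-nb {f = M i} (M-cubic i) u)))
          (*-monoʳ-≤ 9 (length-nb {f = M i} (M-cubic i) u)))
        (*-monoʳ-≤ 27 (≤-reflexive (length-tabulate {n = n} id)))

  -- `large` leaves at least half of the vertices as values of g, so ΣD · n/2 is at most 27 n times
  -- the size of the class, and 54 = 2 · 27.
  doubles-bound : ΣD ≤ 54 * length class
  doubles-bound = *-cancelʳ-≤ ΣD (54 * length class) n {{>-nonZero (≤-trans (s≤s z≤n) large)}} (begin
    ΣD * n
      ≤⟨ *-monoʳ-≤ ΣD n≤ ⟩
    ΣD * (2 * (n ∸ (4 + t)))
      ≡⟨ solve 2 (λ d x → d :* (con 2 :* x) := con 2 :* (x :* d)) refl ΣD (n ∸ (4 + t)) ⟩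
    2 * ((n ∸ (4 + t)) * ΣD)
      ≤⟨ *-monoʳ-≤ 2 (≤-trans length-sources (≤-trans (length-≤-by-coding Related sources-unique transfer (λ {x} {x′} {y} → recover {x} {x′} {y})) length-targets)) ⟩
    2 * (27 * n * length class)
      ≡⟨ solve 2 (λ n c → con 2 :* (con 27 :* n :* c) := con 54 :* c :* n) refl n (length class) ⟩
    54 * length class * n ∎)
    where
    open ≤-Reasoning
    open +-*-Solver
    n≤ : n ≤ 2 * (n ∸ (4 + t))
    n≤ = begin
      n                             ≡⟨ sym (m+n∸m≡n n n) ⟩
      n + n ∸ n                     ≤⟨ ∸-monoʳ-≤ (n + n) large ⟩
      n + n ∸ 2 * (4 + t)           ≡⟨ cong (_∸ 2 * (4 + t)) (cong (n +_) (sym (+-identityʳ n))) ⟩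
      2 * n ∸ 2 * (4 + t)           ≡⟨ sym (*-distribˡ-∸ 2 n (4 + t)) ⟩
      2 * (n ∸ (4 + t))             ∎

  -- Each double pair accounts for three codes and each loop for nine, hence 162 = 3 · 54 and the
  -- term 9 t.
  exits-bound : ∀ (Adj : Fin N → Fin N → Set) → (∀ {i j} → Adj i j → Switchable (M i) (M j)) →
    ∀ (exits : Fin N → List (Fin N)) → (∀ i → Unique (exits i)) →
    (∀ {i j} → j ∈ exits i → loops (M i) ≢ loops (M j) × Adj i j) →
    sum (map (length ∘ exits) class) ≤ (162 + 9 * t) * length class
  exits-bound Adj switch exits exits-unique exits-sound = begin
    sum (map (length ∘ exits) class)
      ≤⟨ sum-map-≤ (length ∘ exits) (λ i → 3 * length (doubles (M i)) + 9 * t) class each ⟩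
    sum (map (λ i → 3 * length (doubles (M i)) + 9 * t) class)
      ≡⟨ sum-map-affine (length ∘ λ i → doubles (M i)) 3 (9 * t) class ⟩
    3 * ΣD + 9 * t * length class
      ≤⟨ +-monoˡ-≤ _ (*-monoʳ-≤ 3 doubles-bound) ⟩
    3 * (54 * length class) + 9 * t * length class
      ≡⟨ solve 2 (λ t c → con 3 :* (con 54 :* c) :+ con 9 :* t :* c := (con 162 :+ con 9 :* t) :* c) refl t (length class) ⟩
    (162 + 9 * t) * length class ∎
    where
    open ≤-Reasoning
    open +-*-Solver
    each : ∀ {i} → i ∈ class → length (exits i) ≤ 3 * length (doubles (M i)) + 9 * t
    each {i} i∈ = ≤-trans (length-≤-by-coding (λ j c → Decodes (M j) c) (exits-unique i)
        (λ j∈ → let changed , adj = exits-sound j∈ in encode (switch adj) changed)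
        (λ {j} {j′} {c} p q → M-injective (decode c p q)))
      (≤-trans length-codes (≤-reflexive (cong (λ l → 3 * length (doubles (M i)) + 9 * l) (class-sound i∈))))
      where open Exits {f = M i} (M-cubic i) (M-sym i)

-- Rewiring within connected cubic graphs.

Linked : Mult n → Fin n → Fin n → Set
Linked f u v = 1 ≤ f u v

connected⁺ : (G : Multigraph n m) → (∀ u v → Star (Linked (mult G)) u v) → Connected G
connected⁺ G c u v = Star.map (≥1⇒neighbours G) (c u v)

connected⁻ : (G : Multigraph n m) → Connected G → ∀ u v → Star (Linked (mult G)) u v
connected⁻ G c u v = Star.map (neighbours⇒≥1 G) (c u v)

reconnect : ∀ {f f′ : Mult n} → (∀ {u v} → Linked f u v → Star (Linked f′) u v) →
  ∀ {u v} → Star (Linked f) u v → Star (Linked f′) u v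
reconnect h = kleisliStar (λ v → v) h

ends⇒δ : ∀ (c d u v : Fin n) → Ends c d u v → ∀ a b → δ c d a b ≡ δ u v a b
ends⇒δ c d u v (inj₁ (refl , refl)) a b = refl
ends⇒δ c d u v (inj₂ (refl , refl)) a b = δ-swap c d a b

edge⇒δ : ∀ (e : Edge n) u v → 1 ≤ edge e u v → ∀ a b → edge e a b ≡ δ u v a b
edge⇒δ (c ∷ d ∷ []) u v p = ends⇒δ c d u v (δ-≥1 c d u v p)

-- Connectedness survives because a copy of uv remains, so that gh can be replaced by the walk g u v
-- h. Degrees survive because the removed and the inserted pair of edges have the same four ends.
rewire : ∀ (G : Multigraph n m) → Cubic G → ∀ u v g h → 2 ≤ mult G u v → 1 ≤ mult G g h →
  g ≢ u → g ≢ v → Σ[ G′ ∈ Multigraph n m ] (Cubic G′ × Rewired u v g h (mult G) (mult G′))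
rewire {n} {m} G (cubic , connected) u v g h 2≤uv gh g≢u g≢v = G′ , (degrees , connected⁺ G′ connected′) , rewired
  where
  uv : 1 ≤ mult G u v
  uv = ≤-trans (s≤s z≤n) 2≤uv
  p q : Fin m
  p = proj₁ (position G u v uv)
  q = proj₁ (position G g h gh)
  at-p : ∀ a b → edge (lookup G p) a b ≡ δ u v a b
  at-p = edge⇒δ (lookup G p) u v (proj₂ (position G u v uv))
  at-q : ∀ a b → edge (lookup G q) a b ≡ δ g h a b
  at-q = edge⇒δ (lookup G q) g h (proj₂ (position G g h gh))
  apart : ¬ Ends g h u v
  apart (inj₁ (r , _)) = g≢u r
  apart (inj₂ (r , _)) = g≢v r
  -- A common position would make gh and uv the same edge, although g is neither u nor v.
  p≢q : p ≢ q
  p≢q eq = apart (δ-≥1 g h u v (≤-reflexive (trans (sym (δ-self u v)) (trans (sym (at-p u v))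
    (trans (cong (λ r → edge (lookup G r) u v) eq) (at-q u v))))))
  G′ : Multigraph n m
  G′ = (G [ q ]%= const (v ∷ h ∷ [])) [ p ]%= const (u ∷ g ∷ [])
  rewired : Rewired u v g h (mult G) (mult G′)
  rewired = record
    { removed = λ a b → ≤-trans (≤-reflexive (cong₂ _+_ (sym (at-p a b)) (sym (at-q a b)))) (edges-≤ G p q p≢q a b)
    ; balance = λ a b → trans (cong (mult G′ a b +_) (cong₂ _+_ (sym (at-p a b)) (sym (at-q a b))))
        (update-two G p q (const (u ∷ g ∷ [])) (const (v ∷ h ∷ [])) p≢q a b) }
  open Rewired rewired
  degrees : ∀ w → degree G′ w ≡ 3
  degrees w = trans (trans (degree-deg G′ w) (+-cancelʳ-≡ (i u + i v + (i g + i h)) _ _ (begin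
      deg (mult G′) w + (i u + i v + (i g + i h))             ≡⟨ sym (expand (mult G′) u v g h) ⟩
      deg (mult G′ ⊕ (δ u v ⊕ δ g h)) w                       ≡⟨ deg-cong {f = mult G′ ⊕ (δ u v ⊕ δ g h)} {mult G ⊕ (δ u g ⊕ δ v h)} balance w ⟩
      deg (mult G ⊕ (δ u g ⊕ δ v h)) w                        ≡⟨ expand (mult G) u g v h ⟩
      deg (mult G) w + (i u + i g + (i v + i h))              ≡⟨ cong (deg (mult G) w +_) (solve 4 (λ u v g h →
                                                                   u :+ g :+ (v :+ h) := u :+ v :+ (g :+ h)) refl (i u) (i v) (i g) (i h)) ⟩
      deg (mult G) w + (i u + i v + (i g + i h)) ∎)))
    (trans (sym (degree-deg G w)) (cubic w))
    where
    open ≡-Reasoning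
    open +-*-Solver
    i : Fin n → ℕ
    i a = indicator (a ≟ w)
    expand : ∀ (f : Mult n) a b c d → deg (f ⊕ (δ a b ⊕ δ c d)) w ≡ deg f w + (i a + i b + (i c + i d))
    expand f a b c d = trans (deg-⊕ f (δ a b ⊕ δ c d) w) (cong (deg f w +_)
      (trans (deg-⊕ (δ a b) (δ c d) w) (cong₂ _+_ (deg-δ a b w) (deg-δ c d w))))
  flip : ∀ {a b} → Linked (mult G′) a b → Linked (mult G′) b a
  flip {a} {b} l = ≤-trans l (≤-reflexive (mult-sym G′ a b))
  u–v : Linked (mult G′) u v
  u–v = survives 2≤uv g≢u g≢v
  g–h : Star (Linked (mult G′)) g h
  g–h = flip created₁ ◅ u–v ◅ created₂ ◅ done
  h–g : Star (Linked (mult G′)) h g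
  h–g = flip created₂ ◅ flip u–v ◅ created₁ ◅ done
  detour : ∀ {a b} → Linked (mult G) a b → Star (Linked (mult G′)) a b
  detour {a} {b} l with joins? {m = 0} a b (u ∷ v ∷ []) | joins? {m = 0} a b (g ∷ h ∷ [])
  ... | yes (inj₁ (refl , refl)) | _ = u–v ◅ done
  ... | yes (inj₂ (refl , refl)) | _ = flip u–v ◅ done
  ... | no _ | yes (inj₁ (refl , refl)) = g–h
  ... | no _ | yes (inj₂ (refl , refl)) = h–g
  ... | no ¬uv | no ¬gh = (begin
      1                                        ≤⟨ l ⟩
      mult G a b                               ≤⟨ m≤m+n _ _ ⟩
      mult G a b + (δ u g a b + δ v h a b)     ≡⟨ sym (balance a b) ⟩
      mult G′ a b + (δ u v a b + δ g h a b)    ≡⟨ cong (mult G′ a b +_) (cong₂ _+_ (δ-0 u v a b ¬uv) (δ-0 g h a b ¬gh)) ⟩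
      mult G′ a b + 0                          ≡⟨ +-identityʳ _ ⟩
      mult G′ a b                              ∎) ◅ done
    where open ≤-Reasoning
  connected′ : ∀ a b → Star (Linked (mult G′)) a b
  connected′ a b = reconnect detour (connected⁻ G connected a b)

-- Cubic graphs with a prescribed number of loops.

private
  pattern 0F = zero
  pattern 1F = suc zero

  shift : Vec (Edge n) m → Vec (Edge (2 + n)) m
  shift = Vec.map (Vec.map (λ v → suc (suc v)))

  indicator-shift : ∀ (a b : Fin n) → indicator (suc (suc a) ≟ suc (suc b)) ≡ indicator (a ≟ b)
  indicator-shift a b = indicator-cong (suc (suc a) ≟ suc (suc b)) (a ≟ b) (λ { refl → refl }) (λ { refl → refl })

  δ-shift : ∀ (a b u v : Fin n) → δ (suc (suc a)) (suc (suc b)) (suc (suc u)) (suc (suc v)) ≡ δ a b u v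
  δ-shift a b u v = δ-cong {a = suc (suc a)} {suc (suc b)} {suc (suc u)} {suc (suc v)} {a} {b} {u} {v}
    (λ { (inj₁ (refl , refl)) → inj₁ (refl , refl) ; (inj₂ (refl , refl)) → inj₂ (refl , refl) })
    (λ { (inj₁ (refl , refl)) → inj₁ (refl , refl) ; (inj₂ (refl , refl)) → inj₂ (refl , refl) })

  mult-shift : ∀ (G : Vec (Edge n) m) u v → mult (shift G) (suc (suc u)) (suc (suc v)) ≡ mult G u v
  mult-shift []                  u v = refl
  mult-shift ((a ∷ b ∷ []) ∷ G) u v = cong₂ _+_ (δ-shift a b u v) (mult-shift G u v)

  degree-∷ : ∀ a b (G : Vec (Edge n) m) v → degree ((a ∷ b ∷ []) ∷ G) v ≡ indicator (a ≟ v) + (indicator (b ≟ v) + degree G v)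
  degree-∷ a b G v = trans (count-∷ (_≟ v) a (b ∷ concat G)) (cong (indicator (a ≟ v) +_) (count-∷ (_≟ v) b (concat G)))

  degree-shift : ∀ (G : Vec (Edge n) m) v → degree (shift G) (suc (suc v)) ≡ degree G v
  degree-shift []                  v = refl
  degree-shift ((a ∷ b ∷ []) ∷ G) v = trans (degree-∷ (suc (suc a)) (suc (suc b)) (shift G) (suc (suc v)))
    (trans (cong₂ _+_ (indicator-shift a v) (cong₂ _+_ (indicator-shift b v) (degree-shift G v))) (sym (degree-∷ a b G v)))

  degree-shift-0 : ∀ (G : Vec (Edge n) m) → degree (shift G) 0F ≡ 0
  degree-shift-0 []                  = refl
  degree-shift-0 ((a ∷ b ∷ []) ∷ G) = degree-shift-0 G

  degree-shift-1 : ∀ (G : Vec (Edge n) m) → degree (shift G) 1F ≡ 0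
  degree-shift-1 []                  = refl
  degree-shift-1 ((a ∷ b ∷ []) ∷ G) = degree-shift-1 G

  loops-∷ : ∀ a b (G : Vec (Edge n) m) → loops (mult ((a ∷ b ∷ []) ∷ G)) ≡ indicator (a ≟ b) + loops (mult G)
  loops-∷ a b G = trans (loops-⊕ (δ a b) (mult G)) (cong (_+ loops (mult G)) (loops-δ a b))

  loops-shift : ∀ (G : Vec (Edge n) m) → loops (mult (shift G)) ≡ loops (mult G)
  loops-shift {n} [] = trans (sum-zeros {2 + n} λ _ → refl) (sym (sum-zeros {n} λ _ → refl))
  loops-shift ((a ∷ b ∷ []) ∷ G) = trans (loops-∷ (suc (suc a)) (suc (suc b)) (shift G))
    (trans (cong₂ _+_ (indicator-shift a b) (loops-shift G)) (sym (loops-∷ a b G)))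

  -- Connectedness for both extensions below. The new vertices are 0 and 1, the old ones are shifted
  -- by two. Old walks lift: the edge xy becomes a walk through 0, or through 0 and 1, and the other
  -- edges are kept.
  module _ (x y : Fin n) (G : Vec (Edge n) m) (f′ : Mult (2 + n)) (f′-sym : ∀ u v → f′ u v ≡ f′ v u)
    (keeps : ∀ u v → mult G u v ≤ f′ (suc (suc u)) (suc (suc v)))
    (x–0 : Linked f′ (suc (suc x)) 0F) (0–1 : Linked f′ 0F 1F) (y–01 : Linked f′ (suc (suc y)) 0F ⊎ Linked f′ (suc (suc y)) 1F)
    (connected : ∀ u v → Star (Linked (mult ((x ∷ y ∷ []) ∷ G))) u v) where

    flip : ∀ {a b} → Linked f′ a b → Linked f′ b a
    flip {a} {b} l = ≤-trans l (≤-reflexive (f′-sym a b))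

    y⇒0 : Star (Linked f′) (suc (suc y)) 0F
    y⇒0 = [ (λ l → l ◅ done) , (λ l → l ◅ flip 0–1 ◅ done) ]′ y–01

    0⇒y : Star (Linked f′) 0F (suc (suc y))
    0⇒y = [ (λ l → flip l ◅ done) , (λ l → 0–1 ◅ flip l ◅ done) ]′ y–01

    lift-step : ∀ {u v} → Linked (mult ((x ∷ y ∷ []) ∷ G)) u v → Star (Linked f′) (suc (suc u)) (suc (suc v))
    lift-step {u} {v} l with joins? {m = 0} u v (x ∷ y ∷ [])
    ... | yes (inj₁ (refl , refl)) = x–0 ◅ 0⇒y
    ... | yes (inj₂ (refl , refl)) = y⇒0 ◅◅ (flip x–0 ◅ done)
    ... | no ¬xy = ≤-trans l (keeps u v) ◅ done

    to-0 : ∀ u → Star (Linked f′) u 0F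
    to-0 0F = done
    to-0 1F = flip 0–1 ◅ done
    to-0 (suc (suc u)) = kleisliStar (λ v → suc (suc v)) lift-step (connected u x) ◅◅ (x–0 ◅ done)

    from-0 : ∀ u → Star (Linked f′) 0F u
    from-0 0F = done
    from-0 1F = 0–1 ◅ done
    from-0 (suc (suc u)) = flip x–0 ◅ kleisliStar (λ v → suc (suc v)) lift-step (connected x u)

    extension-connected : ∀ u v → Star (Linked f′) u v
    extension-connected u v = to-0 u ◅◅ from-0 v

-- The first edge is distinguished: it is not a loop, and it is the edge on
-- which the next graph is built.
record LoopyCubic (n m t : ℕ) : Set where
  field
    x y      : Fin n
    rest     : Vec (Edge n) m
    x≢y      : x ≢ y
    cubic    : Cubic ((x ∷ y ∷ []) ∷ rest)
    loops≡   : loops (mult ((x ∷ y ∷ []) ∷ rest)) ≡ t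

theta : LoopyCubic 2 2 0
theta = record
  { x = 0F ; y = 1F ; rest = (0F ∷ 1F ∷ []) ∷ (0F ∷ 1F ∷ []) ∷ [] ; x≢y = λ ()
  ; cubic = (λ { 0F → refl ; 1F → refl }) , connected⁺ ((0F ∷ 1F ∷ []) ∷ (0F ∷ 1F ∷ []) ∷ (0F ∷ 1F ∷ []) ∷ [])
      theta-connected
  ; loops≡ = refl }
  where
  theta-connected : ∀ u v → Star (Linked (mult {m = 3} ((0F ∷ 1F ∷ []) ∷ (0F ∷ 1F ∷ []) ∷ (0F ∷ 1F ∷ []) ∷ []))) u v
  theta-connected 0F             0F             = done
  theta-connected 0F             1F             = s≤s z≤n ◅ done
  theta-connected 1F             0F             = s≤s z≤n ◅ done
  theta-connected 1F             1F             = done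
  theta-connected (suc (suc ())) _
  theta-connected 0F             (suc (suc ()))
  theta-connected 1F             (suc (suc ()))

module _ {n m t} (L : LoopyCubic n m t) where
  open LoopyCubic L

  private
    x′ y′ : Fin (2 + n)
    x′ = suc (suc x)
    y′ = suc (suc y)

    old-degree : ∀ w → indicator (x ≟ w) + (indicator (y ≟ w) + degree rest w) ≡ 3
    old-degree w = trans (sym (degree-∷ x y rest w)) (proj₁ cubic w)

    old-loops : loops (mult rest) ≡ t
    old-loops = trans (sym (trans (loops-∷ x y rest) (cong (_+ loops (mult rest)) (indicator-no (x ≟ y) x≢y)))) loops≡

  -- Subdivide xy by the vertex 0 and hang on it the vertex 1 with a loop. The new first edge x0 is
  -- again not a loop, so the construction can be iterated.
  insert-loop : LoopyCubic (2 + n) (3 + m) (suc t)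
  insert-loop = record
    { x = x′ ; y = 0F ; rest = tail ; x≢y = λ ()
    ; cubic = degrees , connected⁺ G (extension-connected x y rest (mult G) (mult-sym G) keeps x–0 0–1 (inj₁ y–0) (connected⁻ ((x ∷ y ∷ []) ∷ rest) (proj₂ cubic)))
    ; loops≡ = trans (loops-∷ x′ 0F tail) (trans (loops-∷ y′ 0F ((0F ∷ 1F ∷ []) ∷ (1F ∷ 1F ∷ []) ∷ shift rest)) (trans (loops-∷ 0F 1F ((1F ∷ 1F ∷ []) ∷ shift rest)) (trans (loops-∷ 1F 1F (shift rest))
        (cong suc (trans (loops-shift rest) old-loops))))) }
    where
    tail : Vec (Edge (2 + n)) (3 + m)
    tail = (y′ ∷ 0F ∷ []) ∷ (0F ∷ 1F ∷ []) ∷ (1F ∷ 1F ∷ []) ∷ shift rest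
    G : Multigraph (2 + n) (4 + m)
    G = (x′ ∷ 0F ∷ []) ∷ tail
    x–0 : Linked (mult G) x′ 0F
    x–0 = ≤-trans (≤-reflexive (sym (δ-self x′ 0F))) (m≤m+n _ _)
    y–0 : Linked (mult G) y′ 0F
    y–0 = ≤-trans (≤-trans (≤-reflexive (sym (δ-self y′ 0F))) (m≤m+n _ _)) (m≤n+m _ (δ x′ 0F y′ 0F))
    0–1 : Linked (mult G) 0F 1F
    0–1 = s≤s z≤n
    keeps : ∀ u v → mult rest u v ≤ mult G (suc (suc u)) (suc (suc v))
    keeps u v = ≤-trans (≤-reflexive (sym (mult-shift rest u v))) (≤-trans (m≤n+m _ (δ 1F 1F u′ v′)) (≤-trans (m≤n+m _ (δ 0F 1F u′ v′))
      (≤-trans (m≤n+m _ (δ y′ 0F u′ v′)) (m≤n+m _ (δ x′ 0F u′ v′)))))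
      where
      u′ v′ : Fin (2 + n)
      u′ = suc (suc u)
      v′ = suc (suc v)
    degrees : ∀ w → degree G w ≡ 3
    degrees 0F = cong (3 +_) (degree-shift-0 rest)
    degrees 1F = cong (3 +_) (degree-shift-1 rest)
    degrees (suc (suc w)) = trans (degree-∷ x′ 0F tail (suc (suc w))) (trans (cong₂ _+_ (indicator-shift x w)
      (trans (degree-∷ y′ 0F ((0F ∷ 1F ∷ []) ∷ (1F ∷ 1F ∷ []) ∷ shift rest) (suc (suc w)))
        (cong₂ _+_ (indicator-shift y w) (degree-shift rest w)))) (old-degree w))

  -- Replace xy by the path x 0 1 y with its middle edge doubled: two more vertices and no new loop.
  insert-digon : LoopyCubic (2 + n) (3 + m) t
  insert-digon = record
    { x = x′ ; y = 0F ; rest = tail ; x≢y = λ ()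
    ; cubic = degrees , connected⁺ G (extension-connected x y rest (mult G) (mult-sym G) keeps x–0 0–1 (inj₂ y–1) (connected⁻ ((x ∷ y ∷ []) ∷ rest) (proj₂ cubic)))
    ; loops≡ = trans (loops-∷ x′ 0F tail) (trans (loops-∷ y′ 1F ((0F ∷ 1F ∷ []) ∷ (0F ∷ 1F ∷ []) ∷ shift rest)) (trans (loops-∷ 0F 1F ((0F ∷ 1F ∷ []) ∷ shift rest)) (trans (loops-∷ 0F 1F (shift rest))
        (trans (loops-shift rest) old-loops)))) }
    where
    tail : Vec (Edge (2 + n)) (3 + m)
    tail = (y′ ∷ 1F ∷ []) ∷ (0F ∷ 1F ∷ []) ∷ (0F ∷ 1F ∷ []) ∷ shift rest
    G : Multigraph (2 + n) (4 + m)
    G = (x′ ∷ 0F ∷ []) ∷ tail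
    x–0 : Linked (mult G) x′ 0F
    x–0 = ≤-trans (≤-reflexive (sym (δ-self x′ 0F))) (m≤m+n _ _)
    y–1 : Linked (mult G) y′ 1F
    y–1 = ≤-trans (≤-trans (≤-reflexive (sym (δ-self y′ 1F))) (m≤m+n _ _)) (m≤n+m _ (δ x′ 0F y′ 1F))
    0–1 : Linked (mult G) 0F 1F
    0–1 = s≤s z≤n
    keeps : ∀ u v → mult rest u v ≤ mult G (suc (suc u)) (suc (suc v))
    keeps u v = ≤-trans (≤-reflexive (sym (mult-shift rest u v))) (≤-trans (m≤n+m _ (δ 0F 1F u′ v′)) (≤-trans (m≤n+m _ (δ 0F 1F u′ v′))
      (≤-trans (m≤n+m _ (δ y′ 1F u′ v′)) (m≤n+m _ (δ x′ 0F u′ v′)))))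
      where
      u′ v′ : Fin (2 + n)
      u′ = suc (suc u)
      v′ = suc (suc v)
    degrees : ∀ w → degree G w ≡ 3
    degrees 0F = cong (3 +_) (degree-shift-0 rest)
    degrees 1F = cong (3 +_) (degree-shift-1 rest)
    degrees (suc (suc w)) = trans (degree-∷ x′ 0F tail (suc (suc w))) (trans (cong₂ _+_ (indicator-shift x w)
      (trans (degree-∷ y′ 1F ((0F ∷ 1F ∷ []) ∷ (0F ∷ 1F ∷ []) ∷ shift rest) (suc (suc w)))
        (cong₂ _+_ (indicator-shift y w) (degree-shift rest w)))) (old-degree w))

-- Start from the theta graph and extend k times, each time by two vertices and three edges; t of
-- the extensions insert a loop.
loopyCubic : ∀ k t → t ≤ k → LoopyCubic (suc k * 2) (2 + k * 3) t
loopyCubic zero    zero    z≤n       = theta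
loopyCubic (suc k) zero    z≤n       = insert-digon (loopyCubic k zero z≤n)
loopyCubic (suc k) (suc t) (s≤s t≤k) = insert-loop (loopyCubic k t t≤k)

edgeCount-even : ∀ q → q * 3 ≡ edgeCount (q * 2)
edgeCount-even q = sym (trans (cong (λ e → e / 2) (solve 1 (λ q → con 3 :* (q :* con 2) := q :* con 3 :* con 2) refl q))
  (m*n/n≡m (q * 3) 2))
  where open +-*-Solver

-- The labelled case.

module LabelledSpectrum where
  import Data.Integer.Base as ℤ
  open Enumeration using (≋⇒mult; mult⇒≋; module Labelled)
  open Laplacian

  module _ (n : ℕ) where
    open Labelled n

    multOf-cubic : ∀ i v → deg (multOf i) v ≡ 3
    multOf-cubic i v = trans (sym (degree-deg (representative i) v)) (proj₁ (representative-cubic i) v)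

    multOf-sym : ∀ i u v → multOf i u v ≡ multOf i v u
    multOf-sym i = mult-sym (representative i)

    multOf-injective : ∀ {i j} → (∀ a b → multOf i a b ≡ multOf j a b) → i ≡ j
    multOf-injective {i} {j} h = representative-injective (mult⇒≋ {G = representative i} {representative j} h)

    realise : ∀ {m} → m ≡ edgeCount n → (G : Multigraph n m) → Cubic G → ∃[ i ] (∀ a b → mult G a b ≡ multOf i a b)
    realise refl G cubic = let i , G≋ = class-of G cubic in i , ≋⇒mult {G = G} {representative i} G≋

    multOf-rewire : ∀ i u v g h → u ≢ v → 2 ≤ multOf i u v → 1 ≤ multOf i g h → g ≢ h → g ≢ u → g ≢ v → h ≢ v →
      ∃[ j ] Rewired u v g h (multOf i) (multOf j)
    multOf-rewire i u v g h _ 2≤uv gh _ g≢u g≢v _ =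
      let G′ , cubic , R = rewire (representative i) (representative-cubic i) u v g h 2≤uv gh g≢u g≢v
          j , same = realise refl G′ cubic
      in j , record { removed = Rewired.removed R
                    ; balance = λ a b → trans (cong (_+ (δ u v a b + δ g h a b)) (sym (same a b))) (Rewired.balance R a b) }

    -- The exit bound grows with t, so its value at t = k serves all k + 1 classes. It appears twice
    -- because of the factor 2 in `rayleigh`.
    labelled-bound : ∀ k → 2 * (4 + k) ≤ n →
      (∀ t → t ≤ k → ∃[ i ] loops (multOf i) ≡ t) →
      KthLaplacianEigenvalue≤ (Γˡ n) (suc k) (fromℤ (ℤ.+ ((162 + 9 * k) + (162 + 9 * k))))
    labelled-bound k large nonempty = eigenvalue-bound (Γˡ n) colour k (162 + 9 * k) nonempty λ t t≤k →
        ≤-trans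
          (exits-bound multOf multOf-cubic multOf-sym multOf-injective multOf-rewire t
            (≤-trans (*-monoʳ-≤ 2 (+-monoʳ-≤ 4 t≤k)) large)
            (colourClass (Γˡ n) colour t) (Unique.filter⁺ _ (Unique.allFin⁺ _))
            (λ i∈ → sym (proj₂ (∈-filter⁻ (λ i → t ℕ.≟ colour i) {xs = allFin _} i∈)))
            (λ eq → ∈-filter⁺ (λ i → t ℕ.≟ colour i) (∈-allFin _) (sym eq))
            Adj adj⇒switch (exits (Γˡ n) colour) (λ i → Unique.filter⁺ _ (Unique.allFin⁺ _))
            (λ {i} j∈ → proj₂ (∈-filter⁻ _ {xs = allFin _} j∈)))
          (*-monoˡ-≤ (length (colourClass (Γˡ n) colour t)) (+-monoʳ-≤ 162 (*-monoʳ-≤ 9 t≤k)))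
      where
      colour : Vertex → ℕ
      colour i = loops (multOf i)

  labelled : ∀ k q {n} → n ≡ q * 2 → 4 + k ≤ q →
    KthLaplacianEigenvalue≤ (Γˡ n) (suc k) (fromℤ (ℤ.+ ((162 + 9 * k) + (162 + 9 * k))))
  labelled k (suc q) {n} n≡ 4+k≤q = labelled-bound n k
      (≤-trans (≤-reflexive (*-comm 2 (4 + k))) (≤-trans (*-monoˡ-≤ 2 4+k≤q) (≤-reflexive (sym n≡))))
      λ t t≤k →
        let open LoopyCubic (subst (λ n → LoopyCubic n (2 + q * 3) t) (sym n≡)
              (loopyCubic q t (≤-trans t≤k (≤-trans (m≤n+m k 3) (s≤s⁻¹ 4+k≤q)))))
            i , same = realise n (trans (edgeCount-even (suc q)) (cong edgeCount (sym n≡))) ((x ∷ y ∷ []) ∷ rest) cubic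
        in i , trans (loops-cong {f = Labelled.multOf n i} {mult ((x ∷ y ∷ []) ∷ rest)} (λ a b → sym (same a b))) loops≡

-- Walks of bounded length.

open Enumeration using (Iso; iso)

-- `here` accepts every ℓ, so the index bounds the length of a walk instead of measuring it.
data Within {n} (f : Mult n) : ℕ → Fin n → Fin n → Set where
  here : ∀ {ℓ u} → Within f ℓ u u
  step : ∀ {ℓ u w v} → Linked f u w → Within f ℓ w v → Within f (suc ℓ) u v

module _ {n} {f : Mult n} where

  within-mono : ∀ {k ℓ u v} → k ≤ ℓ → Within f k u v → Within f ℓ u v
  within-mono k≤ℓ       here       = here
  within-mono (s≤s k≤ℓ) (step l w) = step l (within-mono k≤ℓ w)

  within-trans : ∀ {k ℓ u w v} → Within f k u w → Within f ℓ w v → Within f (k + ℓ) u v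
  within-trans {k} {ℓ} here q = within-mono (m≤n+m ℓ k) q
  within-trans (step l p) q = step l (within-trans p q)

  within⇒star : ∀ {ℓ u v} → Within f ℓ u v → Star (Linked f) u v
  within⇒star here       = done
  within⇒star (step l w) = l ◅ within⇒star w

within-iso : ∀ {n} {f g : Mult n} (φ : Iso f g) → ∀ {ℓ u v} → Within g ℓ u v →
  Within f ℓ (Iso.π φ ⟨$⟩ˡ u) (Iso.π φ ⟨$⟩ˡ v)
within-iso φ here = here
within-iso {g = g} φ@(iso π p) (step l w) =
  step (≤-trans l (≤-reflexive (sym (trans (p _ _) (cong₂ g (inverseʳ π) (inverseʳ π)))))) (within-iso φ w)

sum-≥ : ∀ {n} (f : Fin n → ℕ) i → f i ≤ ℕΣ.sum f
sum-≥ f zero    = m≤m+n _ _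
sum-≥ f (suc i) = ≤-trans (sum-≥ (f ∘ suc) i) (m≤n+m _ _)

sum-≥1 : ∀ {n} (f : Fin n → ℕ) → 1 ≤ ℕΣ.sum f → ∃[ i ] 1 ≤ f i
sum-≥1 {suc n} f h with f zero in eq
... | suc _ = zero , ≤-trans (s≤s z≤n) (≤-reflexive (sym eq))
... | zero  = let i , p = sum-≥1 (f ∘ suc) h in suc i , p

+-≥1 : ∀ x {y} → 1 ≤ x + y → 1 ≤ x ⊎ 1 ≤ y
+-≥1 zero    h = inj₂ h
+-≥1 (suc x) h = inj₁ (s≤s z≤n)

-- Bicirculant graphs: symmetry and diameter.

module Cyclic (m′ : ℕ) where

  N : ℕ
  N = suc m′

  infixl 6 _⊞_
  _⊞_ : Fin N → ℕ → Fin N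
  i ⊞ k = (toℕ i + k) mod N

  toℕ-mod : ∀ x → toℕ (x mod N) ≡ x % N
  toℕ-mod x = toℕ-fromℕ< (m%n<n x N)

  toℕ-⊞ : ∀ i k → toℕ (i ⊞ k) ≡ (toℕ i + k) % N
  toℕ-⊞ i k = toℕ-mod (toℕ i + k)

  private
    absorb : ∀ x y → (x % N + y) % N ≡ (x + y) % N
    absorb x y = trans (%-distribˡ-+ (x % N) y N) (trans (cong (λ z → (z + y % N) % N) (m%n%n≡m%n x N)) (sym (%-distribˡ-+ x y N)))

  ⊞-assoc : ∀ i k l → i ⊞ k ⊞ l ≡ i ⊞ (k + l)
  ⊞-assoc i k l = toℕ-injective (trans (toℕ-⊞ (i ⊞ k) l) (trans (cong (λ z → (z + l) % N) (toℕ-⊞ i k))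
    (trans (absorb (toℕ i + k) l) (trans (cong (_% N) (+-assoc (toℕ i) k l)) (sym (toℕ-⊞ i (k + l)))))))

  ⊞-comm : ∀ i k l → i ⊞ k ⊞ l ≡ i ⊞ l ⊞ k
  ⊞-comm i k l = trans (⊞-assoc i k l) (trans (cong (i ⊞_) (+-comm k l)) (sym (⊞-assoc i l k)))

  ⊞-multiple : ∀ i k → i ⊞ (k * N) ≡ i
  ⊞-multiple i k = toℕ-injective (trans (toℕ-⊞ i (k * N)) (trans ([m+kn]%n≡m%n (toℕ i) k N) (m<n⇒m%n≡m (toℕ<n i))))

  ⊞-0 : ∀ i → i ⊞ 0 ≡ i
  ⊞-0 i = ⊞-multiple i 0

  -- As m′ ≡ -1 modulo N, adding k * m′ subtracts k. In this way `to-zero`, `distance` and the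
  -- inverse rotations go backwards without negative numbers.
  ⊞-inverse : ∀ i k → i ⊞ k ⊞ (k * m′) ≡ i
  ⊞-inverse i k = trans (⊞-assoc i k (k * m′)) (trans (cong (i ⊞_) (sym (*-suc k m′))) (⊞-multiple i k))

  ⊞-inverse′ : ∀ i k → i ⊞ (k * m′) ⊞ k ≡ i
  ⊞-inverse′ i k = trans (⊞-comm i (k * m′) k) (⊞-inverse i k)

  to-zero : ∀ i → i ⊞ (toℕ i * m′) ≡ zero
  to-zero i = toℕ-injective (trans (toℕ-⊞ i (toℕ i * m′)) (trans (cong (_% N) (sym (*-suc (toℕ i) m′))) (m*n%n≡0 (toℕ i) N)))

  distance : ∀ i p → ∃[ d ] (d ≤ m′ × i ⊞ d ≡ p)
  distance i p = x % N , s≤s⁻¹ (m%n<n x N) , toℕ-injective (begin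
      toℕ (i ⊞ x % N)              ≡⟨ toℕ-⊞ i (x % N) ⟩
      (toℕ i + x % N) % N          ≡⟨ cong (_% N) (+-comm (toℕ i) (x % N)) ⟩
      (x % N + toℕ i) % N          ≡⟨ absorb x (toℕ i) ⟩
      (x + toℕ i) % N              ≡⟨ cong (_% N) (solve 3 (λ p i n → p :+ i :* n :+ i := p :+ i :* (con 1 :+ n)) refl (toℕ p) (toℕ i) m′) ⟩
      (toℕ p + toℕ i * N) % N      ≡⟨ [m+kn]%n≡m%n (toℕ p) (toℕ i) N ⟩
      toℕ p % N                    ≡⟨ m<n⇒m%n≡m (toℕ<n p) ⟩
      toℕ p ∎)
    where
    open ≡-Reasoning
    open +-*-Solver
    x = toℕ p + toℕ i * m′

  σ : ℕ → Permutation′ N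
  σ k = permutation (_⊞ k) (_⊞ (k * m′)) (λ i → ⊞-inverse′ i k) (λ i → ⊞-inverse i k)

  a b : Fin N → Fin (N * 2)
  a i = combine i zero
  b i = combine i (suc zero)

  data Side : Fin (N * 2) → Set where
    isA : ∀ i → Side (a i)
    isB : ∀ i → Side (b i)

  side : ∀ v → Side v
  side v = subst Side (combine-remQuot {N} 2 v) (by (proj₁ (remQuot {N} 2 v)) (proj₂ (remQuot {N} 2 v)))
    where
    by : ∀ i (c : Fin 2) → Side (combine i c)
    by i zero       = isA i
    by i (suc zero) = isB i

  pos : Fin (N * 2) → Fin N
  pos v = proj₁ (remQuot {N} 2 v)

  pos-a : ∀ i → pos (a i) ≡ i
  pos-a i = cong proj₁ (remQuot-combine i zero)

  pos-b : ∀ i → pos (b i) ≡ i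
  pos-b i = cong proj₁ (remQuot-combine i (suc zero))

  a≢b : ∀ i j → a i ≢ b j
  a≢b i j eq with trans (sym (cong proj₂ (remQuot-combine i zero))) (trans (cong (proj₂ ∘ remQuot {N} 2) eq) (cong proj₂ (remQuot-combine j (suc zero))))
  ... | ()

  rotate : ℕ → Fin (N * 2) → Fin (N * 2)
  rotate k v = combine (pos v ⊞ k) (proj₂ (remQuot {N} 2 v))

  rotate-a : ∀ k i → rotate k (a i) ≡ a (i ⊞ k)
  rotate-a k i = cong₂ combine (cong (_⊞ k) (pos-a i)) (cong proj₂ (remQuot-combine i zero))

  rotate-b : ∀ k i → rotate k (b i) ≡ b (i ⊞ k)
  rotate-b k i = cong₂ combine (cong (_⊞ k) (pos-b i)) (cong proj₂ (remQuot-combine i (suc zero)))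

  rotate-inverse : ∀ k l → (∀ i → i ⊞ l ⊞ k ≡ i) → ∀ v → rotate k (rotate l v) ≡ v
  rotate-inverse k l h v with side v
  ... | isA i = trans (cong (rotate k) (rotate-a l i)) (trans (rotate-a k (i ⊞ l)) (cong a (h i)))
  ... | isB i = trans (cong (rotate k) (rotate-b l i)) (trans (rotate-b k (i ⊞ l)) (cong b (h i)))

  rotation : ℕ → Permutation′ (N * 2)
  rotation k = permutation (rotate k) (rotate (k * m′))
    (rotate-inverse k (k * m′) λ i → ⊞-inverse′ i k) (rotate-inverse (k * m′) k λ i → ⊞-inverse i k)

  rotate-injective : ∀ k {u v} → rotate k u ≡ rotate k v → u ≡ v
  rotate-injective k {u} {v} eq = trans (sym (rotate-inverse (k * m′) k (λ i → ⊞-inverse i k) u))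
    (trans (cong (rotate (k * m′)) eq) (rotate-inverse (k * m′) k (λ i → ⊞-inverse i k) v))

  count-a count-b : Fin (N * 2) → ℕ
  count-a v = ℕΣ.sum λ i → indicator (a i ≟ v)
  count-b v = ℕΣ.sum λ i → indicator (b i ≟ v)

  count-shifted : ∀ k v → ℕΣ.sum (λ i → indicator (b (i ⊞ k) ≟ v)) ≡ count-b v
  count-shifted k v = sym (ℕΣ.∑-permute {N} {N} (λ i → indicator (b i ≟ v)) (σ k))

  count-total : ∀ v → count-a v + count-b v ≡ 1
  count-total v with side v
  ... | isA p = cong₂ _+_ (trans (ℕΣ.sum-cong-≗ {N} λ i → indicator-cong (a i ≟ a p) (p ≟ i)
                    (λ eq → trans (sym (pos-a p)) (trans (cong pos (sym eq)) (pos-a i))) (λ { refl → refl })) (sum-single p))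
                  (sum-zeros {N} λ i → indicator-no (b i ≟ a p) (a≢b p i ∘ sym))
  ... | isB p = cong₂ _+_ (sum-zeros {N} λ i → indicator-no (a i ≟ b p) (a≢b i p))
                  (trans (ℕΣ.sum-cong-≗ {N} λ i → indicator-cong (b i ≟ b p) (p ≟ i)
                    (λ eq → trans (sym (pos-b p)) (trans (cong pos (sym eq)) (pos-b i))) (λ { refl → refl })) (sum-single p))

  -- The bicirculant graph with edges from a i to b i, b (i + 1) and b (i + s).
  module Graph (s : ℕ) where

    spoke : ℕ → Fin N → Mult (N * 2)
    spoke k i = δ (a i) (b (i ⊞ k))

    spokes : Fin N → Mult (N * 2)
    spokes i = spoke 0 i ⊕ (spoke 1 i ⊕ spoke s i)

    F : Mult (N * 2)
    F u v = ℕΣ.sum λ i → spokes i u v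

    edges : Fin N → Vec (Edge (N * 2)) 3
    edges i = (a i ∷ b (i ⊞ 0) ∷ []) ∷ (a i ∷ b (i ⊞ 1) ∷ []) ∷ (a i ∷ b (i ⊞ s) ∷ []) ∷ []

    G : Multigraph (N * 2) (N * 3)
    G = concat (tabulate edges)

    mult-G : ∀ u v → mult G u v ≡ F u v
    mult-G u v = partial N id
      where
      partial : ∀ r (g : Fin r → Fin N) → mult (concat (tabulate (edges ∘ g))) u v ≡ ℕΣ.sum (λ i → spokes (g i) u v)
      partial zero    g = refl
      partial (suc r) g = trans (cong (λ z → spoke 0 (g zero) u v + (spoke 1 (g zero) u v + (spoke s (g zero) u v + z))) (partial r (g ∘ suc)))
        (solve 4 (λ x y z w → x :+ (y :+ (z :+ w)) := x :+ (y :+ z) :+ w) refl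
          (spoke 0 (g zero) u v) (spoke 1 (g zero) u v) (spoke s (g zero) u v) _)
        where open +-*-Solver

    -- Each of the three kinds of spokes is a perfect matching between the a-vertices and the
    -- b-vertices and adds 1 to every degree. Coinciding kinds do no harm.
    deg-F : ∀ v → deg F v ≡ 3
    deg-F v = begin
      deg F v
        ≡⟨ cong (_+ F v v) (ℕΣ.∑-comm {N * 2} {N} λ w i → spokes i v w) ⟩
      ℕΣ.sum (λ i → ℕΣ.sum (spokes i v)) + F v v
        ≡⟨ sym (ℕΣ.∑-distrib-+ {N} (λ i → ℕΣ.sum (spokes i v)) (λ i → spokes i v v)) ⟩
      ℕΣ.sum (λ i → deg (spokes i) v)
        ≡⟨ ℕΣ.sum-cong-≗ {N} (λ i → trans (deg-⊕ (spoke 0 i) (spoke 1 i ⊕ spoke s i) v)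
             (cong₂ _+_ (deg-δ (a i) (b (i ⊞ 0)) v) (trans (deg-⊕ (spoke 1 i) (spoke s i) v)
               (cong₂ _+_ (deg-δ (a i) (b (i ⊞ 1)) v) (deg-δ (a i) (b (i ⊞ s)) v))))) ⟩
      ℕΣ.sum (λ i → A i + B 0 i + (A i + B 1 i + (A i + B s i)))
        ≡⟨ ℕΣ.∑-distrib-+ {N} (λ i → A i + B 0 i) (λ i → A i + B 1 i + (A i + B s i)) ⟩
      ℕΣ.sum (λ i → A i + B 0 i) + ℕΣ.sum (λ i → A i + B 1 i + (A i + B s i))
        ≡⟨ cong₂ _+_ (one 0) (trans (ℕΣ.∑-distrib-+ {N} (λ i → A i + B 1 i) (λ i → A i + B s i)) (cong₂ _+_ (one 1) (one s))) ⟩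
      3 ∎
      where
      open ≡-Reasoning
      A : Fin N → ℕ
      A i = indicator (a i ≟ v)
      B : ℕ → Fin N → ℕ
      B k i = indicator (b (i ⊞ k) ≟ v)
      one : ∀ k → ℕΣ.sum (λ i → A i + B k i) ≡ 1
      one k = trans (ℕΣ.∑-distrib-+ {N} A (B k)) (trans (cong (count-a v +_) (count-shifted k v)) (count-total v))

    rotation-invariant : ∀ k u v → F u v ≡ F (rotate k u) (rotate k v)
    rotation-invariant k u v = trans (ℕΣ.sum-cong-≗ {N} λ i → cong₂ _+_ (move 0 i) (cong₂ _+_ (move 1 i) (move s i)))
      (sym (ℕΣ.∑-permute {N} {N} (λ i → spokes i (rotate k u) (rotate k v)) (σ k)))
      where
      move : ∀ c i → spoke c i u v ≡ spoke c (i ⊞ k) (rotate k u) (rotate k v)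
      move c i = trans
        (δ-cong {a = a i} {b (i ⊞ c)} {u} {v} {rotate k (a i)} {rotate k (b (i ⊞ c))} {rotate k u} {rotate k v}
          (λ { (inj₁ (p , q)) → inj₁ (cong (rotate k) p , cong (rotate k) q) ; (inj₂ (p , q)) → inj₂ (cong (rotate k) p , cong (rotate k) q) })
          (λ { (inj₁ (p , q)) → inj₁ (rotate-injective k p , rotate-injective k q) ; (inj₂ (p , q)) → inj₂ (rotate-injective k p , rotate-injective k q) }))
        (cong₂ (λ x y → δ x y (rotate k u) (rotate k v)) (rotate-a k i) (trans (rotate-b k (i ⊞ c)) (cong b (⊞-comm i c k))))

    rotation-iso : ℕ → Iso F F
    rotation-iso k = iso (rotation k) (rotation-invariant k)

    data Spoke : ℕ → Set where
      spoke-0 : Spoke 0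
      spoke-1 : Spoke 1
      spoke-s : Spoke s

    F-sym : ∀ u v → F u v ≡ F v u
    F-sym u v = ℕΣ.sum-cong-≗ {N} λ i → cong₂ _+_ (δ-sym (a i) (b (i ⊞ 0)) u v)
      (cong₂ _+_ (δ-sym (a i) (b (i ⊞ 1)) u v) (δ-sym (a i) (b (i ⊞ s)) u v))

    link : ∀ {k} → Spoke k → ∀ i → Linked F (a i) (b (i ⊞ k))
    link {k} c i = ≤-trans (≤-reflexive (sym (δ-self (a i) (b (i ⊞ k))))) (≤-trans (part c) (sum-≥ (λ i′ → spokes i′ (a i) (b (i ⊞ k))) i))
      where
      part : ∀ {k} → Spoke k → spoke k i (a i) (b (i ⊞ k)) ≤ spokes i (a i) (b (i ⊞ k))
      part spoke-0 = m≤m+n _ _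
      part spoke-1 = ≤-trans (m≤m+n _ _) (m≤n+m _ (spoke 0 i (a i) (b (i ⊞ 1))))
      part spoke-s = ≤-trans (m≤n+m _ (spoke 1 i (a i) (b (i ⊞ s)))) (m≤n+m _ (spoke 0 i (a i) (b (i ⊞ s))))

    unlink : ∀ {u v} → Linked F u v → ∃[ i ] ∃[ k ] (Spoke k × Ends (a i) (b (i ⊞ k)) u v)
    unlink {u} {v} l with sum-≥1 (λ i → spokes i u v) l
    ... | i , p with +-≥1 (spoke 0 i u v) p
    ... | inj₁ q = i , 0 , spoke-0 , δ-≥1 (a i) (b (i ⊞ 0)) u v q
    ... | inj₂ q with +-≥1 (spoke 1 i u v) q
    ... | inj₁ r = i , 1 , spoke-1 , δ-≥1 (a i) (b (i ⊞ 1)) u v r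
    ... | inj₂ r = i , s , spoke-s , δ-≥1 (a i) (b (i ⊞ s)) u v r

    a-to-b : ∀ i → Linked F (a i) (b i)
    a-to-b i = subst (λ j → Linked F (a i) (b j)) (⊞-0 i) (link spoke-0 i)

    b-to-a : ∀ i → Linked F (b i) (a i)
    b-to-a i = ≤-trans (a-to-b i) (≤-reflexive (F-sym (a i) (b i)))

    -- Out along a spoke of kind k and back along the one of kind 0: two edges advance the index by
    -- k.
    steps : ∀ {k} → Spoke k → ∀ r i → Within F (r * 2) (a i) (a (i ⊞ (r * k)))
    steps c zero i = subst (λ j → Within F 0 (a i) (a j)) (sym (⊞-0 i)) here
    steps {k} c (suc r) i = step (link c i) (step (b-to-a (i ⊞ k))
      (subst (λ j → Within F (r * 2) (a (i ⊞ k)) (a j)) (⊞-assoc i k (r * k)) (steps c r (i ⊞ k))))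

    -- Every vertex is reached by about N / s steps of length s and at most s of length 1.
    module _ .{{_ : NonZero s}} where

      diameter : ℕ
      -- This is only an upper bound. The 2 pays for passing from b to a at the start and from a to
      -- b at the end.
      diameter = 2 + ((m′ / s) * 2 + s * 2)

      within-a : ∀ i p → Within F ((m′ / s) * 2 + s * 2) (a i) (a p)
      within-a i p = let d , d≤m′ , eq = distance i p in
        within-mono (+-mono-≤ (*-monoˡ-≤ 2 (/-monoˡ-≤ s d≤m′)) (*-monoˡ-≤ 2 (<⇒≤ (m%n<n d s))))
          (subst (λ j → Within F ((d / s) * 2 + (d % s) * 2) (a i) (a j))
            (trans (⊞-assoc i ((d / s) * s) ((d % s) * 1)) (trans (cong (i ⊞_) (trans (+-comm ((d / s) * s) ((d % s) * 1))
              (trans (cong (_+ (d / s) * s) (*-identityʳ (d % s))) (sym (m≡m%n+[m/n]*n d s))))) eq))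
            (within-trans (steps spoke-s (d / s) i) (steps spoke-1 (d % s) (i ⊞ ((d / s) * s)))))

      within-diameter : ∀ u v → Within F diameter u v
      within-diameter u v = within-mono (≤-reflexive (cong suc (+-comm ((m′ / s) * 2 + s * 2) 1))) (across (side u) (side v))
        where
        across : ∀ {u v} → Side u → Side v → Within F (1 + ((m′ / s) * 2 + s * 2 + 1)) u v
        across (isA i) (isA p) = within-mono (≤-trans (m≤m+n _ 1) (n≤1+n _)) (within-a i p)
        across (isA i) (isB p) = within-mono (n≤1+n _) (within-trans (within-a i p) (step (a-to-b p) (here {ℓ = 0})))
        across (isB i) (isA p) = step (b-to-a i) (within-mono (m≤m+n _ 1) (within-a i p))
        across (isB i) (isB p) = step (b-to-a i) (within-trans (within-a i p) (step (a-to-b p) (here {ℓ = 0})))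

      cubic : Cubic G
      cubic = (λ v → trans (degree-deg G v) (trans (deg-cong {f = mult G} {F} mult-G v) (deg-F v)))
            , connected⁺ G λ u v → within⇒star (convert (within-diameter u v))
        where
        convert : ∀ {ℓ u v} → Within F ℓ u v → Within (mult G) ℓ u v
        convert here = here
        convert (step {u = u} {w} l p) = step (≤-trans l (≤-reflexive (sym (mult-G u w)))) (convert p)

    spoke-≤ : 1 ≤ s → ∀ {k} → Spoke k → k ≤ s
    spoke-≤ 1≤s spoke-0 = z≤n
    spoke-≤ 1≤s spoke-1 = 1≤s
    spoke-≤ 1≤s spoke-s = ≤-refl

    -- Net displacement of a walk, forward by x and backward by y.
    displacement : 1 ≤ s → ∀ {ℓ u v} → Within F ℓ u v → ∃[ x ] ∃[ y ] (x + y ≤ ℓ * s × pos u ⊞ x ≡ pos v ⊞ y)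
    displacement 1≤s here = 0 , 0 , z≤n , refl
    displacement 1≤s {suc ℓ} {u} {v} (step {w = w} l p) with displacement 1≤s p | unlink {u} {w} l
    ... | x , y , x+y≤ , eq | i , k , c , inj₁ (refl , refl) = k + x , y
        , ≤-trans (≤-reflexive (+-assoc k x y)) (+-mono-≤ (spoke-≤ 1≤s c) x+y≤)
        , trans (cong (_⊞ (k + x)) (pos-a i)) (trans (sym (⊞-assoc i k x)) (trans (cong (_⊞ x) (sym (pos-b (i ⊞ k)))) eq))
    ... | x , y , x+y≤ , eq | i , k , c , inj₂ (refl , refl) = x , y + k
        , ≤-trans (≤-reflexive (trans (sym (+-assoc x y k)) (+-comm (x + y) k))) (+-mono-≤ (spoke-≤ 1≤s c) x+y≤)
        , trans (cong (_⊞ x) (pos-b (i ⊞ k))) (trans (⊞-comm i k x) (trans (cong (λ j → j ⊞ x ⊞ k) (sym (pos-a i)))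
            (trans (cong (_⊞ k) eq) (⊞-assoc (pos v) y k))))

    -- The vertex a with index H = ℓ s + 1 is out of reach from a 0. A walk of at most ℓ edges would
    -- give x ≡ H + y modulo N with x + y < H; as 2 H ≤ N, both sides are below N, so x = H + y,
    -- which contradicts x < H.
    far : 1 ≤ s → ∀ ℓ → 2 * suc (ℓ * s) ≤ N → ¬ (∀ u v → Within F ℓ u v)
    far 1≤s ℓ small all with displacement 1≤s (all (a zero) (a (suc (ℓ * s) mod N)))
    ... | x , y , x+y≤ , eq = <⇒≢ (≤-trans (s≤s (≤-trans (m≤m+n x y) x+y≤)) (m≤m+n H y)) (begin
        x                                 ≡⟨ sym (m<n⇒m%n≡m (≤-trans (s≤s (≤-trans (m≤m+n x y) x+y≤)) H≤m)) ⟩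
        x % N                             ≡⟨ sym (toℕ-⊞ zero x) ⟩
        toℕ (zero ⊞ x)                    ≡⟨ cong (λ j → toℕ (j ⊞ x)) (sym (pos-a zero)) ⟩
        toℕ (pos (a zero) ⊞ x)            ≡⟨ cong toℕ eq ⟩
        toℕ (pos (a (H mod N)) ⊞ y)       ≡⟨ cong (λ j → toℕ (j ⊞ y)) (pos-a (H mod N)) ⟩
        toℕ (H mod N ⊞ y)                 ≡⟨ toℕ-⊞ (H mod N) y ⟩
        (toℕ (H mod N) + y) % N           ≡⟨ cong (λ z → (z + y) % N) (toℕ-mod H) ⟩
        (H % N + y) % N                   ≡⟨ absorb H y ⟩
        (H + y) % N                       ≡⟨ m<n⇒m%n≡m (≤-trans (≤-reflexive (sym (+-suc H y)))
                                               (≤-trans (+-monoʳ-≤ H (s≤s (≤-trans (m≤n+m y x) x+y≤)))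
                                                 (≤-trans (≤-reflexive (cong (H +_) (sym (+-identityʳ H)))) small))) ⟩
        H + y                             ∎)
      where
      open ≡-Reasoning
      H = suc (ℓ * s)
      H≤m : H ≤ N
      H≤m = ≤-trans (m≤m+n H _) small

  module _ (s s′ : ℕ) .{{_ : NonZero s′}} where

    -- An isomorphism would carry the short walks of the graph with s′ over to the graph with s,
    -- where `far` forbids them.
    not-isomorphic : 1 ≤ s → 2 * suc (Graph.diameter s′ * s) ≤ N → ¬ Iso (Graph.F s) (Graph.F s′)
    not-isomorphic 1≤s small φ = Graph.far s 1≤s (Graph.diameter s′) small λ u v →
      subst₂ (Within (Graph.F s) (Graph.diameter s′)) (inverseˡ′ u) (inverseˡ′ v)
        (within-iso φ (Graph.within-diameter s′ (Iso.π φ ⟨$⟩ʳ u) (Iso.π φ ⟨$⟩ʳ v)))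
      where
      inverseˡ′ : ∀ u → Iso.π φ ⟨$⟩ˡ (Iso.π φ ⟨$⟩ʳ u) ≡ u
      inverseˡ′ u = inverseˡ (Iso.π φ)

-- The unlabelled case.

module UnlabelledSpectrum where

  open Counting
  open import Data.Fin.Base using (toℕ; fromℕ<)
  open import Data.Fin.Properties using (any?; toℕ-fromℕ<; toℕ<n; _≟_)
  import Data.Integer.Base as ℤ
  open import Data.Nat.Base using (_^_; NonZero)
  open import Data.Nat.DivMod using (_/_; m/n*n≤m)
  open Enumeration using (Switchable; Iso; Iso-sym; Iso-trans; Iso-refl; ≅⇒Iso; Iso⇒≅; transport-iso; module Unlabelled)
  open Laplacian

  open import Relation.Binary.Definitions using (tri<; tri≈; tri>)

  module _ {n : ℕ} (F : Mult n) (F-cubic : ∀ v → deg F v ≡ 3) (u v : Fin n)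
    (transitive : ∀ w → Σ[ φ ∈ Iso F F ] Iso.π φ ⟨$⟩ʳ w ∈ u ∷ v ∷ []) where

    private
      Code : Set
      Code = Fin n × Fin n × Fin n × Fin n

      last-two : Fin n → Fin n → List (Fin n × Fin n)
      last-two u₁ u₂ = nb F u₁ ⊗ λ x → nb F u₂

      last-three : Fin n → List (Fin n × Fin n × Fin n)
      last-three u₁ = nb F u₁ ⊗ last-two u₁

      codes : List Code
      codes = (u ∷ v ∷ []) ⊗ last-three

      length-codes : length codes ≤ 54
      length-codes = length-⊗-≤ (u ∷ v ∷ []) last-three 27 λ {u₁} _ →
        ≤-trans (length-⊗-≤ (nb F u₁) (last-two u₁) 9 λ {u₂} _ →
          ≤-trans (length-⊗-≤ (nb F u₁) (λ x → nb F u₂) 3 λ {x} _ → length-nb {f = F} F-cubic u₂)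
            (*-monoʳ-≤ 3 (length-nb {f = F} F-cubic u₁)))
          (*-monoʳ-≤ 9 (length-nb {f = F} F-cubic u₁))

      Decodes : Mult n → Code → Set
      Decodes h (u₁ , u₂ , x , y) = ∃[ g ] (Switch u₁ u₂ x y F g × Iso g h)

      decode : ∀ {h h′} c → Decodes h c → Decodes h′ c → Iso h h′
      decode c (g , S , φ) (g′ , S′ , φ′) = Iso-trans (Iso-sym φ) (Iso-trans (Iso-refl (deterministic S S′)) φ′)

      encode-at : ∀ {u₁ u₂ x y g h} → u₁ ∈ u ∷ v ∷ [] → Switch u₁ u₂ x y F g → Iso g h →
        ∃[ c ] (c ∈ codes × Decodes h c)
      encode-at {u₁} {u₂} {x} {y} {g} u₁∈ S φ = (u₁ , u₂ , x , y)
          , ∈-⊗⁺ {f = last-three} u₁∈ (∈-⊗⁺ {f = last-two u₁} (∈-support⁺ {h = F u₁} (first u₁ u₂ u₁ x old₁))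
              (∈-⊗⁺ (∈-support⁺ {h = F u₁} (second u₁ u₂ u₁ x old₁)) (∈-support⁺ {h = F u₂} (second u₁ u₂ u₂ y old₂))))
          , g , S , φ
        where
        open Switch S
        first : ∀ p q c d → (∀ a b → δ p q a b + δ c d a b ≤ F a b) → 1 ≤ F p q
        first p q c d h = ≤-trans (≤-reflexive (sym (δ-self p q))) (≤-trans (m≤m+n _ (δ c d p q)) (h p q))
        second : ∀ p q c d → (∀ a b → δ p q a b + δ c d a b ≤ F a b) → 1 ≤ F c d
        second p q c d h = ≤-trans (≤-reflexive (sym (δ-self c d))) (≤-trans (m≤n+m _ (δ p q c d)) (h c d))

      -- The representative f is only isomorphic to F. The switch is carried over to F and then
      -- moved by an automorphism until its first vertex is u or v; this changes the result only up
      -- to isomorphism, which `Decodes` permits.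
      encode : ∀ {f g h} → Iso f F → Switchable f g → Iso g h → ∃[ c ] (c ∈ codes × Decodes h c)
      encode φ (u₁ , u₂ , x , y , S) ψ =
        let g₁ , S₁ , φ₁ = transport-iso φ S
            ρ , root     = transitive (Iso.π φ ⟨$⟩ʳ u₁)
            g₂ , S₂ , φ₂ = transport-iso ρ S₁
        in encode-at root S₂ (Iso-trans φ₂ (Iso-trans φ₁ ψ))

    -- Two vertex orbits: up to an automorphism of F the first vertex of a switch
    -- is u or v, which leaves at most 2·3·3·3 switches.
    neighbours-bound : ∀ {N} (M : Fin N → Mult n) → (∀ {i j} → Iso (M i) (M j) → i ≡ j) →
      ∀ {f} → Iso f F → ∀ js → Unique js → (∀ {j} → j ∈ js → ∃[ g ] (Switchable f g × Iso g (M j))) → length js ≤ 54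
    neighbours-bound M M-injective φ js unique switch = ≤-trans
      (length-≤-by-coding (λ j c → Decodes (M j) c) unique (λ j∈ → let g , S , ψ = switch j∈ in encode φ S ψ)
        (λ {j} {j′} {c} p q → M-injective (decode c p q)))
      length-codes

  -- All that the eigenvalue bound uses of the circulants. Being stated for any n, it can be
  -- transported along n = q * 2 as a whole.
  record Family (n k : ℕ) : Set where
    field
      F              : ℕ → Mult n
      realised       : ∀ t → Σ[ G ∈ Multigraph n (edgeCount n) ] (Cubic G × (∀ u v → mult G u v ≡ F t u v))
      differ         : ∀ {t t′} → t ≤ k → t′ ≤ k → Iso (F t) (F t′) → t ≡ t′
      few-neighbours : ∀ t {N} (M : Fin N → Mult n) → (∀ {i j} → Iso (M i) (M j) → i ≡ j) →
        ∀ {f} → Iso f (F t) → ∀ js → Unique js → (∀ {j} → j ∈ js → ∃[ g ] (Switchable f g × Iso g (M j))) → length js ≤ 54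

  module _ {n k : ℕ} (family : Family n k) where
    open Family family
    open Unlabelled n

    multOf-injective : ∀ {i j} → Iso (multOf i) (multOf j) → i ≡ j
    multOf-injective {i} {j} φ = representative-injective (Iso⇒≅ {G = representative i} {representative j} φ)

    vertex : ∀ t → ∃[ i ] Iso (multOf i) (F t)
    vertex t = let G , cubic , same = realised t
                   i , G≅ = class-of G cubic
               in i , Iso-trans (Iso-sym (≅⇒Iso {G = G} {representative i} G≅)) (Iso-refl same)

    vertex-injective : ∀ {t t′} → t ≤ k → t′ ≤ k → proj₁ (vertex t) ≡ proj₁ (vertex t′) → t ≡ t′
    vertex-injective {t} {t′} t≤k t′≤k eq = differ t≤k t′≤k
      (Iso-trans (Iso-sym (proj₂ (vertex t))) (subst (λ i → Iso (multOf i) (F t′)) (sym eq) (proj₂ (vertex t′))))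

    position? : ∀ i → Dec (∃[ t ] i ≡ proj₁ (vertex (toℕ {suc k} t)))
    position? i = any? λ t → i ≟ proj₁ (vertex (toℕ t))

    -- Vertices outside the family share the colour k + 1, on which the eigenvalue bound puts no
    -- condition. The decision is an argument so that the lemmas can split on it directly.
    colourBy : ∀ {i} → Dec (∃[ t ] i ≡ proj₁ (vertex (toℕ {suc k} t))) → ℕ
    colourBy (yes (t , _)) = toℕ t
    colourBy (no _)        = suc k

    colour : Vertex → ℕ
    colour i = colourBy (position? i)

    colour-sound : ∀ {i} (d : Dec (∃[ t ] i ≡ proj₁ (vertex (toℕ {suc k} t)))) t → t ≤ k → colourBy d ≡ t → i ≡ proj₁ (vertex t)
    colour-sound (yes (t′ , i≡)) t t≤k refl = i≡
    colour-sound (no _)          t t≤k eq   = contradiction (≤-reflexive eq) (<⇒≱ (s≤s t≤k))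

    colour-vertex : ∀ {t} → t ≤ k → (d : Dec (∃[ t′ ] proj₁ (vertex t) ≡ proj₁ (vertex (toℕ {suc k} t′)))) → colourBy d ≡ t
    colour-vertex t≤k (yes (t′ , eq)) = sym (vertex-injective t≤k (s≤s⁻¹ (toℕ<n t′)) eq)
    colour-vertex t≤k (no none) =
      contradiction (fromℕ< (s≤s t≤k) , cong (λ t → proj₁ (vertex t)) (sym (toℕ-fromℕ< (s≤s t≤k)))) none

    unlabelled-bound : KthLaplacianEigenvalue≤ (Γᵘ n) (suc k) (fromℤ (ℤ.+ (54 + 54)))
    unlabelled-bound = eigenvalue-bound (Γᵘ n) colour k 54
      (λ t t≤k → proj₁ (vertex t) , colour-vertex t≤k (position? (proj₁ (vertex t))))
      λ t t≤k → sum-map-≤-* (λ i → length (exits (Γᵘ n) colour i)) 54 (colourClass (Γᵘ n) colour t) λ {i} i∈ →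
        few-neighbours t multOf multOf-injective
          (subst (λ j → Iso (multOf j) (F t))
            (sym (colour-sound (position? i) t t≤k (sym (proj₂ (∈-filter⁻ (λ i → t ℕ.≟ colour i) {xs = allFin _} i∈))))) (proj₂ (vertex t)))
          (exits (Γᵘ n) colour i) (Unique.filter⁺ _ (Unique.allFin⁺ _))
          λ {j} j∈ → adj⇒switch {i} {j} (proj₂ (proj₂ (∈-filter⁻ (λ j → ¬? (colour i ℕ.≟ colour j) ×-dec SimpleGraph.adj? (Γᵘ n) i j) {xs = allFin _} j∈)))

  module _ (m′ k : ℕ) (large : 4 + 8 * 8 ^ k + 8 * (8 ^ k * 8 ^ k) ≤ suc m′) where
    open Cyclic m′

    -- Twice the left side is 4 + 8 s + 8 s s′ + 8 q s with q = m′ / s′. The first three terms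
    -- together are at most N by `large`, and 8 s ≤ s′ turns the last into q s′ ≤ N.
    separated : ∀ {t t′} → t < t′ → t′ ≤ k → 2 * suc (Graph.diameter (8 ^ t′) {{m^n≢0 8 t′}} * 8 ^ t) ≤ N
    separated {t} {t′} t<t′ t′≤k = *-cancelˡ-≤ 2 (begin
        2 * (2 * suc ((2 + (q * 2 + s′ * 2)) * s))
          ≡⟨ solve 3 (λ q s s′ → con 2 :* (con 2 :* (con 1 :+ (con 2 :+ (q :* con 2 :+ s′ :* con 2)) :* s))
               := con 4 :+ con 8 :* s :+ con 8 :* (s :* s′) :+ q :* (con 8 :* s)) refl q s s′ ⟩
        4 + 8 * s + 8 * (s * s′) + q * (8 * s)
          ≤⟨ +-mono-≤ (+-mono-≤ (+-monoʳ-≤ 4 (*-monoʳ-≤ 8 s≤S)) (*-monoʳ-≤ 8 (*-mono-≤ s≤S s′≤S))) (*-monoʳ-≤ q 8s≤s′) ⟩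
        4 + 8 * S + 8 * (S * S) + q * s′
          ≤⟨ +-mono-≤ large (≤-trans (m/n*n≤m m′ s′) (n≤1+n m′)) ⟩
        N + N
          ≡⟨ cong (N +_) (sym (+-identityʳ N)) ⟩
        2 * N ∎)
      where
      open ≤-Reasoning
      open +-*-Solver
      s s′ S : ℕ
      s = 8 ^ t
      s′ = 8 ^ t′
      S = 8 ^ k
      instance
        s′-nonZero : NonZero s′
        s′-nonZero = m^n≢0 8 t′
      q : ℕ
      q = m′ / s′
      8s≤s′ : 8 * s ≤ s′
      8s≤s′ = ^-monoʳ-≤ 8 t<t′
      s≤S : s ≤ S
      s≤S = ^-monoʳ-≤ 8 (≤-trans (<⇒≤ t<t′) t′≤k)
      s′≤S : s′ ≤ S
      s′≤S = ^-monoʳ-≤ 8 t′≤k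

    circulants-differ : ∀ {t t′} → t ≤ k → t′ ≤ k → Iso (Graph.F (8 ^ t)) (Graph.F (8 ^ t′)) → t ≡ t′
    circulants-differ {t} {t′} t≤k t′≤k φ with <-cmp t t′
    ... | tri< t<t′ _ _ = contradiction φ (not-isomorphic (8 ^ t) (8 ^ t′) {{m^n≢0 8 t′}} (m^n>0 8 t) (separated t<t′ t′≤k))
    ... | tri≈ _ t≡t′ _ = t≡t′
    ... | tri> _ _ t′<t = contradiction (Iso-sym φ) (not-isomorphic (8 ^ t′) (8 ^ t) {{m^n≢0 8 t}} (m^n>0 8 t′) (separated t′<t t≤k))

    realised : ∀ {e} → N * 3 ≡ e → ∀ t →
      Σ[ G ∈ Multigraph (N * 2) e ] (Cubic G × (∀ u v → mult G u v ≡ Graph.F (8 ^ t) u v))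
    realised refl t = Graph.G (8 ^ t) , Graph.cubic (8 ^ t) {{m^n≢0 8 t}} , Graph.mult-G (8 ^ t)

    -- Rotating back by the position of w brings it to index 0 on its own side.
    two-orbits : ∀ s w → Σ[ φ ∈ Iso (Graph.F s) (Graph.F s) ] Iso.π φ ⟨$⟩ʳ w ∈ a zero ∷ b zero ∷ []
    two-orbits s w = Graph.rotation-iso s (toℕ (pos w) * m′) , to-root (side w)
      where
      to-root : ∀ {w} → Side w → rotate (toℕ (pos w) * m′) w ∈ a zero ∷ b zero ∷ []
      to-root (isA i) = here (trans (rotate-a _ i) (cong a (trans (cong (λ j → i ⊞ (toℕ j * m′)) (pos-a i)) (to-zero i))))
      to-root (isB i) = there (here (trans (rotate-b _ i) (cong b (trans (cong (λ j → i ⊞ (toℕ j * m′)) (pos-b i)) (to-zero i)))))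

    -- At t = 0 the parameter is 1, so two kinds of spokes coincide and the graph has double edges;
    -- it is a cubic multigraph like the others.
    circulants : Family (N * 2) k
    circulants = record
      { F              = λ t → Graph.F (8 ^ t)
      ; realised       = realised (edgeCount-even N)
      ; differ         = circulants-differ
      ; few-neighbours = λ t → neighbours-bound (Graph.F (8 ^ t)) (Graph.deg-F (8 ^ t)) (a zero) (b zero) (two-orbits (8 ^ t)) }

  unlabelled : ∀ k q {n} → n ≡ q * 2 → 4 + 8 * 8 ^ k + 8 * (8 ^ k * 8 ^ k) ≤ q →
    KthLaplacianEigenvalue≤ (Γᵘ n) (suc k) (fromℤ (ℤ.+ (54 + 54)))
  unlabelled k (suc m′) n≡ large = unlabelled-bound (subst (λ n → Family n k) (sym n≡) (circulants m′ k large))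

-- Both cases combined.

import Data.Integer.Base as ℤ
open import Data.Nat.Base using (_^_)
open import Data.Nat.Divisibility using (_∣_; divides)
open LabelledSpectrum
open UnlabelledSpectrum

theorem1p1 : ∀ (k : ℕ) → 1 ≤ k →
    ∃[ cˡ ] ∃[ cᵘ ] ∃[ n₀ ] (∀ (n : ℕ) → 2 ∣ n → n₀ ≤ n →
    KthLaplacianEigenvalue≤ (Γˡ n) k cˡ × KthLaplacianEigenvalue≤ (Γᵘ n) k cᵘ)
theorem1p1 (suc k) _ = fromℤ (ℤ.+ ((162 + 9 * k) + (162 + 9 * k))) , fromℤ (ℤ.+ (54 + 54))
  -- The sum of the labelled and the unlabelled threshold for n/2 serves in place of their maximum.
  , (4 + k + (4 + 8 * 8 ^ k + 8 * (8 ^ k * 8 ^ k))) * 2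
  , λ { n (divides q n≡) n₀≤n →
      let q₀≤q = *-cancelʳ-≤ _ q 2 (subst (_ ≤_) n≡ n₀≤n) in
      labelled k q n≡ (≤-trans (m≤m+n (4 + k) _) q₀≤q) , unlabelled k q n≡ (≤-trans (m≤n+m _ (4 + k)) q₀≤q) }
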